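{- None of the following parameterized problems has a polynomial kernel unless $\mathrm{coNP}\subseteq\mathrm{NP}/\mathrm{poly}$: (1) \textsc{Embedding}; (2) \textsc{Poset $\exists$-FO-Model Checking}; (3) \textsc{Poset FO-Model Checking}.
   Context: Posets are finite; the width of a poset is the maximum size of a set of pairwise incomparable elements. An embedding from $\mathcal{Q}=(Q,\leq^Q)$ into $\mathcal{P}=(P,\leq^P)$ is an injective map $e:Q\to P$ with $q\leq^Q q'$ iff $e(q)\leq^P e(q')$. \textsc{Embedding}: given posets $\mathcal{Q},\mathcal{P}$, decide whether there is an embedding from $\mathcal{Q}$ into $\mathcal{P}$; parameters $\mathrm{width}(\mathcal{P})$ and $|Q|$. Formulas are first-order over the vocabulary with a single binary relation $\leq$ and equality. \textsc{Poset $\exists$-FO-Model Checking}: given an existential FO sentence $\phi$ (prefix normal form, only existential quantifiers, negations only on atoms) and a poset $\mathcal{P}$, decide $\mathcal{P}\models\phi$; parameters $\mathrm{width}(\mathcal{P})$ and $|\phi|$. \textsc{Poset FO-Model Checking} is the same problem for arbitrary FO sentences. A polynomial kernel is a polynomial-time algorithm mapping an instance $(x,k)$ to an equivalent instance $(x',k')$ with $|x'|,k'$ bounded by a polynomial in $k$. -}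

module Defs where

open import Data.Bool.Base using (Bool; true; false; T)
open import Data.Fin.Base using (Fin; zero; suc; toℕ)
open import Data.Fin.Subset using (Subset; _∈_; ∣_∣)
open import Data.List.Base using (List; []; _∷_; _++_; length; map; concatMap; allFin; replicate; foldr)
open import Data.Maybe.Base using (Maybe; just; nothing)
open import Data.Nat.Base using (ℕ; zero; suc; _+_; _*_; _≤_)
open import Data.Product.Base using (Σ; Σ-syntax; ∃; ∃-syntax; _×_; _,_)
open import Data.Sum.Base using (_⊎_)
open import Data.Vec.Base as Vec using (Vec)
open import Data.Vec.Functional as Vector using (Vector)
open import Function.Bundles using (_⇔_)
open import Level using (0ℓ) renaming (suc to lsuc)
open import Relation.Binary.Core using (Rel)
open import Relation.Binary.Morphism.Structures using (IsOrderMonomorphism)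
open import Relation.Binary.PropositionalEquality.Core using (_≡_; _≢_)
open import Relation.Binary.Structures using (IsPartialOrder)
open import Relation.Nullary.Negation.Core using (¬_)
open import Relation.Unary using (Pred; U; ∁; _≐_)

------------------------------------------------------------------------
-- Words and their encodings

Word : Set
Word = List Bool

-- Every bit of the first component is preceded by true; a false marks
-- where the second component starts.
⟨_,_⟩ : Word → Word → Word
⟨ []    , v ⟩ = false ∷ v
⟨ b ∷ u , v ⟩ = true ∷ b ∷ ⟨ u , v ⟩

encodePair : Word × Word → Word
encodePair (u , v) = ⟨ u , v ⟩

encodeBit : Bool → Word
encodeBit b = b ∷ []

-- The number n in unary, self-delimiting.
unary : ℕ → Word
unary n = replicate n true ++ false ∷ []

-- Coefficient lists, constant term first.
Polynomial : Set
Polynomial = List ℕ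

⟦_⟧ : Polynomial → ℕ → ℕ
⟦ p ⟧ n = foldr (λ a r → a + n * r) 0 p

------------------------------------------------------------------------
-- Deterministic multi-tape Turing machines

data Symbol (g : ℕ) : Set where
  blank : Symbol g
  bit   : Bool → Symbol g
  extra : Fin g → Symbol g

data Move : Set where
  left stay right : Move

-- A transition value of nothing means that the machine halts.
record TM : Set where
  field
    extraStates  : ℕ
    extraTapes   : ℕ
    extraSymbols : ℕ

  State : Set
  State = Fin (suc extraStates)

  Γ : Set
  Γ = Symbol extraSymbols

  Tapes : Set → Set
  Tapes A = Vec A (suc extraTapes)

  field
    δ : State → Tapes Γ → Maybe (State × Tapes (Γ × Move))

-- A two-way infinite tape. Both lists start with the cell next to the
-- head, and all cells beyond the ends of the lists are blank.
record Tape (g : ℕ) : Set where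
  constructor tape
  field
    before : List (Symbol g)
    head   : Symbol g
    after  : List (Symbol g)

module _ {g : ℕ} where

  act : Tape g → Symbol g × Move → Tape g
  act (tape []       _ rs)       (s , left)  = tape [] blank (s ∷ rs)
  act (tape (l ∷ ls) _ rs)       (s , left)  = tape ls l (s ∷ rs)
  act (tape ls       _ rs)       (s , stay)  = tape ls s rs
  act (tape ls       _ [])       (s , right) = tape (s ∷ ls) blank []
  act (tape ls       _ (r ∷ rs)) (s , right) = tape (s ∷ ls) r rs

  emptyTape : Tape g
  emptyTape = tape [] blank []

  inputTape : Word → Tape g
  inputTape []      = emptyTape
  inputTape (b ∷ w) = tape [] (bit b) (map bit w)

  leadingBits : List (Symbol g) → Word
  leadingBits (bit b ∷ ss) = b ∷ leadingBits ss
  leadingBits _            = []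

  -- The word that starts under the head and extends to the right up to
  -- the first cell that does not hold a bit.
  outputWord : Tape g → Word
  outputWord (tape _ s rs) = leadingBits (s ∷ rs)

module _ (M : TM) where
  open TM M

  Config : Set
  Config = State × Tapes (Tape extraSymbols)

  step : Config → Maybe Config
  step (q , ts) with δ q (Vec.map Tape.head ts)
  ... | nothing        = nothing
  ... | just (q′ , as) = just (q′ , Vec.zipWith act ts as)

  initial : Word → Config
  initial w = zero , inputTape w Vec.∷ Vec.replicate extraTapes emptyTape

  result : Config → Word
  result (_ , ts) = outputWord (Vec.head ts)

  data HaltsIn : ℕ → Config → Config → Set where
    halt : ∀ {c} → step c ≡ nothing → HaltsIn 0 c c
    next : ∀ {t c c′ d} → step c ≡ just c′ → HaltsIn t c′ d → HaltsIn (suc t) c d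

  OutputsWithin : ℕ → Word → Word → Set
  OutputsWithin n w v =
    ∃[ t ] ∃[ d ] t ≤ n × HaltsIn t (initial w) d × result d ≡ v

-- The function f is computable in polynomial time with respect to the
-- given encodings of its arguments and values.
PolyTime : {A B : Set} → (A → Word) → (B → Word) → (A → B) → Set
PolyTime encA encB f =
  Σ[ M ∈ TM ] Σ[ p ∈ Polynomial ]
    (∀ a → OutputsWithin M (⟦ p ⟧ (length (encA a))) (encA a) (encB (f a)))

------------------------------------------------------------------------
-- Complexity classes

Language : Set₁
Language = Pred Word 0ℓ

Class : Set₂
Class = Pred Language (lsuc 0ℓ)

record InNP (L : Language) : Set₁ where
  field
    verify     : Word × Word → Bool
    verifyPoly : PolyTime encodePair encodeBit verify
    bound      : Polynomial
    correct    : ∀ x → L x ⇔ (∃[ y ] length y ≤ ⟦ bound ⟧ (length x) × verify (x , y) ≡ true)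

NP : Class
NP = InNP

coNP : Class
coNP L = Σ[ L′ ∈ Language ] NP L′ × L ≐ ∁ L′

record InNP/poly (L : Language) : Set₁ where
  field
    L′          : Language
    L′∈NP       : NP L′
    advice      : ℕ → Word
    bound       : Polynomial
    adviceBound : ∀ n → length (advice n) ≤ ⟦ bound ⟧ n
    correct     : ∀ x → L x ⇔ L′ ⟨ x , advice (length x) ⟩

NP/poly : Class
NP/poly = InNP/poly

------------------------------------------------------------------------
-- Parameterized problems and polynomial kernels

-- The set of yes-instances (x , k).
ParameterizedProblem : Set₁
ParameterizedProblem = Pred (Word × ℕ) 0ℓ

encodeInstance : Word × ℕ → Word
encodeInstance (x , k) = ⟨ x , replicate k true ⟩

record PolynomialKernel (Π : ParameterizedProblem) : Set where
  field
    kernel     : Word × ℕ → Word × ℕ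
    kernelPoly : PolyTime encodeInstance encodeInstance kernel
    bound      : Polynomial
    equivalent : ∀ x k → Π (x , k) ⇔ Π (kernel (x , k))
    small      : ∀ x k → let (x′ , k′) = kernel (x , k) in
                 length x′ ≤ ⟦ bound ⟧ k × k′ ≤ ⟦ bound ⟧ k

------------------------------------------------------------------------
-- Finite posets

record Poset : Set where
  field
    size : ℕ
    leq  : Fin size → Fin size → Bool

  Carrier : Set
  Carrier = Fin size

  _≼_ : Rel Carrier 0ℓ
  i ≼ j = T (leq i j)

  field
    isPartialOrder : IsPartialOrder _≡_ _≼_

  Antichain : Subset size → Set
  Antichain S = ∀ i j → i ∈ S → j ∈ S → i ≢ j → ¬ (i ≼ j ⊎ j ≼ i)

  HasWidth : ℕ → Set
  HasWidth w = (∃[ S ] Antichain S × ∣ S ∣ ≡ w) × (∀ S → Antichain S → ∣ S ∣ ≤ w)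

-- The size in unary followed by the rows of the order matrix.
encodePoset : Poset → Word
encodePoset P = unary size ++ concatMap (λ i → map (leq i) (allFin size)) (allFin size)
  where open Poset P

_Embeds_ : Poset → Poset → Set
Q Embeds P = ∃ (IsOrderMonomorphism _≡_ _≡_ (Poset._≼_ Q) (Poset._≼_ P))

------------------------------------------------------------------------
-- First-order formulas over one binary relation and equality

-- Formula n has its free variables among n de Bruijn indices; sentences
-- are the elements of Formula 0.
data Formula (n : ℕ) : Set where
  leF eqF   : Fin n → Fin n → Formula n
  notF      : Formula n → Formula n
  andF orF  : Formula n → Formula n → Formula n
  exF allF  : Formula (suc n) → Formula n

Sentence : Set
Sentence = Formula 0

data Atomic {n : ℕ} : Pred (Formula n) 0ℓ where
  le : ∀ {x y} → Atomic (leF x y)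
  eq : ∀ {x y} → Atomic (eqF x y)

-- Quantifier-free with negations only on atoms.
data Matrix {n : ℕ} : Pred (Formula n) 0ℓ where
  pos  : ∀ {φ} → Atomic φ → Matrix φ
  neg  : ∀ {φ} → Atomic φ → Matrix (notF φ)
  conj : ∀ {φ ψ} → Matrix φ → Matrix ψ → Matrix (andF φ ψ)
  disj : ∀ {φ ψ} → Matrix φ → Matrix ψ → Matrix (orF φ ψ)

data Existential {n : ℕ} : Pred (Formula n) 0ℓ where
  matrix : ∀ {φ} → Matrix φ → Existential φ
  ex     : ∀ {φ} → Existential {suc n} φ → Existential (exF φ)

module _ (P : Poset) where
  open Poset P

  Satisfies : ∀ {n} → Vector Carrier n → Formula n → Set
  Satisfies ρ (leF x y)  = ρ x ≼ ρ y
  Satisfies ρ (eqF x y)  = ρ x ≡ ρ y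
  Satisfies ρ (notF φ)   = ¬ Satisfies ρ φ
  Satisfies ρ (andF φ ψ) = Satisfies ρ φ × Satisfies ρ ψ
  Satisfies ρ (orF φ ψ)  = Satisfies ρ φ ⊎ Satisfies ρ ψ
  Satisfies ρ (exF φ)    = ∃[ a ] Satisfies (a Vector.∷ ρ) φ
  Satisfies ρ (allF φ)   = ∀ a → Satisfies (a Vector.∷ ρ) φ

_⊨_ : Poset → Sentence → Set
P ⊨ φ = Satisfies P Vector.[] φ

-- Prefix notation with a three-bit tag per constructor.
encodeFormula : ∀ {n} → Formula n → Word
encodeFormula (leF x y)  = false ∷ false ∷ false ∷ unary (toℕ x) ++ unary (toℕ y)
encodeFormula (eqF x y)  = false ∷ false ∷ true  ∷ unary (toℕ x) ++ unary (toℕ y)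
encodeFormula (notF φ)   = false ∷ true  ∷ false ∷ encodeFormula φ
encodeFormula (andF φ ψ) = false ∷ true  ∷ true  ∷ encodeFormula φ ++ encodeFormula ψ
encodeFormula (orF φ ψ)  = true  ∷ false ∷ false ∷ encodeFormula φ ++ encodeFormula ψ
encodeFormula (exF φ)    = true  ∷ false ∷ true  ∷ encodeFormula φ
encodeFormula (allF φ)   = true  ∷ true  ∷ false ∷ encodeFormula φ

∣_∣ᶠ : Sentence → ℕ
∣ φ ∣ᶠ = length (encodeFormula φ)

------------------------------------------------------------------------
-- The parameterized problems. Two parameters are combined by addition,
-- and k has to be the actual parameter of the encoded instance.

Embedding : ParameterizedProblem
Embedding (x , k) =
  Σ[ Q ∈ Poset ] Σ[ P ∈ Poset ] ∃[ w ]
    x ≡ ⟨ encodePoset Q , encodePoset P ⟩ × Poset.HasWidth P w ×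
    k ≡ w + Poset.size Q × Q Embeds P

ModelChecking : Pred Sentence 0ℓ → ParameterizedProblem
ModelChecking Φ (x , k) =
  Σ[ φ ∈ Sentence ] Σ[ P ∈ Poset ] ∃[ w ]
    Φ φ × x ≡ ⟨ encodeFormula φ , encodePoset P ⟩ × Poset.HasWidth P w ×
    k ≡ w + ∣ φ ∣ᶠ × P ⊨ φ

Poset-∃FO-ModelChecking : ParameterizedProblem
Poset-∃FO-ModelChecking = ModelChecking Existential

Poset-FO-ModelChecking : ParameterizedProblem
Poset-FO-ModelChecking = ModelChecking U

{-# OPTIONS --safe #-}

-- Let L′ ∈ NP. For every input length the computations of a verifier for L′
-- form a constraint satisfaction problem in which the input occurs only in
-- literals. Such a problem is a poset embedding problem: its variables are
-- told apart by a long chain, and a height-two part of the order encodes the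
-- constraints. The linear sum of t such posets contains the pattern iff one
-- of them does, while its width and the pattern do not depend on t. So t
-- inputs are combined into a single instance with parameter poly(n).
--
-- The size of a polynomial kernel of this instance is bounded independently of
-- t, so there are fewer than 2 ^ t kernels for a suitable t. By a covering argument (Fortnow and
-- Santhanam) n + 1 kernels of tuples of no-instances suffice for every
-- no-instance x to occur in a tuple that has one of these kernels. With these
-- kernels as advice, membership of x in the complement of L′ is witnessed by
-- such a tuple. All that depends only on n is put into the advice, which takes
-- the form of a script, so that the verifying machine merely interprets the
-- script, runs the kernelization and compares.

module Submission where

open import Defs
open import Data.Bool.Base using (Bool; true; false; T; not; _xor_; if_then_else_)
import Data.Bool.Properties as 𝔹
open import Data.Empty using (⊥; ⊥-elim)
open import Data.Fin.Base as Fin using (Fin; zero; suc; toℕ)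
import Data.Fin.Properties as Fin
import Data.Fin.Subset as Subset
open import Data.List.Base as List using (List; []; _∷_; _++_; length; map; concatMap; concat; allFin; replicate; reverse; _ʳ++_; cartesianProduct; cartesianProductWith; upTo)
import Data.List.Properties as List
open import Data.List.Membership.Propositional using (_∈_; find; lose)
open import Data.List.Membership.Propositional.Properties
open import Data.List.Relation.Unary.All as All using (All; []; _∷_)
import Data.List.Relation.Unary.All.Properties as All
open import Data.List.Relation.Unary.Any as Any using (Any; here; there)
import Data.List.Relation.Unary.Any.Properties as Any
open import Data.Maybe.Base using (Maybe; just; nothing)
import Data.Maybe.Base as Maybe
open import Data.Nat.Base using (ℕ; zero; suc; _+_; _*_; _^_; _∸_; _≤_; _<_; z≤n; s≤s; s≤s⁻¹)
import Data.Nat.Properties as ℕ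
open import Data.Nat.Tactic.RingSolver using (solve-∀)
open import Data.Product.Base using (∃; ∃-syntax; _×_; _,_; proj₁; proj₂; uncurry)
import Data.Product.Properties as Product
open import Data.Sum.Base using (_⊎_; inj₁; inj₂; [_,_]′)
import Data.Sum.Properties as Sum
open import Data.Sum.Function.Propositional using (_⊎-↔_)
open import Data.Product.Function.NonDependent.Propositional using (_×-↔_)
open import Data.Unit.Base using (tt)
open import Data.Vec.Base as Vec using (Vec; []; _∷_)
import Data.Vec.Properties as Vec
open import Data.Vec.Functional as Vector using (Vector)
open import Function.Base using (_∘_; id; const)
open import Function.Bundles using (_⇔_; _↔_; Equivalence; Inverse; mk⇔)
open import Function.Construct.Composition using (_↔-∘_)
open import Function.Construct.Identity using (↔-id)
open import Relation.Binary.PropositionalEquality.Properties using (isEquivalence)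
open import Relation.Binary.PropositionalEquality using (_≡_; _≢_; refl; sym; trans; cong; cong₂; subst; subst₂; module ≡-Reasoning)
open import Relation.Binary.Definitions using (tri<; tri≈; tri>)
open import Relation.Binary.Structures using (IsPartialOrder)
open import Relation.Binary.Morphism.Structures using (IsOrderMonomorphism)
open import Relation.Nullary using (¬_; Dec; yes; no; contradiction)
open import Relation.Nullary.Decidable using (⌊_⌋; map′; _×-dec_; _→-dec_)
open import Relation.Unary using (_⊆_; ∁; _≐_; U)

-- Polynomial bounds

-- The argument lives on no-instances: a tuple that shares its kernel with a tuple of no-instances
-- has no yes-instance among its components, so the guessed companions of an input never have to be
-- checked. The poset must hide the number of inputs. Elements of different blocks of a linear sum
-- are comparable, hence an antichain stays inside one block, and so does the pattern, whose
-- incomparability graph is connected. Since the exact width belongs to the instance while the width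
-- of a block may vary with its input, an antichain as large as a block is added as one more block.
-- The chain can tell variables apart only if every embedding fixes it. A rank function with as many
-- values as the chain has elements enforces this. Polynomial time means an explicit Turing machine.
-- That each bit of the composed instance is a constant or a single, possibly negated, input bit
-- keeps the interpreter small: it only moves heads, copies bits and negates them.

Polynomial-mono : ∀ p {m n} → m ≤ n → ⟦ p ⟧ m ≤ ⟦ p ⟧ n
Polynomial-mono []      m≤n = z≤n
Polynomial-mono (a ∷ p) m≤n = ℕ.+-monoʳ-≤ a (ℕ.*-mono-≤ m≤n (Polynomial-mono p m≤n))

_⊕_ : Polynomial → Polynomial → Polynomial
[]      ⊕ q       = q
(a ∷ p) ⊕ []      = a ∷ p
(a ∷ p) ⊕ (b ∷ q) = a + b ∷ p ⊕ q

⊕-sem : ∀ p q n → ⟦ p ⊕ q ⟧ n ≡ ⟦ p ⟧ n + ⟦ q ⟧ n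
⊕-sem []      q       n = refl
⊕-sem (a ∷ p) []      n = sym (ℕ.+-identityʳ _)
⊕-sem (a ∷ p) (b ∷ q) n rewrite ⊕-sem p q n = lemma a b n (⟦ p ⟧ n) (⟦ q ⟧ n)
  where
  lemma : ∀ a b n x y → a + b + n * (x + y) ≡ a + n * x + (b + n * y)
  lemma = solve-∀

scale : ℕ → Polynomial → Polynomial
scale c = map (c *_)

scale-sem : ∀ c p n → ⟦ scale c p ⟧ n ≡ c * ⟦ p ⟧ n
scale-sem c []      n = sym (ℕ.*-zeroʳ c)
scale-sem c (a ∷ p) n rewrite scale-sem c p n = lemma c a n (⟦ p ⟧ n)
  where
  lemma : ∀ c a n x → c * a + n * (c * x) ≡ c * (a + n * x)
  lemma = solve-∀

_⊛_ : Polynomial → Polynomial → Polynomial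
[]      ⊛ q = []
(a ∷ p) ⊛ q = scale a q ⊕ (0 ∷ (p ⊛ q))

⊛-sem : ∀ p q n → ⟦ p ⊛ q ⟧ n ≡ ⟦ p ⟧ n * ⟦ q ⟧ n
⊛-sem []      q n = refl
⊛-sem (a ∷ p) q n
  rewrite ⊕-sem (scale a q) (0 ∷ (p ⊛ q)) n | scale-sem a q n | ⊛-sem p q n =
  lemma a n (⟦ p ⟧ n) (⟦ q ⟧ n)
  where
  lemma : ∀ a n x y → a * y + n * (x * y) ≡ (a + n * x) * y
  lemma = solve-∀

_∘ᴾ_ : Polynomial → Polynomial → Polynomial
[]      ∘ᴾ q = []
(a ∷ p) ∘ᴾ q = (a ∷ []) ⊕ (q ⊛ (p ∘ᴾ q))

∘ᴾ-sem : ∀ p q n → ⟦ p ∘ᴾ q ⟧ n ≡ ⟦ p ⟧ (⟦ q ⟧ n)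
∘ᴾ-sem []      q n = refl
∘ᴾ-sem (a ∷ p) q n
  rewrite ⊕-sem (a ∷ []) (q ⊛ (p ∘ᴾ q)) n | ⊛-sem q (p ∘ᴾ q) n | ∘ᴾ-sem p q n
        | ℕ.*-zeroʳ n | ℕ.+-identityʳ a = refl

record PolyBounded (f : ℕ → ℕ) : Set where
  constructor polyBounded
  field
    poly   : Polynomial
    bounds : ∀ n → f n ≤ ⟦ poly ⟧ n

open PolyBounded

pb-≤ : ∀ {f g} → (∀ n → f n ≤ g n) → PolyBounded g → PolyBounded f
pb-≤ f≤g (polyBounded p b) = polyBounded p (λ n → ℕ.≤-trans (f≤g n) (b n))

pb-poly : ∀ p → PolyBounded ⟦ p ⟧
pb-poly p = polyBounded p (λ _ → ℕ.≤-refl)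

pb-const : ∀ c → PolyBounded (const c)
pb-const c = polyBounded (c ∷ []) (λ n → ℕ.m≤m+n c _)

pb-id : PolyBounded id
pb-id = polyBounded (0 ∷ 1 ∷ []) λ n → ℕ.≤-reflexive (lemma n)
  where
  lemma : ∀ n → n ≡ 0 + n * (1 + n * 0)
  lemma = solve-∀

pb-+ : ∀ {f g} → PolyBounded f → PolyBounded g → PolyBounded (λ n → f n + g n)
pb-+ (polyBounded p b) (polyBounded q c) = polyBounded (p ⊕ q) λ n →
  ℕ.≤-trans (ℕ.+-mono-≤ (b n) (c n)) (ℕ.≤-reflexive (sym (⊕-sem p q n)))

pb-* : ∀ {f g} → PolyBounded f → PolyBounded g → PolyBounded (λ n → f n * g n)
pb-* (polyBounded p b) (polyBounded q c) = polyBounded (p ⊛ q) λ n →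
  ℕ.≤-trans (ℕ.*-mono-≤ (b n) (c n)) (ℕ.≤-reflexive (sym (⊛-sem p q n)))

pb-∘ : ∀ p {f} → PolyBounded f → PolyBounded (λ n → ⟦ p ⟧ (f n))
pb-∘ p (polyBounded q c) = polyBounded (p ∘ᴾ q) λ n →
  ℕ.≤-trans (Polynomial-mono p (c n)) (ℕ.≤-reflexive (sym (∘ᴾ-sem p q n)))

pb-suc : ∀ {f} → PolyBounded f → PolyBounded (suc ∘ f)
pb-suc = pb-+ (pb-const 1)

-- Finite enumerations and the covering argument

length-cartesianProductWith : ∀ {A B C : Set} (f : A → B → C) xs ys →
  length (cartesianProductWith f xs ys) ≡ length xs * length ys
length-cartesianProductWith f []       ys = refl
length-cartesianProductWith f (x ∷ xs) ys
  rewrite List.length-++ (map (f x) ys) {cartesianProductWith f xs ys}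
        | List.length-map (f x) ys
        | length-cartesianProductWith f xs ys = refl

allVecs : ∀ {A : Set} → List A → ∀ n → List (Vec A n)
allVecs xs zero    = [] ∷ []
allVecs xs (suc n) = cartesianProductWith _∷_ xs (allVecs xs n)

length-allVecs : ∀ {A : Set} (xs : List A) n → length (allVecs xs n) ≡ length xs ^ n
length-allVecs xs zero    = refl
length-allVecs xs (suc n) =
  trans (length-cartesianProductWith _∷_ xs (allVecs xs n))
        (cong (length xs *_) (length-allVecs xs n))

∈-allVecs⁺ : ∀ {A : Set} {xs : List A} {n} (v : Vec A n) →
  (∀ i → Vec.lookup v i ∈ xs) → v ∈ allVecs xs n
∈-allVecs⁺ []      h = here refl
∈-allVecs⁺ (x ∷ v) h = ∈-cartesianProductWith⁺ _∷_ (h zero) (∈-allVecs⁺ v (h ∘ suc))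

∈-allVecs⁻ : ∀ {A : Set} {xs : List A} {n} {v : Vec A n} →
  v ∈ allVecs xs n → ∀ i → Vec.lookup v i ∈ xs
∈-allVecs⁻ {xs = xs} {suc n} v∈ i
  with _ , _ , x∈ , w∈ , refl ← ∈-cartesianProductWith⁻ _∷_ xs (allVecs xs n) v∈
  with i
... | zero  = x∈
... | suc i = ∈-allVecs⁻ w∈ i

bits : List Bool
bits = true ∷ false ∷ []

∈-bits : ∀ b → b ∈ bits
∈-bits true  = here refl
∈-bits false = there (here refl)

words≤ : ℕ → List Word
words≤ zero    = [] ∷ []
words≤ (suc m) = [] ∷ cartesianProductWith _∷_ bits (words≤ m)

∈-words≤ : ∀ {m} w → length w ≤ m → w ∈ words≤ m
∈-words≤ {zero}  []      _       = here refl
∈-words≤ {suc m} []      _       = here refl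
∈-words≤ {suc m} (b ∷ w) (s≤s l) = there (∈-cartesianProductWith⁺ _∷_ (∈-bits b) (∈-words≤ w l))

words≤-length : ∀ {m w} → w ∈ words≤ m → length w ≤ m
words≤-length {zero}  (here refl) = z≤n
words≤-length {suc m} (here refl) = z≤n
words≤-length {suc m} (there w∈)
  with _ , _ , _ , v∈ , refl ← ∈-cartesianProductWith⁻ _∷_ bits (words≤ m) w∈ = s≤s (words≤-length v∈)

length-words≤ : ∀ m → length (words≤ m) < 2 ^ suc m
length-words≤ zero    = s≤s (s≤s z≤n)
length-words≤ (suc m) = begin
  2 + length (cartesianProductWith _∷_ bits (words≤ m))
    ≡⟨ cong (2 +_) (length-cartesianProductWith _∷_ bits (words≤ m)) ⟩
  2 + 2 * length (words≤ m)   ≡⟨ ℕ.*-suc 2 (length (words≤ m)) ⟨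
  2 * suc (length (words≤ m)) ≤⟨ ℕ.*-monoʳ-≤ 2 (length-words≤ m) ⟩
  2 * 2 ^ suc m               ∎
  where open ℕ.≤-Reasoning

module _ {A : Set} where

  count : (A → Bool) → List A → ℕ
  count p []       = 0
  count p (x ∷ xs) = (if p x then 1 else 0) + count p xs

  select : (A → Bool) → List A → List A
  select p []       = []
  select p (x ∷ xs) = if p x then x ∷ select p xs else select p xs

  length-select : ∀ p xs → length (select p xs) ≡ count p xs
  length-select p []       = refl
  length-select p (x ∷ xs) with p x
  ... | true  = cong suc (length-select p xs)
  ... | false = length-select p xs

  count-not : ∀ p xs → count p xs + count (not ∘ p) xs ≡ length xs
  count-not p []       = refl
  count-not p (x ∷ xs) with p x
  ... | true  = cong suc (count-not p xs)
  ... | false = trans (ℕ.+-suc _ _) (cong suc (count-not p xs))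

  ∈-select⁺ : ∀ p {x xs} → x ∈ xs → p x ≡ true → x ∈ select p xs
  ∈-select⁺ p {xs = x ∷ xs} (here refl) px rewrite px = here refl
  ∈-select⁺ p {xs = y ∷ xs} (there x∈)  px with p y
  ... | true  = there (∈-select⁺ p x∈ px)
  ... | false = ∈-select⁺ p x∈ px

  ∈-select⁻ : ∀ p xs {x} → x ∈ select p xs → x ∈ xs × p x ≡ true
  ∈-select⁻ p (y ∷ xs) x∈ with p y in py
  ∈-select⁻ p (y ∷ xs) (here refl) | true = here refl , py
  ∈-select⁻ p (y ∷ xs) (there x∈)  | true = let x∈xs , px = ∈-select⁻ p xs x∈ in there x∈xs , px
  ∈-select⁻ p (y ∷ xs) x∈          | false = let x∈xs , px = ∈-select⁻ p xs x∈ in there x∈xs , px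

  sumOver : (A → ℕ) → List A → ℕ
  sumOver f []       = 0
  sumOver f (x ∷ xs) = f x + sumOver f xs

  sumOver-+ : ∀ f g xs → sumOver (λ x → f x + g x) xs ≡ sumOver f xs + sumOver g xs
  sumOver-+ f g []       = refl
  sumOver-+ f g (x ∷ xs) rewrite sumOver-+ f g xs = lemma (f x) (g x) (sumOver f xs) (sumOver g xs)
    where
    lemma : ∀ a b c d → a + b + (c + d) ≡ a + c + (b + d)
    lemma = solve-∀

  sumOver-≤ : ∀ f c xs → (∀ {x} → x ∈ xs → 2 * f x ≤ c) → 2 * sumOver f xs ≤ length xs * c
  sumOver-≤ f c []       h = z≤n
  sumOver-≤ f c (x ∷ xs) h rewrite ℕ.*-distribˡ-+ 2 (f x) (sumOver f xs) =
    ℕ.+-mono-≤ (h (here refl)) (sumOver-≤ f c xs (h ∘ there))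

  sumOver-≥ : ∀ f c xs → (∀ {x} → x ∈ xs → c ≤ 2 * f x) → length xs * c ≤ 2 * sumOver f xs
  sumOver-≥ f c []       h = z≤n
  sumOver-≥ f c (x ∷ xs) h rewrite ℕ.*-distribˡ-+ 2 (f x) (sumOver f xs) =
    ℕ.+-mono-≤ (h (here refl)) (sumOver-≥ f c xs (h ∘ there))

  count≡sumOver : ∀ p xs → count p xs ≡ sumOver (λ x → if p x then 1 else 0) xs
  count≡sumOver p []       = refl
  count≡sumOver p (x ∷ xs) = cong (_ +_) (count≡sumOver p xs)

  search : ∀ {P : A → Set} → (∀ x → Dec (P x)) → ∀ xs →
    (∃[ x ] x ∈ xs × P x) ⊎ (∀ {x} → x ∈ xs → ¬ P x)
  search P? xs with Any.any? P? xs
  ... | yes p = inj₁ (find p)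
  ... | no ¬p = inj₂ (λ x∈ px → ¬p (lose x∈ px))

double-counting : ∀ {X Z : Set} (B : X → Z → Bool) xs zs →
  sumOver (λ x → count (B x) zs) xs ≡ sumOver (λ z → count (λ x → B x z) xs) zs
double-counting B []       zs = sym (zero-sum zs)
  where
  zero-sum : ∀ zs → sumOver (λ _ → 0) zs ≡ 0
  zero-sum []       = refl
  zero-sum (_ ∷ zs) = zero-sum zs
double-counting B (x ∷ xs) zs = begin
  count (B x) zs + sumOver (λ x′ → count (B x′) zs) xs
    ≡⟨ cong₂ _+_ (count≡sumOver (B x) zs) (double-counting B xs zs) ⟩
  sumOver (λ z → if B x z then 1 else 0) zs + sumOver (λ z → count (λ x′ → B x′ z) xs) zs
    ≡⟨ sumOver-+ _ _ zs ⟨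
  sumOver (λ z → count (λ x′ → B x′ z) (x ∷ xs)) zs ∎
  where open ≡-Reasoning

halve : ∀ {a b n} → 2 * a ≤ b → b < 2 ^ suc n → a < 2 ^ n
halve {a} {b} {n} 2a≤b b< = ℕ.*-cancelˡ-< 2 a (2 ^ n) (ℕ.≤-<-trans 2a≤b b<)

-- Either some z covers half of the remaining xs, or, by double counting, some
-- x lies in at most half of the remaining z's; each step halves one of the two lists.
cover-or-escape : ∀ {X Z : Set} (B : X → Z → Bool) s t (xs : List X) (zs : List Z) →
  length xs < 2 ^ s → length zs < 2 ^ t →
  (∃[ v ] v ∈ allVecs xs t × (∀ {z} → z ∈ zs → ∃[ i ] B (Vec.lookup v i) z ≡ false)) ⊎
  (∃[ cs ] length cs ≤ s × (∀ {z} → z ∈ cs → z ∈ zs) × (∀ {x} → x ∈ xs → ∃[ z ] z ∈ cs × B x z ≡ true))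
cover-or-escape B s       t       []            zs ls lt = inj₂ ([] , z≤n , (λ ()) , λ ())
cover-or-escape B zero    t       (x ∷ xs)      zs (s≤s ()) lt
cover-or-escape B (suc s) zero    (x ∷ xs)      [] ls lt = inj₁ ([] , here refl , λ ())
cover-or-escape B (suc s) zero    (x ∷ xs)      (_ ∷ zs) ls (s≤s ())
cover-or-escape B (suc s) (suc t) xs₀@(_ ∷ xs) zs ls lt
  with search (λ x → 2 * count (B x) zs ℕ.≤? length zs) xs₀
... | inj₁ (x , x∈ , few)
  with cover-or-escape B (suc s) t xs₀ (select (B x) zs) ls
         (subst (_< 2 ^ t) (sym (length-select (B x) zs)) (halve {n = t} few lt))
...   | inj₂ (cs , l , sub , cov) = inj₂ (cs , l , (λ z∈ → proj₁ (∈-select⁻ (B x) zs (sub z∈))) , cov)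
...   | inj₁ (v , v∈ , esc) = inj₁ (x ∷ v , ∈-cartesianProductWith⁺ _∷_ x∈ v∈ , esc′)
  where
  esc′ : ∀ {z} → z ∈ zs → ∃[ i ] B (Vec.lookup (x ∷ v) i) z ≡ false
  esc′ {z} z∈ with B x z in eqn
  ... | false = zero , eqn
  ... | true  = let i , e = esc (∈-select⁺ (B x) z∈ eqn) in suc i , e
cover-or-escape B (suc s) (suc t) xs₀@(_ ∷ xs) zs ls lt
    | inj₂ ¬few
  with search (λ z → length xs₀ ℕ.≤? 2 * count (λ x → B x z) xs₀) zs
-- Here every `x` is related to more than half of `zs`, and every `z` to less than half of `xs₀`.
-- The two counts of related pairs clash: the excess of one per `x` makes the inequality strict
-- because `xs₀` is not empty.
... | inj₂ ¬many = contradiction key (ℕ.<⇒≱ strict)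
  where
  l = length xs₀
  key : l * suc (length zs) ≤ length zs * l
  key = begin
    l * suc (length zs)
      ≤⟨ sumOver-≥ (λ x → count (B x) zs) (suc (length zs)) xs₀ (λ x∈ → ℕ.≰⇒> (¬few x∈)) ⟩
    2 * sumOver (λ x → count (B x) zs) xs₀
      ≡⟨ cong (2 *_) (double-counting B xs₀ zs) ⟩
    2 * sumOver (λ z → count (λ x → B x z) xs₀) zs
      ≤⟨ sumOver-≤ (λ z → count (λ x → B x z) xs₀) l zs (λ z∈ → ℕ.<⇒≤ (ℕ.≰⇒> (¬many z∈))) ⟩
    length zs * l ∎
    where open ℕ.≤-Reasoning
  strict : length zs * l < l * suc (length zs)
  strict = subst (_< l * suc (length zs)) (ℕ.*-comm l (length zs))
             (ℕ.*-monoʳ-< l (ℕ.n<1+n (length zs)))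
... | inj₁ (z , z∈ , many)
  with cover-or-escape B s (suc t) (select (λ x → not (B x z)) xs₀) zs shorter lt
  where
  missed = count (λ x → not (B x z)) xs₀
  shorter : length (select (λ x → not (B x z)) xs₀) < 2 ^ s
  shorter = subst (_< 2 ^ s) (sym (length-select (λ x → not (B x z)) xs₀)) (halve {n = s} twice ls)
    where
    twice : 2 * missed ≤ length xs₀
    twice = ℕ.+-cancelˡ-≤ (2 * count (λ x → B x z) xs₀) _ _ (begin
      2 * hit + 2 * missed   ≡⟨ ℕ.*-distribˡ-+ 2 hit missed ⟨
      2 * (hit + missed)     ≡⟨ cong (2 *_) (count-not (λ x → B x z) xs₀) ⟩
      length xs₀ + (length xs₀ + 0) ≡⟨ cong (length xs₀ +_) (ℕ.+-identityʳ _) ⟩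
      length xs₀ + length xs₀ ≤⟨ ℕ.+-monoˡ-≤ (length xs₀) many ⟩
      2 * hit + length xs₀   ∎)
      where
      open ℕ.≤-Reasoning
      hit = count (λ x → B x z) xs₀
...   | inj₁ (v , v∈ , esc) = inj₁ (v , ∈-allVecs⁺ v (λ i → proj₁ (∈-select⁻ (λ x → not (B x z)) xs₀ (∈-allVecs⁻ v∈ i))) , esc)
...   | inj₂ (cs , l , sub , cov) = inj₂ (z ∷ cs , s≤s l , sub′ , cov′)
  where
  sub′ : ∀ {z′} → z′ ∈ z ∷ cs → z′ ∈ zs
  sub′ (here refl)  = z∈
  sub′ (there z′∈) = sub z′∈
  cov′ : ∀ {x} → x ∈ xs₀ → ∃[ z′ ] z′ ∈ z ∷ cs × B x z′ ≡ true
  cov′ {x} x∈ with B x z in eqn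
  ... | true  = z , here refl , eqn
  ... | false = let z′ , z′∈ , e = cov (∈-select⁺ (λ x → not (B x z)) x∈ (cong not eqn)) in z′ , there z′∈ , e

-- Binary constraint satisfaction problems whose unary constraints are literals

data Lit (I : Set) : Set where
  constL : Bool → Lit I
  varL   : Bool → I → Lit I

-- The Boolean of `varL` is a sign: `true` stands for the negated variable.
evalL : ∀ {I} → (I → Bool) → Lit I → Bool
evalL ρ (constL b) = b
evalL ρ (varL b i) = b xor ρ i

-- `compatible` may be asymmetric, since a solution is tested on both orders of a pair; this suits
-- constraints between successive times.
record CSP (n : ℕ) : Set where
  field
    #vars #vals : ℕ
    compatible  : Fin #vars → Fin #vals → Fin #vars → Fin #vals → Bool
    admissible  : Fin #vars → Fin #vals → Lit (Fin n)

  Solution : (Fin n → Bool) → (Fin #vars → Fin #vals) → Set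
  Solution ρ f = (∀ u v → u ≢ v → compatible u (f u) v (f v) ≡ true) ×
                 (∀ u → evalL ρ (admissible u (f u)) ≡ true)

  Satisfiable : (Fin n → Bool) → Set
  Satisfiable ρ = ∃ (Solution ρ)

-- Computations as constraint satisfaction problems

-- Cells are addressed relative to the head.
data Place : Set where
  hd    : Place
  lf rt : ℕ → Place

lf-injective : ∀ {i j} → lf i ≡ lf j → i ≡ j
lf-injective refl = refl

rt-injective : ∀ {i j} → rt i ≡ rt j → i ≡ j
rt-injective refl = refl

_≟ᴾ_ : (p q : Place) → Dec (p ≡ q)
hd   ≟ᴾ hd   = yes refl
hd   ≟ᴾ lf _ = no λ ()
hd   ≟ᴾ rt _ = no λ ()
lf _ ≟ᴾ hd   = no λ ()
lf i ≟ᴾ lf j = map′ (cong lf) lf-injective (i ℕ.≟ j)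
lf _ ≟ᴾ rt _ = no λ ()
rt _ ≟ᴾ hd   = no λ ()
rt _ ≟ᴾ lf _ = no λ ()
rt i ≟ᴾ rt j = map′ (cong rt) rt-injective (i ℕ.≟ j)

distance : Place → ℕ
distance hd     = 0
distance (lf i) = suc i
distance (rt i) = suc i

cell : ℕ → Place
cell zero    = hd
cell (suc i) = rt i

distance-cell : ∀ i → distance (cell i) ≡ i
distance-cell zero    = refl
distance-cell (suc i) = refl

-- Where the cell at a place was before the move.
shift : Move → Place → Place
shift stay  p            = p
shift left  hd           = lf 0
shift left  (lf i)       = lf (suc i)
shift left  (rt zero)    = hd
shift left  (rt (suc i)) = rt i
shift right hd           = rt 0
shift right (rt i)       = rt (suc i)
shift right (lf zero)    = hd
shift right (lf (suc i)) = lf i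

distance-shift : ∀ d p → distance (shift d p) ≤ suc (distance p)
distance-shift stay  p            = ℕ.n≤1+n _
distance-shift left  hd           = ℕ.≤-refl
distance-shift left  (lf i)       = ℕ.≤-refl
distance-shift left  (rt zero)    = z≤n
distance-shift left  (rt (suc i)) = s≤s (ℕ.≤-trans (ℕ.n≤1+n i) (ℕ.n≤1+n _))
distance-shift right hd           = ℕ.≤-refl
distance-shift right (rt i)       = ℕ.≤-refl
distance-shift right (lf zero)    = z≤n
distance-shift right (lf (suc i)) = s≤s (ℕ.≤-trans (ℕ.n≤1+n i) (ℕ.n≤1+n _))

places : ℕ → List Place
places N = hd ∷ map lf (upTo N) ++ map rt (upTo N)

∈-places : ∀ {N} p → distance p ≤ N → p ∈ places N
∈-places hd     _   = here refl
∈-places (lf i) i<N = there (∈-++⁺ˡ (∈-map⁺ lf (∈-upTo⁺ i<N)))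
∈-places {N} (rt i) i<N = there (∈-++⁺ʳ (map lf (upTo N)) (∈-map⁺ rt (∈-upTo⁺ i<N)))

length-places : ∀ N → length (places N) ≡ suc (N + N)
length-places N = cong suc (trans (List.length-++ (map lf (upTo N)))
  (cong₂ _+_ (trans (List.length-map lf (upTo N)) (List.length-upTo N))
             (trans (List.length-map rt (upTo N)) (List.length-upTo N))))

module _ {g : ℕ} where

  bit-injective : ∀ {b c} → bit {g} b ≡ bit c → b ≡ c
  bit-injective refl = refl

  extra-injective : ∀ {i j} → extra {g} i ≡ extra j → i ≡ j
  extra-injective refl = refl

  _≟ˢ_ : (s t : Symbol g) → Dec (s ≡ t)
  blank   ≟ˢ blank   = yes refl
  blank   ≟ˢ bit _   = no λ ()
  blank   ≟ˢ extra _ = no λ ()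
  bit _   ≟ˢ blank   = no λ ()
  bit b   ≟ˢ bit c   = map′ (cong bit) bit-injective (b 𝔹.≟ c)
  bit _   ≟ˢ extra _ = no λ ()
  extra _ ≟ˢ blank   = no λ ()
  extra _ ≟ˢ bit _   = no λ ()
  extra i ≟ˢ extra j = map′ (cong extra) extra-injective (i Fin.≟ j)

  symbols : List (Symbol g)
  symbols = blank ∷ bit true ∷ bit false ∷ map extra (allFin g)

  ∈-symbols : ∀ s → s ∈ symbols
  ∈-symbols blank       = here refl
  ∈-symbols (bit true)  = there (here refl)
  ∈-symbols (bit false) = there (there (here refl))
  ∈-symbols (extra i)   = there (there (there (∈-map⁺ extra (∈-allFin i))))

  bitOf : Symbol g → Bool
  bitOf (bit b) = b
  bitOf _       = false

  nth : List (Symbol g) → ℕ → Symbol g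
  nth []       _       = blank
  nth (s ∷ ss) zero    = s
  nth (s ∷ ss) (suc i) = nth ss i

  look : Tape g → Place → Symbol g
  look t hd     = Tape.head t
  look t (lf i) = nth (Tape.before t) i
  look t (rt i) = nth (Tape.after t) i

  pick : Symbol g → Place → Symbol g → Symbol g
  pick w hd     s = w
  pick w (lf _) s = s
  pick w (rt _) s = s

  -- In head-relative addresses a step renames all cells by `shift`, and only the cell formerly
  -- under the head changes its content. So a cell depends on the control and on a single earlier
  -- cell, which makes binary constraints sufficient.
  look-act : ∀ t w d p → look (act t (w , d)) p ≡ pick w (shift d p) (look t (shift d p))
  look-act (tape []      _ _)       w left  hd           = refl
  look-act (tape []      _ _)       w left  (lf i)       = refl
  look-act (tape []      _ _)       w left  (rt zero)    = refl
  look-act (tape []      _ _)       w left  (rt (suc i)) = refl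
  look-act (tape (_ ∷ _) _ _)       w left  hd           = refl
  look-act (tape (_ ∷ _) _ _)       w left  (lf i)       = refl
  look-act (tape (_ ∷ _) _ _)       w left  (rt zero)    = refl
  look-act (tape (_ ∷ _) _ _)       w left  (rt (suc i)) = refl
  look-act (tape []      _ _)       w stay  hd           = refl
  look-act (tape []      _ _)       w stay  (lf i)       = refl
  look-act (tape []      _ _)       w stay  (rt i)       = refl
  look-act (tape (_ ∷ _) _ _)       w stay  hd           = refl
  look-act (tape (_ ∷ _) _ _)       w stay  (lf i)       = refl
  look-act (tape (_ ∷ _) _ _)       w stay  (rt i)       = refl
  look-act (tape []      _ [])      w right hd           = refl
  look-act (tape []      _ [])      w right (rt i)       = refl
  look-act (tape []      _ [])      w right (lf zero)    = refl
  look-act (tape []      _ [])      w right (lf (suc i)) = refl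
  look-act (tape []      _ (_ ∷ _)) w right hd           = refl
  look-act (tape []      _ (_ ∷ _)) w right (rt i)       = refl
  look-act (tape []      _ (_ ∷ _)) w right (lf zero)    = refl
  look-act (tape []      _ (_ ∷ _)) w right (lf (suc i)) = refl
  look-act (tape (_ ∷ _) _ [])      w right hd           = refl
  look-act (tape (_ ∷ _) _ [])      w right (rt i)       = refl
  look-act (tape (_ ∷ _) _ [])      w right (lf zero)    = refl
  look-act (tape (_ ∷ _) _ [])      w right (lf (suc i)) = refl
  look-act (tape (_ ∷ _) _ (_ ∷ _)) w right hd           = refl
  look-act (tape (_ ∷ _) _ (_ ∷ _)) w right (rt i)       = refl
  look-act (tape (_ ∷ _) _ (_ ∷ _)) w right (lf zero)    = refl
  look-act (tape (_ ∷ _) _ (_ ∷ _)) w right (lf (suc i)) = refl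

  act-stay : ∀ (t : Tape g) → act t (Tape.head t , stay) ≡ t
  act-stay (tape []      _ _) = refl
  act-stay (tape (_ ∷ _) _ _) = refl

  look-inputTape : ∀ w i → look (inputTape w) (cell i) ≡ nth (map bit w) i
  look-inputTape []      zero    = refl
  look-inputTape []      (suc i) = refl
  look-inputTape (b ∷ w) zero    = refl
  look-inputTape (b ∷ w) (suc i) = refl

  look-inputTape-lf : ∀ w i → look (inputTape w) (lf i) ≡ blank
  look-inputTape-lf []      i = refl
  look-inputTape-lf (_ ∷ _) i = refl

  look-emptyTape : ∀ p → look emptyTape p ≡ blank
  look-emptyTape hd     = refl
  look-emptyTape (lf _) = refl
  look-emptyTape (rt _) = refl

-- The initial contents of the input tape as literals

length-⟨⟩ : ∀ u v → length ⟨ u , v ⟩ ≡ suc (length u + length u + length v)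
length-⟨⟩ []      v = refl
length-⟨⟩ (b ∷ u) v = cong (2 +_) (trans (length-⟨⟩ u v)
  (cong (λ l → l + length v) (sym (ℕ.+-suc (length u) (length u)))))

-- `⟨_,_⟩` interleaves `x` with constant bits, whence `xbit` and `fixed`. A `ybit` may hold any bit:
-- this is where the certificate is guessed.
data InputCell (n : ℕ) : Set where
  fixed : Bool → InputCell n
  xbit  : Fin n → InputCell n
  ybit  : InputCell n

module _ {n : ℕ} where

  inputCells : List (Fin n) → ℕ → List (InputCell n)
  inputCells []       m = fixed false ∷ replicate m ybit
  inputCells (j ∷ js) m = fixed true ∷ xbit j ∷ inputCells js m

  module _ {g : ℕ} where

    holds : InputCell n → Symbol g → Lit (Fin n)
    holds (fixed b) (bit c) = constL ⌊ b 𝔹.≟ c ⌋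
    -- With the sign `not c` the literal is true iff `ρ j` equals `c`.
    holds (xbit j)  (bit c) = varL (not c) j
    holds ybit      (bit c) = constL true
    holds _         _       = constL false

    -- Past the end of the input only `blank` is allowed, so the guessed length of the certificate
    -- is exact.
    holdsAt : List (InputCell n) → ℕ → Symbol g → Lit (Fin n)
    holdsAt []       _       blank = constL true
    holdsAt []       _       _     = constL false
    holdsAt (c ∷ cs) zero    s     = holds c s
    holdsAt (c ∷ cs) (suc i) s     = holdsAt cs i s

    module _ (ρ : Fin n → Bool) where

      readCell : InputCell n → Symbol g → Bool
      readCell (fixed b) s = b
      readCell (xbit j)  s = ρ j
      readCell ybit      s = bitOf s

      readCells : List (InputCell n) → (ℕ → Symbol g) → Word
      readCells []       s = []
      readCells (c ∷ cs) s = readCell c (s 0) ∷ readCells cs (s ∘ suc)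

      holds-sound : ∀ c s → evalL ρ (holds c s) ≡ true → s ≡ bit (readCell c s)
      holds-sound (fixed b) (bit c) h with yes b≡c ← b 𝔹.≟ c = cong bit (sym b≡c)
      holds-sound (xbit j)  (bit c) h = cong bit (lemma c (ρ j) h)
        where
        lemma : ∀ c r → not c xor r ≡ true → c ≡ r
        lemma true  true  _ = refl
        lemma false false _ = refl
      holds-sound ybit      (bit c) h = refl

      holdsAt-sound : ∀ cs (s : ℕ → Symbol g) i →
        evalL ρ (holdsAt cs i (s i)) ≡ true → s i ≡ nth (map bit (readCells cs s)) i
      holdsAt-sound [] s i h with s i
      ... | blank = refl
      holdsAt-sound (c ∷ cs) s zero    h = holds-sound c (s 0) h
      holdsAt-sound (c ∷ cs) s (suc i) h = holdsAt-sound cs (s ∘ suc) i h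

      length-readCells-ybits : ∀ m s → length (readCells (replicate m ybit) s) ≡ m
      length-readCells-ybits zero    s = refl
      length-readCells-ybits (suc m) s = cong suc (length-readCells-ybits m (s ∘ suc))

      -- Serves soundness: any assignment of symbols to the cells yields a certificate, read off its
      -- `ybit` cells.
      readCells-pair : ∀ js m s → ∃[ y ] length y ≡ m × readCells (inputCells js m) s ≡ ⟨ map ρ js , y ⟩
      readCells-pair []       m s = _ , length-readCells-ybits m (s ∘ suc) , refl
      readCells-pair (j ∷ js) m s =
        let y , l , e = readCells-pair js m (λ i → s (2 + i)) in
        y , l , cong (λ w → true ∷ ρ j ∷ w) e

      holdsAt-ybits : ∀ y i → evalL ρ (holdsAt (replicate (length y) ybit) i (nth (map bit y) i)) ≡ true
      holdsAt-ybits []      i       = refl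
      holdsAt-ybits (_ ∷ y) zero    = refl
      holdsAt-ybits (_ ∷ y) (suc i) = holdsAt-ybits y i

      holdsAt-complete : ∀ js y i →
        evalL ρ (holdsAt (inputCells js (length y)) i (nth (map bit ⟨ map ρ js , y ⟩) i)) ≡ true
      holdsAt-complete []       y zero          = refl
      holdsAt-complete []       y (suc i)       = holdsAt-ybits y i
      holdsAt-complete (j ∷ js) y zero          = refl
      holdsAt-complete (j ∷ js) y (suc zero)    = lemma (ρ j)
        where
        lemma : ∀ r → not r xor r ≡ true
        lemma true  = refl
        lemma false = refl
      holdsAt-complete (j ∷ js) y (suc (suc i)) = holdsAt-complete js y i

-- Runs prolonged beyond halting

module Run (M : TM) where
  open TM M

  Control : Set
  Control = State × Tapes Γ

  control : Config M → Control
  control (q , ts) = q , Vec.map Tape.head ts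

  -- A halted configuration is continued by idle steps, so that all runs can be inspected at one
  -- common time, whenever they halt.
  actions : Control → State × Tapes (Γ × Move)
  actions (q , s) with δ q s
  ... | just (q′ , as) = q′ , as
  ... | nothing        = q , Vec.map (_, stay) s

  advance : Config M → Config M
  advance c = let q , as = actions (control c) in q , Vec.zipWith act (proj₂ c) as

  run : Config M → ℕ → Config M
  run c zero    = c
  run c (suc τ) = advance (run c τ)

  accepting : Control → Bool
  accepting (q , s) with δ q s
  ... | just _  = false
  ... | nothing = bitOf (Vec.head s)

  act-stays : ∀ {m} (ts : Vec (Tape extraSymbols) m) →
    Vec.zipWith act ts (Vec.map (_, stay) (Vec.map Tape.head ts)) ≡ ts
  act-stays []       = refl
  act-stays (t ∷ ts) = cong₂ _∷_ (act-stay t) (act-stays ts)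

  advance-step : ∀ {c c′} → step M c ≡ just c′ → advance c ≡ c′
  advance-step {q , ts} e with δ q (Vec.map Tape.head ts)
  advance-step refl | just _ = refl

  advance-halt : ∀ {c} → step M c ≡ nothing → advance c ≡ c
  advance-halt {q , ts} e with δ q (Vec.map Tape.head ts)
  ... | nothing = cong (q ,_) (act-stays ts)

  run-advance : ∀ c τ → run (advance c) τ ≡ advance (run c τ)
  run-advance c zero    = refl
  run-advance c (suc τ) = cong advance (run-advance c τ)

  run-halts : ∀ {t c d} → HaltsIn M t c d → ∀ {T} → t ≤ T → run c T ≡ d × step M d ≡ nothing
  run-halts {d = d} (halt e) _ = at _ , e
    where
    at : ∀ T → run d T ≡ d
    at zero    = refl
    at (suc T) = trans (cong advance (at T)) (advance-halt e)
  run-halts {c = c} (next {c′ = c′} e h) {suc T} (s≤s t≤T) =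
    let r , s = run-halts h t≤T in
    trans (sym (run-advance c T)) (trans (cong (λ c → run c T) (advance-step e)) r) , s

  head-output : ∀ {b} (t : Tape extraSymbols) → outputWord t ≡ b ∷ [] → Tape.head t ≡ bit b
  head-output (tape _ (bit _) _) e = cong bit (List.∷-injectiveˡ e)

  accepting-halted : ∀ {d b} → step M d ≡ nothing → result M d ≡ b ∷ [] → accepting (control d) ≡ b
  accepting-halted {q , t ∷ ts} e r with δ q (Vec.map Tape.head (t ∷ ts))
  ... | nothing rewrite head-output t r = refl

  accepting-run : ∀ {n w b T} → OutputsWithin M n w (b ∷ []) → n ≤ T →
    accepting (control (run (initial M w) T)) ≡ b
  accepting-run (t , d , t≤n , h , r) n≤T =
    let e , s = run-halts h (ℕ.≤-trans t≤n n≤T) in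
    trans (cong (accepting ∘ control) e) (accepting-halted s r)

toList-tabulate : ∀ {A : Set} {n} (x : Vec A n) → map (Vec.lookup x) (allFin n) ≡ Vec.toList x
toList-tabulate []      = refl
toList-tabulate (a ∷ x) = cong (a ∷_) (trans
  (trans (List.map-tabulate suc (Vec.lookup (a ∷ x))) (sym (List.map-tabulate id (Vec.lookup x))))
  (toList-tabulate x))

vec-ext : ∀ {A : Set} {n} {v w : Vec A n} → (∀ i → Vec.lookup v i ≡ Vec.lookup w i) → v ≡ w
vec-ext {v = []}    {[]}    h = refl
vec-ext {v = _ ∷ _} {_ ∷ _} h = cong₂ _∷_ (h zero) (vec-ext (h ∘ suc))

dec-sound : ∀ {P : Set} (d : Dec P) → ⌊ d ⌋ ≡ true → P
dec-sound (yes p) _ = p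

dec-complete : ∀ {P : Set} (d : Dec P) → P → ⌊ d ⌋ ≡ true
dec-complete (yes _) _ = refl
dec-complete (no ¬p) p = contradiction p ¬p

-- The tableau of a verifier as a constraint satisfaction problem

module CookLevin {L : Language} (np : InNP L) where
  open InNP np using (verify) renaming (bound to certBound; correct to L-correct)

  M : TM
  M = proj₁ (InNP.verifyPoly np)

  open TM M
  open Run M

  timeBound : Polynomial
  timeBound = proj₁ (proj₂ (InNP.verifyPoly np))

  runs : ∀ xy → OutputsWithin M (⟦ timeBound ⟧ (length (encodePair xy))) (encodePair xy) (encodeBit (verify xy))
  runs = proj₂ (proj₂ (InNP.verifyPoly np))

  k : ℕ
  k = suc extraTapes

  localValues : List (Control × Γ)
  localValues = cartesianProduct (cartesianProduct (allFin (suc extraStates)) (allVecs symbols k)) symbols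

  module Fixed (n : ℕ) where

    -- `ℓ` bounds the length of the encoded pair of input and certificate, `H` the running time on
    -- it. The variables cover `N` cells on either side of each head. The part of this window that
    -- is known to be correct shrinks by one cell per step, and `N` exceeds `H`, so the heads are
    -- still covered at time `H`.
    q ℓ H N : ℕ
    q = ⟦ certBound ⟧ n
    ℓ = suc (n + n + q)
    H = ⟦ timeBound ⟧ ℓ
    N = H + ℓ

    Var Val : Set
    Var = ℕ × Fin k × Place
    Val = ℕ × Control × Γ

    abstract
      vars : List Var
      vars = cartesianProduct (upTo (suc H)) (cartesianProduct (allFin k) (places N))

      vals : List Val
      vals = cartesianProduct (upTo (suc q))
        localValues

      ∈-vars : ∀ {τ j p} → τ ≤ H → distance p ≤ N → (τ , j , p) ∈ vars
      ∈-vars {j = j} {p} τ≤H p≤N =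
        ∈-cartesianProduct⁺ (∈-upTo⁺ (s≤s τ≤H)) (∈-cartesianProduct⁺ (∈-allFin j) (∈-places p p≤N))

      ∈-vals : ∀ {m c s} → m ≤ q → (m , c , s) ∈ vals
      ∈-vals {c = c} {s} m≤q =
        ∈-cartesianProduct⁺ (∈-upTo⁺ (s≤s m≤q))
          (∈-cartesianProduct⁺ (∈-cartesianProduct⁺ (∈-allFin (proj₁ c)) (∈-allVecs⁺ (proj₂ c) (λ i → ∈-symbols _)))
            (∈-symbols s))

      vals-bound : ∀ {a} → a ∈ vals → proj₁ a ≤ q
      vals-bound a∈ = s≤s⁻¹ (∈-upTo⁻ (proj₁ (∈-cartesianProduct⁻ (upTo (suc q))
        localValues a∈)))

      length-vars : length vars ≡ suc H * (k * suc (N + N))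
      length-vars = trans (length-cartesianProductWith _,_ (upTo (suc H)) (cartesianProduct (allFin k) (places N)))
        (cong₂ _*_ (List.length-upTo (suc H))
          (trans (length-cartesianProductWith _,_ (allFin k) (places N))
            (cong₂ _*_ (List.length-tabulate {n = k} id) (length-places N))))

      length-vals : length vals ≡
        suc q * length localValues
      length-vals = trans (length-cartesianProductWith _,_ (upTo (suc q)) localValues)
        (cong (_* length localValues) (List.length-upTo (suc q)))

    written : Control → Fin k → Γ
    written c j = proj₁ (Vec.lookup (proj₂ (actions c)) j)

    move : Control → Fin k → Move
    move c j = proj₂ (Vec.lookup (proj₂ (actions c)) j)

    -- The value of a cell consists of the certificate length, the control
    -- at that time and the symbol in the cell.
    Compatible : Var → Val → Var → Val → Set
    Compatible (τ , j , p) (m , c , s) (τ′ , j′ , p′) (m′ , c′ , s′) =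
      m ≡ m′ × (τ ≡ τ′ → c ≡ c′ × (j ≡ j′ → p ≡ p′ → s ≡ s′)) ×
      (τ′ ≡ suc τ → proj₁ c′ ≡ proj₁ (actions c)) ×
      (τ′ ≡ suc τ → j′ ≡ j → shift (move c j) p′ ≡ p → s′ ≡ pick (written c j) p s)

    abstract
      compatible? : ∀ u a v b → Dec (Compatible u a v b)
      compatible? (τ , j , p) (m , c , s) (τ′ , j′ , p′) (m′ , c′ , s′) =
        (m ℕ.≟ m′) ×-dec
        ((τ ℕ.≟ τ′) →-dec (map′ (uncurry (cong₂ _,_)) (λ { refl → refl , refl })
                              ((proj₁ c Fin.≟ proj₁ c′) ×-dec Vec.≡-dec _≟ˢ_ (proj₂ c) (proj₂ c′))
                           ×-dec ((j Fin.≟ j′) →-dec ((p ≟ᴾ p′) →-dec (s ≟ˢ s′))))) ×-dec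
        ((τ′ ℕ.≟ suc τ) →-dec (proj₁ c′ Fin.≟ _)) ×-dec
        ((τ′ ℕ.≟ suc τ) →-dec ((j′ Fin.≟ j) →-dec ((shift (move c j) p′ ≟ᴾ p) →-dec (s′ ≟ˢ _))))

    Admissible : Var → Val → Set
    Admissible (τ , j , p) (m , c , s) =
      (p ≡ hd → s ≡ Vec.lookup (proj₂ c) j) × (τ ≡ 0 → proj₁ c ≡ zero) × (τ ≡ H → accepting c ≡ true)

    abstract
      admissible? : ∀ u a → Dec (Admissible u a)
      admissible? (τ , j , p) (m , c , s) =
        ((p ≟ᴾ hd) →-dec (s ≟ˢ _)) ×-dec
        ((τ ℕ.≟ 0) →-dec (proj₁ c Fin.≟ zero)) ×-dec
        ((τ ℕ.≟ H) →-dec (accepting c 𝔹.≟ true))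

    isBlank : Γ → Lit (Fin n)
    isBlank s = constL ⌊ s ≟ˢ blank ⌋

    cellsOf : ℕ → List (InputCell n)
    cellsOf = inputCells (allFin n)

    initialLit : Fin k → Place → ℕ → Γ → Lit (Fin n)
    initialLit zero    hd     m s = holdsAt (cellsOf m) 0 s
    initialLit zero    (rt i) m s = holdsAt (cellsOf m) (suc i) s
    initialLit zero    (lf i) m s = isBlank s
    initialLit (suc j) p      m s = isBlank s

    -- Only time zero looks at the input; every later unary constraint is a constant.
    admissibleLit : Var → Val → Lit (Fin n)
    admissibleLit u@(zero  , j , p) a@(m , c , s) =
      if ⌊ admissible? u a ⌋ then initialLit j p m s else constL false
    admissibleLit u@(suc τ , j , p) a = constL ⌊ admissible? u a ⌋

    csp : CSP n
    csp = record
      { #vars      = length vars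
      ; #vals      = length vals
      ; compatible = λ u a v b →
          ⌊ compatible? (List.lookup vars u) (List.lookup vals a) (List.lookup vars v) (List.lookup vals b) ⌋
      ; admissible = λ u a → admissibleLit (List.lookup vars u) (List.lookup vals a)
      }

    module _ (x : Vec Bool n) where

      ρ : Fin n → Bool
      ρ = Vec.lookup x

      start : Word → Config M
      start y = initial M ⟨ map ρ (allFin n) , y ⟩

      contents : Word → ℕ → Fin k → Tape extraSymbols
      contents y τ j = Vec.lookup (proj₂ (run (start y) τ)) j

      look-blank : ∀ j p → look (Vec.lookup (Vec.replicate extraTapes emptyTape) j) p ≡ blank {extraSymbols}
      look-blank j p = trans (cong (λ t → look t p) (Vec.lookup-replicate j emptyTape)) (look-emptyTape p)

      lookup-heads : ∀ c j → Vec.lookup (proj₂ (control c)) j ≡ look (Vec.lookup (proj₂ c) j) hd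
      lookup-heads (_ , ts) j = Vec.lookup-map j Tape.head ts

      look-advance : ∀ c j p → look (Vec.lookup (proj₂ (advance c)) j) p ≡
        pick (written (control c) j) (shift (move (control c) j) p)
             (look (Vec.lookup (proj₂ c) j) (shift (move (control c) j) p))
      look-advance c@(_ , ts) j p = trans
        (cong (λ t → look t p) (Vec.lookup-zipWith act j ts (proj₂ (actions (control c)))))
        (look-act (Vec.lookup ts j) (written (control c) j) (move (control c) j) p)

      outcome : ∀ y → length y ≤ q → accepting (control (run (start y) H)) ≡ verify (map ρ (allFin n) , y)
      outcome y y≤q = accepting-run (runs (map ρ (allFin n) , y)) (Polynomial-mono timeBound (begin
        length ⟨ map ρ (allFin n) , y ⟩ ≡⟨ length-⟨⟩ (map ρ (allFin n)) y ⟩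
        suc (length (map ρ (allFin n)) + length (map ρ (allFin n)) + length y)
          ≡⟨ cong (λ l → suc (l + l + length y)) (trans (List.length-map ρ (allFin n)) (List.length-tabulate {n = n} id)) ⟩
        suc (n + n + length y) ≤⟨ s≤s (ℕ.+-monoʳ-≤ (n + n) y≤q) ⟩
        ℓ ∎))
        where open ℕ.≤-Reasoning

      initial-holds : ∀ y j p → evalL ρ (initialLit j p (length y) (look (contents y 0 j) p)) ≡ true
      initial-holds y zero hd
        rewrite look-inputTape {extraSymbols} ⟨ map ρ (allFin n) , y ⟩ 0 = holdsAt-complete ρ (allFin n) y 0
      initial-holds y zero (rt i)
        rewrite look-inputTape {extraSymbols} ⟨ map ρ (allFin n) , y ⟩ (suc i) = holdsAt-complete ρ (allFin n) y (suc i)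
      initial-holds y zero (lf i)
        rewrite look-inputTape-lf {extraSymbols} ⟨ map ρ (allFin n) , y ⟩ i = refl
      initial-holds y (suc j) p rewrite look-blank j p = refl

      complete : ∀ y → length y ≤ q → verify (map ρ (allFin n) , y) ≡ true → CSP.Satisfiable csp ρ
      complete y y≤q v≡true = f , (λ u v _ → dec-complete (compatible? _ _ _ _) (compat u v)) , admis
        where
        value : Var → Val
        value (τ , j , p) = length y , control (run (start y) τ) , look (contents y τ j) p

        value∈ : ∀ u → value u ∈ vals
        value∈ u = ∈-vals y≤q

        f : Fin (length vars) → Fin (length vals)
        f u = Any.index (value∈ (List.lookup vars u))

        lookup-f : ∀ u → List.lookup vals (f u) ≡ value (List.lookup vars u)
        lookup-f u = sym (Any.lookup-index (value∈ (List.lookup vars u)))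

        compat′ : ∀ u v → Compatible u (value u) v (value v)
        compat′ (τ , j , p) (τ′ , j′ , p′) =
          refl , (λ { refl → refl , λ { refl refl → refl } }) , (λ { refl → refl }) ,
          (λ { refl refl refl → look-advance (run (start y) τ) j p′ })

        compat : ∀ u v → Compatible (List.lookup vars u) (List.lookup vals (f u))
                                    (List.lookup vars v) (List.lookup vals (f v))
        compat u v rewrite lookup-f u | lookup-f v = compat′ (List.lookup vars u) (List.lookup vars v)

        admis′ : ∀ u → Admissible u (value u)
        admis′ (τ , j , p) =
          (λ { refl → sym (lookup-heads (run (start y) τ) j) }) , (λ { refl → refl }) ,
          (λ { refl → trans (outcome y y≤q) v≡true })

        admisLit : ∀ u → evalL ρ (admissibleLit u (value u)) ≡ true
        admisLit u@(zero , j , p)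
          rewrite dec-complete (admissible? u (value u)) (admis′ u) = initial-holds y j p
        admisLit u@(suc τ , j , p) = dec-complete (admissible? u (value u)) (admis′ u)

        admis : ∀ u → evalL ρ (admissibleLit (List.lookup vars u) (List.lookup vals (f u))) ≡ true
        admis u rewrite lookup-f u = admisLit (List.lookup vars u)

      module Sound (f : Fin (length vars) → Fin (length vals)) (solution : CSP.Solution csp ρ f) where

        value : ∀ {u} → u ∈ vars → Val
        value u∈ = List.lookup vals (f (Any.index u∈))

        compatible-refl : ∀ u a → Compatible u a u a
        compatible-refl (τ , _) a =
          refl , (λ _ → refl , λ _ _ → refl) , (λ e → contradiction (sym e) ℕ.1+n≢n) , (λ e → contradiction (sym e) ℕ.1+n≢n)

        -- A solution promises nothing for equal indices, where `compatible-refl` steps in. For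
        -- different indices its constraint applies even if both hold the same variable; this
        -- matters because `vars` is not shown to be free of repetitions.
        pair : ∀ {u v} (u∈ : u ∈ vars) (v∈ : v ∈ vars) → Compatible u (value u∈) v (value v∈)
        pair {u} {v} u∈ v∈ with Any.index u∈ Fin.≟ Any.index v∈
        ... | yes e = subst₂ (λ v i → Compatible u (value u∈) v (List.lookup vals (f i)))
                        (trans (Any.lookup-index u∈) (trans (cong (List.lookup vars) e) (sym (Any.lookup-index v∈))))
                        e (compatible-refl u (value u∈))
        ... | no ne = subst₂ (λ u v → Compatible u (value u∈) v (value v∈))
                        (sym (Any.lookup-index u∈)) (sym (Any.lookup-index v∈))
                        (dec-sound (compatible? _ _ _ _) (proj₁ solution _ _ ne))

        single : ∀ {u} (u∈ : u ∈ vars) → evalL ρ (admissibleLit u (value u∈)) ≡ true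
        single {u} u∈ = subst (λ u → evalL ρ (admissibleLit u (value u∈)) ≡ true)
                          (sym (Any.lookup-index u∈)) (proj₂ solution (Any.index u∈))

        split-lit : ∀ u a → evalL ρ (admissibleLit u a) ≡ true →
          Admissible u a × (proj₁ u ≡ 0 → evalL ρ (initialLit (proj₁ (proj₂ u)) (proj₂ (proj₂ u)) (proj₁ a) (proj₂ (proj₂ a))) ≡ true)
        split-lit u@(zero , _) a h with yes p ← admissible? u a = p , λ _ → h
        split-lit u@(suc _ , _) a h = dec-sound (admissible? u a) h , λ ()

        adm : ∀ {u} (u∈ : u ∈ vars) → Admissible u (value u∈)
        adm u∈ = proj₁ (split-lit _ _ (single u∈))

        first∈ : (0 , zero , hd) ∈ vars
        first∈ = ∈-vars z≤n z≤n

        -- Every value carries the certificate length because the admissible initial contents depend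
        -- on it; compatibility makes it the same everywhere.
        m : ℕ
        m = proj₁ (value first∈)

        m≤q : m ≤ q
        m≤q = vals-bound (∈-lookup (f (Any.index first∈)))

        value-m : ∀ {u} (u∈ : u ∈ vars) → proj₁ (value u∈) ≡ m
        value-m u∈ = sym (proj₁ (pair first∈ u∈))

        symbol : ∀ {u} → u ∈ vars → Γ
        symbol u∈ = proj₂ (proj₂ (value u∈))

        input : ℕ → Γ
        input i with i ℕ.≤? N
        ... | yes i≤N = symbol (∈-vars {0} {zero} {cell i} z≤n (subst (_≤ N) (sym (distance-cell i)) i≤N))
        -- A default outside the window; `input` is compared with the tape only at positions up to
        -- `N`.
        ... | no _    = blank

        y : Word
        y = proj₁ (readCells-pair ρ (allFin n) m input)

        length-y : length y ≡ m
        length-y = proj₁ (proj₂ (readCells-pair ρ (allFin n) m input))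

        initialLit-cell : ∀ i {m s} → initialLit zero (cell i) m s ≡ holdsAt (cellsOf m) i s
        initialLit-cell zero    = refl
        initialLit-cell (suc i) = refl

        input-holds : ∀ i → i ≤ N → evalL ρ (holdsAt (cellsOf m) i (input i)) ≡ true
        input-holds i i≤N with i ℕ.≤? N
        ... | no i≰N = contradiction i≤N i≰N
        ... | yes i≤N′ =
          let u∈ = ∈-vars {0} {zero} {cell i} z≤n (subst (_≤ N) (sym (distance-cell i)) i≤N′) in
          subst (λ l → evalL ρ l ≡ true) (trans (initialLit-cell i) (cong (λ m → holdsAt (cellsOf m) i (symbol u∈)) (value-m u∈)))
            (proj₂ (split-lit _ _ (single u∈)) refl)

        -- The control enters by its state alone, since its head symbols follow from the cells at
        -- `hd` by admissibility. The bound on `distance p + τ` is the shrinking window: the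
        -- predecessor of a cell may lie one cell further out.
        Correct : ℕ → Set
        Correct τ = ∀ j p (u∈ : (τ , j , p) ∈ vars) → distance p + τ ≤ N →
          proj₁ (proj₁ (proj₂ (value u∈))) ≡ proj₁ (run (start y) τ) ×
          symbol u∈ ≡ look (contents y τ j) p

        control-correct : ∀ τ → τ ≤ H → Correct τ → ∀ {j p} (u∈ : (τ , j , p) ∈ vars) →
          proj₁ (proj₂ (value u∈)) ≡ control (run (start y) τ)
        control-correct τ τ≤H correct {j} {p} u∈ = cong₂ _,_ (trans (cong proj₁ (here-control zero)) (proj₁ (at zero)))
          (vec-ext λ i → trans (cong (λ c → Vec.lookup (proj₂ c) i) (here-control i))
             (trans (sym (proj₁ (adm (hd∈ i)) refl))
             (trans (proj₂ (at i)) (sym (lookup-heads (run (start y) τ) i)))))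
          where
          hd∈ : ∀ i → (τ , i , hd) ∈ vars
          hd∈ i = ∈-vars τ≤H z≤n
          at : ∀ i → _
          at i = correct i hd (hd∈ i) (ℕ.≤-trans τ≤H (ℕ.m≤m+n H ℓ))
          here-control : ∀ i → proj₁ (proj₂ (value u∈)) ≡ proj₁ (proj₂ (value (hd∈ i)))
          here-control i = proj₁ (proj₁ (proj₂ (pair u∈ (hd∈ i))) refl)

        input-correct : ∀ i → i ≤ N → (u∈ : (0 , zero , cell i) ∈ vars) → symbol u∈ ≡ input i
        input-correct i i≤N u∈ with i ℕ.≤? N
        ... | yes _   = proj₂ (proj₁ (proj₂ (pair u∈ _)) refl) refl refl
        ... | no i≰N = contradiction i≤N i≰N

        input-word : ∀ i → i ≤ N → input i ≡ nth (map bit ⟨ map ρ (allFin n) , y ⟩) i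
        input-word i i≤N = trans (holdsAt-sound ρ (cellsOf m) input i (input-holds i i≤N))
          (cong (λ w → nth (map bit w) i) (proj₂ (proj₂ (readCells-pair ρ (allFin n) m input))))

        initial-blank : ∀ s → evalL ρ (isBlank s) ≡ true → s ≡ blank
        initial-blank s = dec-sound (s ≟ˢ blank)

        initial-lit : ∀ {j p} (u∈ : (0 , j , p) ∈ vars) → evalL ρ (initialLit j p (proj₁ (value u∈)) (symbol u∈)) ≡ true
        initial-lit u∈ = proj₂ (split-lit _ _ (single u∈)) refl

        initial-symbol : ∀ j p (u∈ : (0 , j , p) ∈ vars) → distance p ≤ N → symbol u∈ ≡ look (contents y 0 j) p
        initial-symbol zero hd u∈ _ = trans (input-correct 0 z≤n u∈)
          (trans (input-word 0 z≤n) (sym (look-inputTape ⟨ map ρ (allFin n) , y ⟩ 0)))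
        initial-symbol zero (rt i) u∈ i<N = trans (input-correct (suc i) i<N u∈)
          (trans (input-word (suc i) i<N) (sym (look-inputTape ⟨ map ρ (allFin n) , y ⟩ (suc i))))
        initial-symbol zero (lf i) u∈ _ = trans (initial-blank _ (initial-lit u∈))
          (sym (look-inputTape-lf ⟨ map ρ (allFin n) , y ⟩ i))
        initial-symbol (suc j) p u∈ _ = trans (initial-blank _ (initial-lit u∈)) (sym (look-blank j p))

        all-correct : ∀ τ → τ ≤ H → Correct τ
        all-correct zero _ j p u∈ p≤N =
          proj₁ (proj₂ (adm u∈)) refl , initial-symbol j p u∈ (subst (_≤ N) (ℕ.+-identityʳ _) p≤N)
        all-correct (suc τ) τ<H j p u∈ p≤N =
          trans (proj₁ (proj₂ (proj₂ link)) refl) (cong (proj₁ ∘ actions) control≡) ,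
          trans (proj₂ (proj₂ (proj₂ link)) refl refl (cong (λ c → shift (move c j) p) control≡))
            (trans (cong₂ (λ c s → pick (written c j) p₀ s) control≡ (proj₂ (previous j p₀ old∈ p₀≤N)))
                   (sym (look-advance (run (start y) τ) j p)))
          where
          c₀ = control (run (start y) τ)
          p₀ = shift (move c₀ j) p
          previous = all-correct τ (ℕ.<⇒≤ τ<H)
          p₀≤N : distance p₀ + τ ≤ N
          p₀≤N = ℕ.≤-trans (ℕ.+-monoˡ-≤ τ (distance-shift (move c₀ j) p))
                   (subst (_≤ N) (ℕ.+-suc (distance p) τ) p≤N)
          old∈ : (τ , j , p₀) ∈ vars
          old∈ = ∈-vars (ℕ.<⇒≤ τ<H) (ℕ.m+n≤o⇒m≤o _ p₀≤N)
          link = pair old∈ u∈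
          control≡ = control-correct τ (ℕ.<⇒≤ τ<H) previous old∈

        last∈ : (H , zero , hd) ∈ vars
        last∈ = ∈-vars ℕ.≤-refl z≤n

        verified : verify (map ρ (allFin n) , y) ≡ true
        verified = trans (sym (outcome y (subst (_≤ q) (sym length-y) m≤q)))
          (trans (cong accepting (sym (control-correct H ℕ.≤-refl (all-correct H ℕ.≤-refl) last∈)))
                 (proj₂ (proj₂ (adm last∈)) refl))

      csp-correct : L (Vec.toList x) ⇔ CSP.Satisfiable csp ρ
      csp-correct = mk⇔ to from
        where
        bound≡ : ⟦ certBound ⟧ (length (Vec.toList x)) ≡ q
        bound≡ = cong ⟦ certBound ⟧ (Vec.length-toList x)
        to : L (Vec.toList x) → CSP.Satisfiable csp ρ
        to Lx = let y , y≤ , v = Equivalence.to (L-correct (Vec.toList x)) Lx in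
          complete y (subst (length y ≤_) bound≡ y≤) (trans (cong (λ w → verify (w , y)) (toList-tabulate x)) v)
        from : CSP.Satisfiable csp ρ → L (Vec.toList x)
        from (f , sol) = Equivalence.from (L-correct (Vec.toList x))
          (y , subst₂ _≤_ (sym length-y) (sym bound≡) m≤q
             , trans (cong (λ w → verify (w , y)) (sym (toList-tabulate x))) verified)
          where open Sound f sol

  open Fixed using (csp; csp-correct) public

  #vars-polyBounded : PolyBounded (λ n → CSP.#vars (csp n))
  #vars-polyBounded = pb-≤ (λ n → ℕ.≤-reflexive (Fixed.length-vars n))
    (pb-* (pb-suc H-pb) (pb-* (pb-const k) (pb-suc (pb-+ N-pb N-pb))))
    where
    open Fixed using (H; N; ℓ)
    ℓ-pb : PolyBounded ℓ
    ℓ-pb = pb-suc (pb-+ (pb-+ pb-id pb-id) (pb-poly certBound))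
    H-pb : PolyBounded H
    H-pb = pb-∘ timeBound ℓ-pb
    N-pb : PolyBounded N
    N-pb = pb-+ H-pb ℓ-pb

  #vals-polyBounded : PolyBounded (λ n → CSP.#vals (csp n))
  #vals-polyBounded = pb-≤ (λ n → ℕ.≤-reflexive (Fixed.length-vals n))
    (pb-* (pb-suc (pb-poly certBound)) (pb-const (length localValues)))

  #vars>0 : ∀ n → 0 < CSP.#vars (csp n)
  #vars>0 n = ∈-length (Fixed.∈-vars n {0} {zero} {hd} z≤n z≤n)

-- From constraint satisfaction to poset embedding

negL : ∀ {I} → Lit I → Lit I
negL (constL b) = constL (not b)
negL (varL b i) = varL (not b) i

evalL-neg : ∀ {I} (ρ : I → Bool) l → evalL ρ (negL l) ≡ not (evalL ρ l)
evalL-neg ρ (constL b)     = refl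
evalL-neg ρ (varL true i)  = sym (𝔹.not-involutive (ρ i))
evalL-neg ρ (varL false i) = refl

mapL : ∀ {I J : Set} → (I → J) → Lit I → Lit J
mapL f (constL b) = constL b
mapL f (varL b i) = varL b (f i)

evalL-map : ∀ {I J : Set} (f : I → J) ρ l → evalL ρ (mapL f l) ≡ evalL (ρ ∘ f) l
evalL-map f ρ (constL b) = refl
evalL-map f ρ (varL b i) = refl

-- An interval of `m` numbers leaves no gap for a strictly increasing sequence of `m` values. The
-- offset `c` is there for the induction.
squeeze : ∀ {m} c (f : Fin m → ℕ) → (∀ {i j} → toℕ i < toℕ j → f i < f j) →
  (∀ i → c ≤ f i) → (∀ i → f i < c + m) → ∀ i → f i ≡ c + toℕ i
squeeze {suc zero} c f mono lower upper zero = trans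
  (ℕ.≤-antisym (s≤s⁻¹ (subst (f zero <_) (ℕ.+-comm c 1) (upper zero))) (lower zero)) (sym (ℕ.+-identityʳ c))
squeeze {suc (suc m)} c f mono lower upper = λ
  { zero    → trans (ℕ.≤-antisym (s≤s⁻¹ (subst (f zero <_) (trans (tail zero) (ℕ.+-identityʳ (suc c))) (mono (s≤s z≤n))))
                                 (lower zero)) (sym (ℕ.+-identityʳ c))
  ; (suc i) → trans (tail i) (sym (ℕ.+-suc c (toℕ i))) }
  where
  tail : ∀ i → f (suc i) ≡ suc c + toℕ i
  tail = squeeze (suc c) (f ∘ suc) (λ i<j → mono (s≤s i<j))
    (λ i → ℕ.≤-<-trans (lower zero) (mono (s≤s z≤n)))
    (λ i → subst (f (suc i) <_) (ℕ.+-suc c (suc m)) (upper (suc i)))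

-- Sizes of subsets by injections

members : ∀ {n} (S : Subset.Subset n) → Fin Subset.∣ S ∣ → Fin n
members (true  ∷ S) zero    = zero
members (true  ∷ S) (suc i) = suc (members S i)
members (false ∷ S) i       = suc (members S i)

members∈ : ∀ {n} (S : Subset.Subset n) i → members S i Subset.∈ S
members∈ (true  ∷ S) zero    = Vec.here
members∈ (true  ∷ S) (suc i) = Vec.there (members∈ S i)
members∈ (false ∷ S) i       = Vec.there (members∈ S i)

members-injective : ∀ {n} (S : Subset.Subset n) {i j} → members S i ≡ members S j → i ≡ j
members-injective (true  ∷ S) {zero}  {zero}  e = refl
members-injective (true  ∷ S) {suc i} {suc j} e = cong suc (members-injective S (Fin.suc-injective e))
members-injective (false ∷ S) e = members-injective S (Fin.suc-injective e)

∣∣≤-injective : ∀ {n w} (S : Subset.Subset n) (f : Fin n → Fin w) →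
  (∀ {i j} → i Subset.∈ S → j Subset.∈ S → f i ≡ f j → i ≡ j) → Subset.∣ S ∣ ≤ w
∣∣≤-injective S f inj = Fin.injective⇒≤ {f = f ∘ members S}
  (λ {i} {j} e → members-injective S (inj (members∈ S i) (members∈ S j) e))

injective⇒≤-∣∣ : ∀ {n w} (f : Fin w → Fin n) → (∀ {i j} → f i ≡ f j → i ≡ j) →
  ∃[ S ] (∀ {x} → x Subset.∈ S → ∃[ i ] x ≡ f i) × Subset.∣ S ∣ ≡ w
injective⇒≤-∣∣ {n} {w} f inj = S , from , ℕ.≤-antisym upper lower
  where
  hit? : ∀ x → Dec (∃[ i ] x ≡ f i)
  hit? x = Fin.any? (λ i → x Fin.≟ f i)
  S : Subset.Subset n
  S = Vec.tabulate (λ x → ⌊ hit? x ⌋)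
  from : ∀ {x} → x Subset.∈ S → ∃[ i ] x ≡ f i
  from {x} x∈ = dec-sound (hit? x) (trans (sym (Vec.lookup∘tabulate _ x)) (Vec.[]=⇒lookup x∈))
  to : ∀ i → f i Subset.∈ S
  to i = Vec.lookup⇒[]= (f i) S (trans (Vec.lookup∘tabulate _ (f i)) (dec-complete (hit? (f i)) (i , refl)))
  upper : Subset.∣ S ∣ ≤ w
  upper = Fin.injective⇒≤ {f = λ i → proj₁ (from (members∈ S i))} λ {i} {j} e → members-injective S
    (trans (proj₂ (from (members∈ S i))) (trans (cong f e) (sym (proj₂ (from (members∈ S j))))))
  index : ∀ {n} (S : Subset.Subset n) {x} → x Subset.∈ S → ∃[ i ] members S i ≡ x
  index (true  ∷ S) Vec.here        = zero , refl
  index (true  ∷ S) (Vec.there x∈)  = let i , e = index S x∈ in suc i , cong suc e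
  index (false ∷ S) (Vec.there x∈)  = let i , e = index S x∈ in i , cong suc e
  lower : w ≤ Subset.∣ S ∣
  lower = Fin.injective⇒≤ {f = λ i → proj₁ (index S (to i))} λ {i} {j} e → inj
    (trans (sym (proj₂ (index S (to i)))) (trans (cong (members S) e) (proj₂ (index S (to j)))))

↔-injective : ∀ {A B : Set} (f : A ↔ B) {x y} → Inverse.to f x ≡ Inverse.to f y → x ≡ y
↔-injective f e = trans (sym (Inverse.inverseʳ f refl)) (Inverse.inverseʳ f e)

-- A poset whose order matrix consists of literals.
record Shape (I : Set) : Set₁ where
  field
    Element : Set
    size    : ℕ
    code    : Fin size ↔ Element
    leqLit  : Element → Element → Lit I

  decode : Fin size → Element
  decode = Inverse.to code

  encode : Element → Fin size
  encode = Inverse.from code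

  decode-encode : ∀ x → decode (encode x) ≡ x
  decode-encode x = Inverse.inverseˡ code refl

  decode-injective : ∀ {i j} → decode i ≡ decode j → i ≡ j
  decode-injective = ↔-injective code

  encode-injective : ∀ {x y} → encode x ≡ encode y → x ≡ y
  encode-injective {x} {y} e = trans (sym (decode-encode x)) (trans (cong decode e) (decode-encode y))

  entry : Fin size → Fin size → Lit I
  entry i j = leqLit (decode i) (decode j)

record IsOrder (A : Set) (_≤ᴬ_ : A → A → Set) : Set where
  field
    ≤-refl    : ∀ x → x ≤ᴬ x
    ≤-trans   : ∀ {x y z} → x ≤ᴬ y → y ≤ᴬ z → x ≤ᴬ z
    ≤-antisym : ∀ {x y} → x ≤ᴬ y → y ≤ᴬ x → x ≡ y

module _ {I : Set} (S : Shape I) (ρ : I → Bool) (_≤ᴬ_ : Shape.Element S → Shape.Element S → Set)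
  (isOrder : IsOrder (Shape.Element S) _≤ᴬ_)
  (leqLit⇔ : ∀ x y → evalL ρ (Shape.leqLit S x y) ≡ true ⇔ x ≤ᴬ y) where
  open Shape S
  open IsOrder isOrder

  shapePoset : Poset
  shapePoset = record
    { size = size
    ; leq  = λ i j → evalL ρ (entry i j)
    ; isPartialOrder = record
      { isPreorder = record
        { isEquivalence = isEquivalence
        ; reflexive = λ { {i} refl → from (≤-refl (decode i)) }
        ; trans = λ p q → from (≤-trans (to p) (to q))
        }
      ; antisym = λ p q → decode-injective (≤-antisym (to p) (to q))
      }
    }
    where
    to : ∀ {i j} → T (evalL ρ (entry i j)) → decode i ≤ᴬ decode j
    to p = Equivalence.to (leqLit⇔ _ _) (Equivalence.to 𝔹.T-≡ p)
    from : ∀ {i j} → decode i ≤ᴬ decode j → T (evalL ρ (entry i j))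
    from p = Equivalence.from 𝔹.T-≡ (Equivalence.from (leqLit⇔ _ _) p)

  shape-≼ : ∀ i j → Poset._≼_ shapePoset i j ⇔ decode i ≤ᴬ decode j
  shape-≼ i j = mk⇔ (λ p → Equivalence.to (leqLit⇔ _ _) (Equivalence.to 𝔹.T-≡ p))
                    (λ p → Equivalence.from 𝔹.T-≡ (Equivalence.from (leqLit⇔ _ _) p))

-- The poset of a constraint satisfaction problem

module Block {n : ℕ} (C : CSP n) where
  open CSP C renaming (#vars to V; #vals to D)

  height : ℕ
  height = suc (suc (V + V))

  Elem : Set
  Elem = Fin height ⊎ (Fin V × Fin D ⊎ Fin V × Fin D)

  pattern chain i  = inj₁ i
  pattern low u a  = inj₂ (inj₁ (u , a))
  pattern high u a = inj₂ (inj₂ (u , a))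

  _≟ᴱ_ : (x y : Elem) → Dec (x ≡ y)
  _≟ᴱ_ = Sum.≡-dec Fin._≟_ (Sum.≡-dec (Product.≡-dec Fin._≟_ Fin._≟_) (Product.≡-dec Fin._≟_ Fin._≟_))

  -- Distinct variables are related when their values are compatible. For a single variable the
  -- encoding uses incomparability: in the pattern `low u` is not below `high u`, and this can be
  -- matched here only if both images carry the same value and the negated literal is false, that
  -- is, the value is admissible.
  relate : Fin V → Fin D → Fin V → Fin D → Lit (Fin n)
  relate u a v b with u Fin.≟ v | a Fin.≟ b
  ... | yes _ | yes _ = negL (admissible u a)
  ... | yes _ | no _  = constL true
  ... | no _  | _     = constL (compatible u a v b)

  -- The lower half of the chain tells the colours of the high elements
  -- apart, the upper half those of the low elements.
  leqLit : Elem → Elem → Lit (Fin n)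
  leqLit (chain i)  (chain j)  = constL ⌊ toℕ i ℕ.≤? toℕ j ⌋
  leqLit (chain i)  (low _ _)  = constL false
  leqLit (chain i)  (high v _) = constL ⌊ toℕ i ℕ.≤? toℕ v ⌋
  leqLit (low u _)  (chain j)  = constL ⌊ suc (suc (V + toℕ u)) ℕ.≤? toℕ j ⌋
  leqLit (low u a)  (low v b)  = constL ⌊ Product.≡-dec Fin._≟_ Fin._≟_ (u , a) (v , b) ⌋
  leqLit (low u a)  (high v b) = relate u a v b
  leqLit (high _ _) (chain _)  = constL false
  leqLit (high _ _) (low _ _)  = constL false
  leqLit (high u a) (high v b) = constL ⌊ Product.≡-dec Fin._≟_ Fin._≟_ (u , a) (v , b) ⌋

  size : ℕ
  size = height + (V * D + V * D)

  abstract
    code : Fin size ↔ Elem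
    code = (↔-id _ ⊎-↔ ((Fin.*↔× ⊎-↔ Fin.*↔×) ↔-∘ Fin.+↔⊎)) ↔-∘ Fin.+↔⊎

module BlockOrder {n : ℕ} (C : CSP n) (ρ : Fin n → Bool) (0<V : 0 < CSP.#vars C) where
  open CSP C using () renaming (#vars to V; #vals to D)
  open Block C public

  _⊑_ : Elem → Elem → Set
  chain i  ⊑ chain j  = toℕ i ≤ toℕ j
  chain i  ⊑ low _ _  = ⊥
  chain i  ⊑ high v _ = toℕ i ≤ toℕ v
  low u _  ⊑ chain j  = suc (suc (V + toℕ u)) ≤ toℕ j
  low u a  ⊑ low v b  = (u , a) ≡ (v , b)
  low u a  ⊑ high v b = evalL ρ (relate u a v b) ≡ true
  high _ _ ⊑ chain _  = ⊥
  high _ _ ⊑ low _ _  = ⊥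
  high u a ⊑ high v b = (u , a) ≡ (v , b)

  private
    via : ∀ {P : Set} (d : Dec P) → ⌊ d ⌋ ≡ true ⇔ P
    via d = mk⇔ (dec-sound d) (dec-complete d)

  leqLit⇔⊑ : ∀ x y → evalL ρ (leqLit x y) ≡ true ⇔ x ⊑ y
  leqLit⇔⊑ (chain i)  (chain j)  = via _
  leqLit⇔⊑ (chain i)  (low _ _)  = mk⇔ (λ ()) (λ ())
  leqLit⇔⊑ (chain i)  (high v _) = via _
  leqLit⇔⊑ (low u _)  (chain j)  = via _
  leqLit⇔⊑ (low u a)  (low v b)  = via _
  leqLit⇔⊑ (low u a)  (high v b) = mk⇔ id id
  leqLit⇔⊑ (high _ _) (chain _)  = mk⇔ (λ ()) (λ ())
  leqLit⇔⊑ (high _ _) (low _ _)  = mk⇔ (λ ()) (λ ())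
  leqLit⇔⊑ (high u a) (high v b) = via _

  v<V : (v : Fin V) → toℕ v < V
  v<V = Fin.toℕ<n

  -- No chain element lies between a low and a high element. Otherwise transitivity would prescribe
  -- values of `relate`, which has to be arbitrary.
  below-above : ∀ {k} u v → suc (suc (V + u)) ≤ k → k ≤ toℕ {V} v → ⊥
  below-above u v lo hi = ℕ.<⇒≱ (v<V v)
    (ℕ.≤-trans (ℕ.≤-trans (ℕ.m≤m+n V u) (ℕ.≤-trans (ℕ.n≤1+n _) (ℕ.n≤1+n _))) (ℕ.≤-trans lo hi))

  ⊑-refl : ∀ x → x ⊑ x
  ⊑-refl (chain i)  = ℕ.≤-refl
  ⊑-refl (low _ _)  = refl
  ⊑-refl (high _ _) = refl

  ⊑-trans : ∀ {x y z} → x ⊑ y → y ⊑ z → x ⊑ z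
  ⊑-trans {chain _} {chain _} {chain _}  p q = ℕ.≤-trans p q
  ⊑-trans {chain _} {chain _} {high _ _} p q = ℕ.≤-trans p q
  ⊑-trans {chain _} {high _ _} {high _ _} p refl = p
  ⊑-trans {low _ _} {chain _} {chain _}  p q = ℕ.≤-trans p q
  ⊑-trans {low u _} {chain _} {high v _} p q = ⊥-elim (below-above (toℕ u) v p q)
  ⊑-trans {low _ _} {low _ _} refl q = q
  ⊑-trans {low _ _} {high _ _} {high _ _} p refl = p
  ⊑-trans {high _ _} {high _ _} refl q = q

  ⊑-antisym : ∀ {x y} → x ⊑ y → y ⊑ x → x ≡ y
  ⊑-antisym {chain _}  {chain _}  p q = cong inj₁ (Fin.toℕ-injective (ℕ.≤-antisym p q))
  ⊑-antisym {chain _}  {low _ _}  () _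
  ⊑-antisym {chain _}  {high _ _} _ ()
  ⊑-antisym {low _ _}  {low _ _}  refl _ = refl
  ⊑-antisym {high _ _} {high _ _} refl _ = refl

  -- Strictly increasing and below `height`, so in any embedded chain of `height` elements the
  -- element number `i` has rank `i`. The ranks 1 and `V + V` avoid the extremes 0 and
  -- `suc (V + V)`, which are attained by the ends of the chain alone.
  rank : Elem → ℕ
  rank (chain i)  = toℕ i
  rank (low _ _)  = 1
  rank (high _ _) = V + V

  2≤V+V : 2 ≤ V + V
  2≤V+V = ℕ.+-mono-≤ 0<V 0<V

  rank-mono : ∀ {x y} → x ⊑ y → x ≢ y → rank x < rank y
  rank-mono {chain i}  {chain j}  p ne = ℕ.≤∧≢⇒< p (λ e → ne (cong inj₁ (Fin.toℕ-injective e)))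
  rank-mono {chain _}  {high v _} p _  = ℕ.≤-<-trans p (ℕ.≤-trans (v<V v) (ℕ.m≤m+n V V))
  rank-mono {low _ _}  {chain _}  p _  = ℕ.≤-trans (s≤s (s≤s z≤n)) p
  rank-mono {low _ _}  {low _ _}  refl ne = contradiction refl ne
  rank-mono {low _ _}  {high _ _} _ _  = 2≤V+V
  rank-mono {high _ _} {high _ _} refl ne = contradiction refl ne

  rank<height : ∀ x → rank x < height
  rank<height (chain i)  = Fin.toℕ<n i
  rank<height (low _ _)  = s≤s (s≤s z≤n)
  rank<height (high _ _) = ℕ.n≤1+n _

-- The block of this problem is the pattern that is to be embedded.
trivialCSP : ℕ → CSP 0
trivialCSP V = record
  { #vars = V ; #vals = 1 ; compatible = λ _ _ _ _ → true ; admissible = λ _ _ → constL true }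

noBits : Fin 0 → Bool
noBits ()

-- Embeddings of the pattern into a block

module BlockEmbedding {n : ℕ} (C : CSP n) (ρ : Fin n → Bool) (0<V : 0 < CSP.#vars C) where
  open CSP C renaming (#vars to V; #vals to D)
  module B = BlockOrder C ρ 0<V
  module Q = BlockOrder (trivialCSP V) noBits 0<V
  open B using (chain; low; high; height; rank)

  relate-pattern : ∀ u v → u ≢ v → evalL noBits (Q.relate u zero v zero) ≡ true
  relate-pattern u v u≢v with u Fin.≟ v
  ... | yes e = contradiction e u≢v
  ... | no _  = refl

  relate-pattern-self : ∀ u → evalL noBits (Q.relate u zero u zero) ≡ false
  relate-pattern-self u with u Fin.≟ u
  ... | yes _ = refl
  ... | no ne = contradiction refl ne

  module Extract (e : Q.Elem → B.Elem) (mono : ∀ {x y} → x Q.⊑ y → e x B.⊑ e y)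
    (cancel : ∀ {x y} → e x B.⊑ e y → x Q.⊑ y) where

    e-injective : ∀ {x y} → e x ≡ e y → x ≡ y
    e-injective {x} {y} eqn = Q.⊑-antisym (cancel (subst (e x B.⊑_) eqn (B.⊑-refl (e x))))
                                         (cancel (subst (B._⊑ e x) eqn (B.⊑-refl (e x))))

    rank-chain : ∀ i → rank (e (chain i)) ≡ toℕ i
    rank-chain = squeeze 0 (λ i → rank (e (chain i)))
      (λ {i} {j} i<j → B.rank-mono (mono {chain i} {chain j} (ℕ.<⇒≤ i<j))
         (λ eqn → ℕ.<⇒≱ i<j (cancel {chain j} {chain i} (subst (B._⊑ e (chain i)) eqn (B.⊑-refl (e (chain i)))))))
      (λ _ → z≤n) (λ i → B.rank<height (e (chain i)))

    top : Fin height
    top = Fin.fromℕ (suc (V + V))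

    toℕ-top : toℕ top ≡ suc (V + V)
    toℕ-top = Fin.toℕ-fromℕ _

    e-bottom : e (chain zero) ≡ chain zero
    e-bottom with e (chain zero) | rank-chain zero
    ... | chain zero | _ = refl
    ... | high _ _   | r = contradiction (subst (2 ≤_) r B.2≤V+V) λ ()

    e-top : e (chain top) ≡ chain top
    e-top with e (chain top) | rank-chain top
    ... | chain i  | r = cong inj₁ (Fin.toℕ-injective r)
    ... | low _ _  | r = contradiction (subst (λ k → 2 ≤ k ∸ 1) (trans (sym toℕ-top) (sym r)) B.2≤V+V) λ ()
    ... | high _ _ | r = contradiction (trans r toℕ-top) (ℕ.1+n≢n ∘ sym)

    -- Bottom and top are fixed already, and only chain elements lie between them: a low element is
    -- not above the bottom, a high element is not below the top. The rank then determines the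
    -- element.
    e-chain : ∀ i → e (chain i) ≡ chain i
    e-chain i with e (chain i) in eqn | rank-chain i
    ... | chain j  | r = cong inj₁ (Fin.toℕ-injective r)
    ... | low _ _  | r = ⊥-elim (subst₂ B._⊑_ e-bottom eqn (mono {chain zero} {chain i} z≤n))
    ... | high _ _ | r = ⊥-elim (subst₂ B._⊑_ eqn e-top (mono {chain i} {chain top}
            (subst (toℕ i ≤_) (sym toℕ-top) (s≤s⁻¹ (Fin.toℕ<n i)))))

    low-threshold : ∀ {u u′ : Fin V} →
      (∀ (j : Fin height) → suc (suc (V + toℕ u)) ≤ toℕ j → suc (suc (V + toℕ u′)) ≤ toℕ j) → toℕ u′ ≤ toℕ u
    low-threshold {u} {u′} h = ℕ.+-cancelˡ-≤ V _ _ (s≤s⁻¹ (s≤s⁻¹ (subst (suc (suc (V + toℕ u′)) ≤_) toℕ-j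
        (h j (ℕ.≤-reflexive (sym toℕ-j))))))
      where
      thr< : suc (suc (V + toℕ u)) < height
      thr< = s≤s (s≤s (subst (_≤ V + V) (ℕ.+-suc V (toℕ u)) (ℕ.+-monoʳ-≤ V (Fin.toℕ<n u))))
      j : Fin height
      j = Fin.fromℕ< thr<
      toℕ-j : toℕ j ≡ suc (suc (V + toℕ u))
      toℕ-j = Fin.toℕ-fromℕ< thr<

    -- The chain is fixed pointwise, and the chain elements above a low element determine its
    -- variable. The only freedom left is the value, which becomes the solution `f`.
    e-low : ∀ u → ∃[ a ] e (low u zero) ≡ low u a
    e-low u with e (low u zero) in eqn
    ... | chain i = contradiction (e-injective (trans (e-chain i) (sym eqn))) λ ()
    ... | high v b = ⊥-elim (subst₂ B._⊑_ eqn (e-chain top) (mono {low u zero} {chain top}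
            (subst (suc (suc (V + toℕ u)) ≤_) (sym toℕ-top)
               (s≤s (subst (_≤ V + V) (ℕ.+-suc V (toℕ u)) (ℕ.+-monoʳ-≤ V (Fin.toℕ<n u)))))))
    ... | low v a = a , cong (λ u → low u a) (Fin.toℕ-injective (ℕ.≤-antisym
            (low-threshold (λ j p → subst₂ B._⊑_ eqn (e-chain j) (mono {low u zero} {chain j} p)))
            (low-threshold (λ j p → cancel {low u zero} {chain j} (subst₂ B._⊑_ (sym eqn) (sym (e-chain j)) p)))))

    high-threshold : ∀ {v v′ : Fin V} →
      (∀ (j : Fin height) → toℕ j ≤ toℕ v → toℕ j ≤ toℕ v′) → toℕ v ≤ toℕ v′
    high-threshold {v} {v′} h = subst (_≤ toℕ v′) (Fin.toℕ-inject≤ v V≤) (h (Fin.inject≤ v V≤)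
        (ℕ.≤-reflexive (Fin.toℕ-inject≤ v V≤)))
      where
      V≤ : V ≤ height
      V≤ = ℕ.≤-trans (ℕ.m≤m+n V V) (ℕ.≤-trans (ℕ.n≤1+n _) (ℕ.n≤1+n _))

    e-high : ∀ v → ∃[ b ] e (high v zero) ≡ high v b
    e-high v with e (high v zero) in eqn
    ... | chain i = contradiction (e-injective (trans (e-chain i) (sym eqn))) λ ()
    ... | low u a = ⊥-elim (subst₂ B._⊑_ e-bottom eqn (mono {chain zero} {high v zero} z≤n))
    ... | high w b = b , cong (λ v → high v b) (Fin.toℕ-injective (ℕ.≤-antisym
            (high-threshold (λ j p → cancel {chain j} {high v zero} (subst₂ B._⊑_ (sym (e-chain j)) (sym eqn) p)))
            (high-threshold (λ j p → subst₂ B._⊑_ (e-chain j) eqn (mono {chain j} {high v zero} p)))))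

    f : Fin V → Fin D
    f u = proj₁ (e-low u)

    relate-false : ∀ u a b → ¬ evalL ρ (B.relate u a u b) ≡ true → a ≡ b × evalL ρ (admissible u a) ≡ true
    relate-false u a b h with u Fin.≟ u | a Fin.≟ b
    ... | yes _ | yes a≡b = a≡b , trans (sym (𝔹.not-involutive _))
          (cong not (trans (sym (evalL-neg ρ (admissible u a))) (𝔹.¬-not h)))
    ... | yes _ | no _    = contradiction refl h
    ... | no ne | _       = contradiction refl ne

    diagonal : ∀ u → f u ≡ proj₁ (e-high u) × evalL ρ (admissible u (f u)) ≡ true
    diagonal u = relate-false u _ _ λ h → contradiction
      (cancel {low u zero} {high u zero} (subst₂ B._⊑_ (sym (proj₂ (e-low u))) (sym (proj₂ (e-high u))) h))
      (𝔹.not-¬ (relate-pattern-self u))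

    solution : Solution ρ f
    solution = (λ u v u≢v → compat u v u≢v (subst (λ b → evalL ρ (B.relate u (f u) v b) ≡ true) (sym (proj₁ (diagonal v)))
                   (subst₂ B._⊑_ (proj₂ (e-low u)) (proj₂ (e-high v)) (mono {low u zero} {high v zero} (relate-pattern u v u≢v)))))
             , λ u → proj₂ (diagonal u)
      where
      compat : ∀ u v {a b} → u ≢ v → evalL ρ (B.relate u a v b) ≡ true → compatible u a v b ≡ true
      compat u v u≢v h with u Fin.≟ v
      ... | yes e = contradiction e u≢v
      ... | no _  = h

  module Construct (f : Fin V → Fin D) (sol : Solution ρ f) where

    e : Q.Elem → B.Elem
    e (chain i)  = chain i
    e (low u _)  = low u (f u)
    e (high v _) = high v (f v)

    mono : ∀ {x y} → x Q.⊑ y → e x B.⊑ e y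
    mono {chain _}  {chain _}  p = p
    mono {chain _}  {high _ _} p = p
    mono {low _ _}  {chain _}  p = p
    mono {low _ _}  {low _ _}  refl = refl
    mono {high _ _} {high _ _} refl = refl
    mono {low u zero} {high v zero} p with u Fin.≟ v | f u Fin.≟ f v
    ... | no u≢v | _ = proj₁ sol u v u≢v
    ... | yes refl | _ = contradiction p λ ()

    cancel : ∀ {x y} → e x B.⊑ e y → x Q.⊑ y
    cancel {chain _}  {chain _}  p = p
    cancel {chain _}  {high _ _} p = p
    cancel {low _ _}  {chain _}  p = p
    cancel {low u zero}  {low .u zero}  refl = refl
    cancel {high u zero} {high .u zero} refl = refl
    cancel {low u zero} {high v zero} p with u Fin.≟ v | f u Fin.≟ f v
    ... | no _     | _        = refl
    ... | yes refl | yes _    = contradiction p (𝔹.not-¬ (trans (evalL-neg ρ (admissible u (f u))) (cong not (proj₂ sol u))))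
    ... | yes refl | no f≢f   = contradiction refl f≢f

-- Linear sums of blocks

module Sums {n : ℕ} (C : CSP n) (0<V : 0 < CSP.#vars C) (t : ℕ) where
  open CSP C using (Satisfiable) renaming (#vars to V; #vals to D)

  Bit : Set
  Bit = Fin t × Fin n

  open Block C using (leqLit; _≟ᴱ_) renaming (Elem to Local; code to localCode; size to blockSize)
  module Q = BlockOrder (trivialCSP V) noBits 0<V
  open Q using (chain; low; high)

  Elem : Set
  Elem = Fin (suc t) × Local

  -- The block with index zero is an antichain, which fixes the width.
  withinLit : Fin (suc t) → Local → Local → Lit Bit
  withinLit zero    a b = constL ⌊ a ≟ᴱ b ⌋
  withinLit (suc c) a b = mapL (c ,_) (leqLit a b)

  sumLit : Elem → Elem → Lit Bit
  sumLit (i , a) (j , b) =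
    if ⌊ toℕ i ℕ.<? toℕ j ⌋ then constL true else if ⌊ i Fin.≟ j ⌋ then withinLit i a b else constL false

  abstract
    sumCode : Fin (suc t * blockSize) ↔ Elem
    sumCode = (↔-id _ ×-↔ localCode) ↔-∘ Fin.*↔×

  sumShape : Shape Bit
  sumShape = record
    { Element = Elem
    ; size    = suc t * blockSize
    ; code    = sumCode
    ; leqLit  = sumLit
    }

  patternShape : Shape (Fin 0)
  patternShape = record { Element = Q.Elem ; size = Q.size ; code = Q.code ; leqLit = Q.leqLit }

  pattern-isOrder : IsOrder Q.Elem Q._⊑_
  pattern-isOrder = record
    { ≤-refl = Q.⊑-refl ; ≤-trans = λ {x} {y} {z} → Q.⊑-trans {x} {y} {z} ; ≤-antisym = Q.⊑-antisym }

  patternPoset : Poset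
  patternPoset = shapePoset patternShape noBits Q._⊑_ pattern-isOrder Q.leqLit⇔⊑

  module Instance (X : Bit → Bool) where

    module B (c : Fin t) = BlockOrder C (λ j → X (c , j)) 0<V

    Within : Fin (suc t) → Local → Local → Set
    Within zero    a b = a ≡ b
    Within (suc c) a b = B._⊑_ c a b

    _≤ˢ_ : Elem → Elem → Set
    (i , a) ≤ˢ (j , b) = toℕ i < toℕ j ⊎ (i ≡ j × Within i a b)

    within-refl : ∀ i a → Within i a a
    within-refl zero    a = refl
    within-refl (suc c) a = B.⊑-refl c a

    within-trans : ∀ i {x y z} → Within i x y → Within i y z → Within i x z
    within-trans zero    p q = trans p q
    within-trans (suc c) {x} {y} {z} p q = B.⊑-trans c {x} {y} {z} p q

    within-antisym : ∀ i {x y} → Within i x y → Within i y x → x ≡ y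
    within-antisym zero    p _ = p
    within-antisym (suc c) p q = B.⊑-antisym c p q

    sum-isOrder : IsOrder Elem _≤ˢ_
    sum-isOrder = record
      { ≤-refl    = λ (i , a) → inj₂ (refl , within-refl i a)
      ; ≤-trans   = λ
        { (inj₁ p)          (inj₁ q)          → inj₁ (ℕ.<-trans p q)
        ; (inj₁ p)          (inj₂ (refl , _)) → inj₁ p
        ; (inj₂ (refl , _)) (inj₁ q)          → inj₁ q
        ; {i , _} (inj₂ (refl , p)) (inj₂ (refl , q)) → inj₂ (refl , within-trans i p q) }
      ; ≤-antisym = λ
        { (inj₁ p)          (inj₁ q)          → contradiction q (ℕ.<⇒≯ p)
        ; (inj₁ p)          (inj₂ (refl , _)) → contradiction p (ℕ.<-irrefl refl)
        ; (inj₂ (refl , _)) (inj₁ q)          → contradiction q (ℕ.<-irrefl refl)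
        ; {i , _} (inj₂ (refl , p)) (inj₂ (refl , q)) → cong (i ,_) (within-antisym i p q) }
      }

    withinLit⇔ : ∀ i a b → evalL X (withinLit i a b) ≡ true ⇔ Within i a b
    withinLit⇔ zero    a b = mk⇔ (dec-sound (a ≟ᴱ b)) (dec-complete (a ≟ᴱ b))
    withinLit⇔ (suc c) a b rewrite evalL-map (c ,_) X (leqLit a b) = B.leqLit⇔⊑ c a b

    sumLit⇔ : ∀ x y → evalL X (sumLit x y) ≡ true ⇔ x ≤ˢ y
    sumLit⇔ (i , a) (j , b) with toℕ i ℕ.<? toℕ j | i Fin.≟ j
    ... | yes i<j | _        = mk⇔ (λ _ → inj₁ i<j) (λ _ → refl)
    ... | no i≮j  | no i≢j   = mk⇔ (λ ()) λ { (inj₁ p) → contradiction p i≮j ; (inj₂ (p , _)) → contradiction p i≢j }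
    ... | no i≮j  | yes refl = mk⇔ (λ h → inj₂ (refl , Equivalence.to (withinLit⇔ i a b) h))
      λ { (inj₁ p) → contradiction p i≮j ; (inj₂ (refl , p)) → Equivalence.from (withinLit⇔ i a b) p }

    sumPoset : Poset
    sumPoset = shapePoset sumShape X _≤ˢ_ sum-isOrder sumLit⇔

    open Shape

    sum-≼ : ∀ i j → Poset._≼_ sumPoset i j ⇔ decode sumShape i ≤ˢ decode sumShape j
    sum-≼ = shape-≼ sumShape X _≤ˢ_ sum-isOrder sumLit⇔

    pattern-≼ : ∀ i j → Poset._≼_ patternPoset i j ⇔ decode patternShape i Q.⊑ decode patternShape j
    pattern-≼ = shape-≼ patternShape noBits Q._⊑_ pattern-isOrder Q.leqLit⇔⊑

    comparable : ∀ {i j a b} → i ≢ j → (i , a) ≤ˢ (j , b) ⊎ (j , b) ≤ˢ (i , a)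
    comparable {i} {j} i≢j with ℕ.<-cmp (toℕ i) (toℕ j)
    ... | tri< p _ _ = inj₁ (inj₁ p)
    ... | tri≈ _ p _ = contradiction (Fin.toℕ-injective p) i≢j
    ... | tri> _ _ p = inj₂ (inj₁ p)

    -- Elements of different blocks are comparable, so forgetting the block is injective on an
    -- antichain. Block zero attains the resulting bound.
    sum-width : Poset.HasWidth sumPoset blockSize
    sum-width = (S , antichain , proj₂ (proj₂ bottom)) , λ S anti → ∣∣≤-injective S local (local-injective S anti)
      where
      place : Fin blockSize → Fin (Poset.size sumPoset)
      place i = encode sumShape (zero , Inverse.to localCode i)
      place-injective : ∀ {i j} → place i ≡ place j → i ≡ j
      place-injective e = ↔-injective localCode (cong proj₂ (encode-injective sumShape e))
      bottom = injective⇒≤-∣∣ place place-injective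
      S = proj₁ bottom
      bottom≤ : ∀ i j → Poset._≼_ sumPoset (place i) (place j) → i ≡ j
      bottom≤ i j p with subst₂ _≤ˢ_ (decode-encode sumShape _) (decode-encode sumShape _) (Equivalence.to (sum-≼ _ _) p)
      ... | inj₂ (_ , e) = ↔-injective localCode e
      antichain : Poset.Antichain sumPoset S
      antichain i j i∈ j∈ i≢j with proj₁ (proj₂ bottom) i∈ | proj₁ (proj₂ bottom) j∈
      ... | i′ , refl | j′ , refl = λ
        { (inj₁ p) → i≢j (cong place (bottom≤ i′ j′ p)) ; (inj₂ p) → i≢j (cong place (sym (bottom≤ j′ i′ p))) }
      local : Fin (Poset.size sumPoset) → Fin blockSize
      local x = Inverse.from localCode (proj₂ (decode sumShape x))
      local-injective : ∀ S → Poset.Antichain sumPoset S → ∀ {i j} →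
        i Subset.∈ S → j Subset.∈ S → local i ≡ local j → i ≡ j
      local-injective S anti {i} {j} i∈ j∈ e with i Fin.≟ j
      ... | yes i≡j = i≡j
      ... | no i≢j with proj₁ (decode sumShape i) Fin.≟ proj₁ (decode sumShape j)
      ...   | yes b = decode-injective sumShape (cong₂ _,_ b
                (trans (sym (Inverse.inverseˡ localCode refl)) (trans (cong (Inverse.to localCode) e) (Inverse.inverseˡ localCode refl))))
      ...   | no b = contradiction
                ([ (λ p → inj₁ (Equivalence.from (sum-≼ i j) p)) , (λ p → inj₂ (Equivalence.from (sum-≼ j i) p)) ]′ (comparable b))
                (anti i j i∈ j∈ i≢j)

    -- The incomparability graph of the pattern is connected, so the
    -- pattern is embedded into a single block.
    module Connected (e : Q.Elem → Elem) (mono : ∀ {x y} → x Q.⊑ y → e x ≤ˢ e y)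
      (cancel : ∀ {x y} → e x ≤ˢ e y → x Q.⊑ y) where

      blockOf : Q.Elem → Fin (suc t)
      blockOf x = proj₁ (e x)

      incomparable : ∀ {x y} → ¬ x Q.⊑ y → ¬ y Q.⊑ x → blockOf x ≡ blockOf y
      incomparable {x} {y} x⋢y y⋢x with blockOf x Fin.≟ blockOf y
      ... | yes b = b
      ... | no b  = ⊥-elim ([ x⋢y ∘ cancel , y⋢x ∘ cancel ]′ (comparable b))

      v₀ : Fin V
      v₀ = Fin.fromℕ< 0<V

      b₀ : Fin (suc t)
      b₀ = blockOf (low v₀ zero)

      low-block : ∀ u → blockOf (low u zero) ≡ b₀
      low-block u with u Fin.≟ v₀
      ... | yes refl = refl
      ... | no u≢v   = incomparable (λ { refl → u≢v refl }) (λ { refl → u≢v refl })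

      high-block : ∀ v → blockOf (high v zero) ≡ b₀
      high-block v = trans (sym (incomparable {low v zero} {high v zero}
        (𝔹.not-¬ (BlockEmbedding.relate-pattern-self C (const false) 0<V v)) λ ())) (low-block v)

      single-block : ∀ x → blockOf x ≡ b₀
      single-block (low u zero)  = low-block u
      single-block (high v zero) = high-block v
      -- The thresholds of the low elements lie above `V` and those of the high elements below it,
      -- so each chain element is incomparable to `low v₀` or to `high v₀`.
      single-block (chain i) with toℕ i ℕ.<? V
      ... | yes i<V = incomparable {chain i} {low v₀ zero} (λ ())
              λ p → ℕ.<⇒≱ i<V (ℕ.≤-trans (ℕ.≤-trans (ℕ.m≤m+n V (toℕ v₀)) (ℕ.≤-trans (ℕ.n≤1+n _) (ℕ.n≤1+n _))) p)
      ... | no i≮V  = trans (incomparable {chain i} {high v₀ zero} (λ p → i≮V (ℕ.≤-<-trans p (Fin.toℕ<n v₀))) λ ()) (high-block v₀)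

      within : ∀ {x y} → x Q.⊑ y → Within b₀ (proj₂ (e x)) (proj₂ (e y))
      within {x} {y} p with mono p
      ... | inj₁ q = contradiction q (ℕ.<-irrefl (cong toℕ (trans (single-block x) (sym (single-block y)))))
      ... | inj₂ (_ , q) = subst (λ b → Within b (proj₂ (e x)) (proj₂ (e y))) (single-block x) q

      cancel-within : ∀ {x y} → Within b₀ (proj₂ (e x)) (proj₂ (e y)) → x Q.⊑ y
      cancel-within {x} {y} p = cancel (inj₂ (trans (single-block x) (sym (single-block y)) ,
        subst (λ b → Within b (proj₂ (e x)) (proj₂ (e y))) (sym (single-block x)) p))

      satisfiable : ∃[ c ] Satisfiable (λ j → X (c , j))
      satisfiable with b₀ | within | cancel-within
      -- In the antichain block comparable elements are equal, which would collapse the chain of the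
      -- pattern.
      ... | zero  | w | cw = contradiction (cw {chain (suc zero)} {chain zero} (sym (w {chain zero} {chain (suc zero)} z≤n))) λ ()
      ... | suc c | w | cw = c , E.f , E.solution
        where module E = BlockEmbedding.Extract C (λ j → X (c , j)) 0<V (proj₂ ∘ e)
                           (λ {x} {y} → w {x} {y}) (λ {x} {y} → cw {x} {y})

    embeds⇔ : patternPoset Embeds sumPoset ⇔ (∃[ c ] Satisfiable (λ j → X (c , j)))
    embeds⇔ = mk⇔ to from
      where
      to : patternPoset Embeds sumPoset → ∃[ c ] Satisfiable (λ j → X (c , j))
      to (g , isMono) = Connected.satisfiable (decode sumShape ∘ g ∘ encode patternShape)
        (λ {x} {y} p → Equivalence.to (sum-≼ _ _) (mono (Equivalence.from (pattern-≼ _ _)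
            (subst₂ Q._⊑_ (sym (decode-encode patternShape x)) (sym (decode-encode patternShape y)) p))))
        (λ {x} {y} p → subst₂ Q._⊑_ (decode-encode patternShape x) (decode-encode patternShape y)
            (Equivalence.to (pattern-≼ _ _) (cancel (Equivalence.from (sum-≼ _ _) p))))
        where open IsOrderMonomorphism isMono
      from : (∃[ c ] Satisfiable (λ j → X (c , j))) → patternPoset Embeds sumPoset
      from (c , f , sol) = g , record
        { isOrderHomomorphism = record { cong = cong g ; mono = g-mono }
        ; injective = λ {i} {j} e≡ → Poset-antisym
            (g-cancel (Equivalence.from (sum-≼ _ _) (subst (λ k → decode sumShape (g i) ≤ˢ decode sumShape k) e≡ (IsOrder.≤-refl sum-isOrder _))))
            (g-cancel (Equivalence.from (sum-≼ _ _) (subst (λ k → decode sumShape k ≤ˢ decode sumShape (g i)) e≡ (IsOrder.≤-refl sum-isOrder _))))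
        ; cancel = g-cancel
        }
        where
        Poset-antisym = IsPartialOrder.antisym (Poset.isPartialOrder patternPoset)
        module E = BlockEmbedding.Construct C (λ j → X (c , j)) 0<V f sol
        g : Fin (Poset.size patternPoset) → Fin (Poset.size sumPoset)
        g i = encode sumShape (suc c , E.e (decode patternShape i))
        g-mono : ∀ {i j} → Poset._≼_ patternPoset i j → Poset._≼_ sumPoset (g i) (g j)
        g-mono {i} {j} p = Equivalence.from (sum-≼ _ _)
          (subst₂ _≤ˢ_ (sym (decode-encode sumShape _)) (sym (decode-encode sumShape _))
            (inj₂ (refl , E.mono {decode patternShape i} {decode patternShape j} (Equivalence.to (pattern-≼ i j) p))))
        g-cancel : ∀ {i j} → Poset._≼_ sumPoset (g i) (g j) → Poset._≼_ patternPoset i j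
        g-cancel {i} {j} p with subst₂ _≤ˢ_ (decode-encode sumShape _) (decode-encode sumShape _) (Equivalence.to (sum-≼ _ _) p)
        ... | inj₁ q       = contradiction q (ℕ.<-irrefl refl)
        ... | inj₂ (_ , q) = Equivalence.from (pattern-≼ i j) (E.cancel {decode patternShape i} {decode patternShape j} q)

-- Encodings

⟨⟩-injective : ∀ u u′ {v v′} → ⟨ u , v ⟩ ≡ ⟨ u′ , v′ ⟩ → u ≡ u′ × v ≡ v′
⟨⟩-injective []      []        refl = refl , refl
⟨⟩-injective (b ∷ u) (b′ ∷ u′) e with List.∷-injective (List.∷-injectiveʳ e)
... | refl , e′ = let p , q = ⟨⟩-injective u u′ e′ in cong (b ∷_) p , q

unary-injective : ∀ m n {u v} → unary m ++ u ≡ unary n ++ v → m ≡ n × u ≡ v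
unary-injective zero    zero    refl = refl , refl
unary-injective (suc m) (suc n) e =
  let p , q = unary-injective m n (List.∷-injectiveʳ e) in cong suc p , q

unary-toℕ-injective : ∀ {n} (i j : Fin n) {u v} → unary (toℕ i) ++ u ≡ unary (toℕ j) ++ v → i ≡ j × u ≡ v
unary-toℕ-injective i j e = let p , q = unary-injective (toℕ i) (toℕ j) e in Fin.toℕ-injective p , q

length-unary : ∀ n → length (unary n) ≡ suc n
length-unary n = trans (List.length-++ (replicate n true))
  (trans (cong (_+ 1) (List.length-replicate n)) (ℕ.+-comm n 1))

drop-tag : ∀ {a b c a′ b′ c′ : Bool} {u v : Word} →
  _≡_ {A = Word} (a ∷ b ∷ c ∷ u) (a′ ∷ b′ ∷ c′ ∷ v) → u ≡ v
drop-tag refl = refl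

-- The trailing words turn injectivity into unique readability of a prefix code, which the binary
-- connectives require.
formula-injective : ∀ {n} (φ ψ : Formula n) {u v} →
  encodeFormula φ ++ u ≡ encodeFormula ψ ++ v → φ ≡ ψ × u ≡ v

variables-injective : ∀ {n} (x y x′ y′ : Fin n) {u v} →
  (unary (toℕ x) ++ unary (toℕ y)) ++ u ≡ (unary (toℕ x′) ++ unary (toℕ y′)) ++ v → x ≡ x′ × y ≡ y′ × u ≡ v
variables-injective x y x′ y′ {u} {v} e
  with refl , e′ ← unary-toℕ-injective x x′ (trans (sym (List.++-assoc (unary (toℕ x)) (unary (toℕ y)) u))
                     (trans e (List.++-assoc (unary (toℕ x′)) (unary (toℕ y′)) v)))
  with refl , e″ ← unary-toℕ-injective y y′ e′ = refl , refl , e″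

formulas-injective : ∀ {n} (φ χ φ′ χ′ : Formula n) {u v} →
  (encodeFormula φ ++ encodeFormula χ) ++ u ≡ (encodeFormula φ′ ++ encodeFormula χ′) ++ v → φ ≡ φ′ × χ ≡ χ′ × u ≡ v
formulas-injective φ χ φ′ χ′ {u} {v} e
  with refl , e′ ← formula-injective φ φ′ (trans (sym (List.++-assoc (encodeFormula φ) (encodeFormula χ) u))
                     (trans e (List.++-assoc (encodeFormula φ′) (encodeFormula χ′) v)))
  with refl , e″ ← formula-injective χ χ′ e′ = refl , refl , e″

formula-injective (leF x y) (leF x′ y′) e
  with refl , refl , e′ ← variables-injective x y x′ y′ (drop-tag e) = refl , e′
formula-injective (eqF x y) (eqF x′ y′) e
  with refl , refl , e′ ← variables-injective x y x′ y′ (drop-tag e) = refl , e′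
formula-injective (notF φ) (notF ψ) e
  with refl , e′ ← formula-injective φ ψ (drop-tag e) = refl , e′
formula-injective (andF φ χ) (andF φ′ χ′) e
  with refl , refl , e′ ← formulas-injective φ χ φ′ χ′ (drop-tag e) = refl , e′
formula-injective (orF φ χ) (orF φ′ χ′) e
  with refl , refl , e′ ← formulas-injective φ χ φ′ χ′ (drop-tag e) = refl , e′
formula-injective (exF φ) (exF ψ) e
  with refl , e′ ← formula-injective φ ψ (drop-tag e) = refl , e′
formula-injective (allF φ) (allF ψ) e
  with refl , e′ ← formula-injective φ ψ (drop-tag e) = refl , e′
formula-injective (leF _ _) (eqF _ _) ()
formula-injective (leF _ _) (notF _) ()
formula-injective (leF _ _) (andF _ _) ()
formula-injective (leF _ _) (orF _ _) ()
formula-injective (leF _ _) (exF _) ()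
formula-injective (leF _ _) (allF _) ()
formula-injective (eqF _ _) (leF _ _) ()
formula-injective (eqF _ _) (notF _) ()
formula-injective (eqF _ _) (andF _ _) ()
formula-injective (eqF _ _) (orF _ _) ()
formula-injective (eqF _ _) (exF _) ()
formula-injective (eqF _ _) (allF _) ()
formula-injective (notF _) (leF _ _) ()
formula-injective (notF _) (eqF _ _) ()
formula-injective (notF _) (andF _ _) ()
formula-injective (notF _) (orF _ _) ()
formula-injective (notF _) (exF _) ()
formula-injective (notF _) (allF _) ()
formula-injective (andF _ _) (leF _ _) ()
formula-injective (andF _ _) (eqF _ _) ()
formula-injective (andF _ _) (notF _) ()
formula-injective (andF _ _) (orF _ _) ()
formula-injective (andF _ _) (exF _) ()
formula-injective (andF _ _) (allF _) ()
formula-injective (orF _ _) (leF _ _) ()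
formula-injective (orF _ _) (eqF _ _) ()
formula-injective (orF _ _) (notF _) ()
formula-injective (orF _ _) (andF _ _) ()
formula-injective (orF _ _) (exF _) ()
formula-injective (orF _ _) (allF _) ()
formula-injective (exF _) (leF _ _) ()
formula-injective (exF _) (eqF _ _) ()
formula-injective (exF _) (notF _) ()
formula-injective (exF _) (andF _ _) ()
formula-injective (exF _) (orF _ _) ()
formula-injective (exF _) (allF _) ()
formula-injective (allF _) (leF _ _) ()
formula-injective (allF _) (eqF _ _) ()
formula-injective (allF _) (notF _) ()
formula-injective (allF _) (andF _ _) ()
formula-injective (allF _) (orF _ _) ()
formula-injective (allF _) (exF _) ()

-- An encoding determines the order matrix pointwise and says nothing about the proof of
-- `isPartialOrder`. Embeddings respect this coarser equality.
data _≈ᴾ_ : Poset → Poset → Set where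
  same : ∀ {s l l′ po po′} → (∀ i j → l i j ≡ l′ i j) →
    record { size = s ; leq = l ; isPartialOrder = po } ≈ᴾ record { size = s ; leq = l′ ; isPartialOrder = po′ }

≈ᴾ-refl : ∀ P → P ≈ᴾ P
≈ᴾ-refl _ = same λ _ _ → refl

map-++-injective : ∀ {A : Set} (f g : A → Bool) xs {u v} → map f xs ++ u ≡ map g xs ++ v →
  (∀ {x} → x ∈ xs → f x ≡ g x) × u ≡ v
map-++-injective f g []       e = (λ ()) , e
map-++-injective f g (x ∷ xs) e =
  let p , e′ = List.∷-injective e ; h , q = map-++-injective f g xs e′ in
  (λ { (here refl) → p ; (there x∈) → h x∈ }) , q

rows-injective : ∀ {A : Set} (l l′ : A → A → Bool) xs ys →
  concatMap (λ i → map (l i) ys) xs ≡ concatMap (λ i → map (l′ i) ys) xs →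
  ∀ {i j} → i ∈ xs → j ∈ ys → l i j ≡ l′ i j
rows-injective l l′ (x ∷ xs) ys e i∈ j∈ with map-++-injective (l x) (l′ x) ys e
rows-injective l l′ (x ∷ xs) ys e (here refl) j∈ | h , _  = h j∈
rows-injective l l′ (x ∷ xs) ys e (there i∈)  j∈ | _ , e′ = rows-injective l l′ xs ys e′ i∈ j∈

encodePoset-injective : ∀ P P′ → encodePoset P ≡ encodePoset P′ → P ≈ᴾ P′
encodePoset-injective record { size = s ; leq = l } record { size = s′ ; leq = l′ } e
  with refl , e′ ← unary-injective s s′ e =
  same λ i j → rows-injective l l′ (allFin s) (allFin s) e′ (∈-allFin i) (∈-allFin j)

embeds-resp : ∀ {Q Q′ P P′} → Q ≈ᴾ Q′ → P ≈ᴾ P′ → Q′ Embeds P′ → Q Embeds P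
embeds-resp (same q) (same p) (e , isMono) = e , record
  { isOrderHomomorphism = record
    { cong = cong e
    ; mono = λ {i} {j} h → subst T (sym (p (e i) (e j))) (mono (subst T (q i j) h)) }
  ; injective = injective
  ; cancel = λ {i} {j} h → subst T (sym (q i j)) (cancel (subst T (p (e i) (e j)) h))
  }
  where open IsOrderMonomorphism isMono hiding (cong)

Embedding⇔Embeds : ∀ Q P {w} → Poset.HasWidth P w →
  Embedding (⟨ encodePoset Q , encodePoset P ⟩ , w + Poset.size Q) ⇔ Q Embeds P
Embedding⇔Embeds Q P {w} hw = mk⇔
  (λ { (Q′ , P′ , _ , e , _ , _ , emb) →
    let eq₁ , eq₂ = ⟨⟩-injective (encodePoset Q) (encodePoset Q′) e in
    embeds-resp (encodePoset-injective Q Q′ eq₁) (encodePoset-injective P P′ eq₂) emb })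
  (λ emb → Q , P , w , refl , hw , refl , emb)

-- The existential diagram of a poset

close : ∀ q → Formula q → Sentence
close zero    φ = φ
close (suc q) φ = close q (exF φ)

close-existential : ∀ q {φ} → Existential φ → Existential (close q φ)
close-existential zero    h = h
close-existential (suc q) h = close-existential q (ex h)

module _ (P : Poset) where
  open Poset P using (Carrier)

  -- Environments are functions; `close-sat` splits one into head and tail and reassembles it, which
  -- preserves it pointwise.
  Extensional : ∀ {q} → Formula q → Set
  Extensional φ = ∀ {ρ ρ′ : Vector Carrier _} → (∀ i → ρ i ≡ ρ′ i) → Satisfies P ρ φ → Satisfies P ρ′ φ

  ∷-ext : ∀ {q} {ρ ρ′ : Vector Carrier q} (a : Carrier) → (∀ i → ρ i ≡ ρ′ i) →
    ∀ i → (a Vector.∷ ρ) i ≡ (a Vector.∷ ρ′) i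
  ∷-ext a h zero    = refl
  ∷-ext a h (suc i) = h i

  close-sat : ∀ q {φ : Formula q} → Extensional φ → P ⊨ close q φ ⇔ (∃[ ρ ] Satisfies P ρ φ)
  close-sat zero    ext = mk⇔ (λ h → _ , h) (λ { (ρ , h) → ext (λ ()) h })
  close-sat (suc q) {φ} ext = mk⇔ to from
    where
    exF-ext : Extensional (exF φ)
    exF-ext h (a , s) = a , ext (∷-ext a h) s
    to : P ⊨ close q (exF φ) → ∃[ ρ ] Satisfies P ρ φ
    to h = let ρ , a , s = Equivalence.to (close-sat q exF-ext) h in (a Vector.∷ ρ) , s
    from : (∃[ ρ ] Satisfies P ρ φ) → P ⊨ close q (exF φ)
    from (ρ , s) = Equivalence.from (close-sat q exF-ext)
      (Vector.tail ρ , Vector.head ρ , ext (λ { zero → refl ; (suc i) → refl }) s)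

module Diagram (Q : Poset) (z : Poset.Carrier Q) where
  open Poset Q using () renaming (size to q; leq to leqQ)

  literal : Fin q × Fin q → Formula q
  literal (i , j) = if leqQ i j then leF i j else notF (leF i j)

  literals : List (Fin q × Fin q) → Formula q
  -- A reflexive atom stands for the empty conjunction; the element `z` is supplied for this.
  literals []       = leF z z
  literals (p ∷ ps) = andF (literal p) (literals ps)

  pairs : List (Fin q × Fin q)
  pairs = cartesianProduct (allFin q) (allFin q)

  diagram : Sentence
  diagram = close q (literals pairs)

  literals-matrix : ∀ ps → Matrix (literals ps)
  literals-matrix []             = pos le
  literals-matrix ((i , j) ∷ ps) with leqQ i j
  ... | true  = conj (pos le) (literals-matrix ps)
  ... | false = conj (neg le) (literals-matrix ps)

  diagram-existential : Existential diagram
  diagram-existential = close-existential q (matrix (literals-matrix pairs))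

  module _ (P : Poset) where
    open Poset P using (Carrier; _≼_; isPartialOrder)

    literals-sat : ∀ {ρ} ps → Satisfies P ρ (literals ps) ⇔ (∀ {p} → p ∈ ps → Satisfies P ρ (literal p))
    literals-sat []       = mk⇔ (λ _ ()) (λ _ → IsPartialOrder.refl isPartialOrder)
    literals-sat (p ∷ ps) = mk⇔
      (λ { (h , hs) (here refl) → h ; (h , hs) (there p∈) → Equivalence.to (literals-sat ps) hs p∈ })
      (λ h → h (here refl) , Equivalence.from (literals-sat ps) (λ p∈ → h (there p∈)))

    literal-sat : ∀ {ρ} i j → Satisfies P ρ (literal (i , j)) ⇔ (T (leqQ i j) ⇔ ρ i ≼ ρ j)
    literal-sat i j with leqQ i j
    ... | true  = mk⇔ (λ h → mk⇔ (λ _ → h) (λ _ → tt)) (λ h → Equivalence.to h tt)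
    ... | false = mk⇔ (λ h → mk⇔ (λ ()) h) (λ h → Equivalence.from h)

    ext : Extensional P (literals pairs)
    ext {ρ} {ρ′} h s = Equivalence.from (literals-sat pairs) λ { {i , j} p∈ →
      Equivalence.from (literal-sat i j) (subst₂ (λ a b → T (leqQ i j) ⇔ a ≼ b) (h i) (h j)
        (Equivalence.to (literal-sat i j) (Equivalence.to (literals-sat pairs) s p∈))) }

    -- The literals fix the order in both directions, and a map that reflects the order is injective
    -- by antisymmetry of `Q`.
    ⊨-diagram : P ⊨ diagram ⇔ Q Embeds P
    ⊨-diagram = mk⇔
      (λ h → let ρ , s = Equivalence.to (close-sat P q ext) h in embedding ρ λ i j →
        Equivalence.to (literal-sat i j) (Equivalence.to (literals-sat pairs) s (∈-cartesianProduct⁺ (∈-allFin i) (∈-allFin j))))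
      (λ (e , isMono) → Equivalence.from (close-sat P q ext) (e , Equivalence.from (literals-sat pairs) λ { {i , j} _ →
        Equivalence.from (literal-sat i j) (mk⇔ (IsOrderMonomorphism.mono isMono) (IsOrderMonomorphism.cancel isMono)) }))
      where
      embedding : ∀ e → (∀ i j → T (leqQ i j) ⇔ e i ≼ e j) → Q Embeds P
      embedding e h = e , record
        { isOrderHomomorphism = record { cong = cong e ; mono = Equivalence.to (h _ _) }
        ; injective = λ {i} {j} e≡ → IsPartialOrder.antisym (Poset.isPartialOrder Q)
            (Equivalence.from (h i j) (subst (e i ≼_) e≡ (IsPartialOrder.refl isPartialOrder)))
            (Equivalence.from (h j i) (subst (_≼ e i) e≡ (IsPartialOrder.refl isPartialOrder)))
        ; cancel = Equivalence.from (h _ _)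
        }

  ModelChecking⇔Embeds : ∀ P (Φ : Sentence → Set) → Φ diagram → ∀ {w} → Poset.HasWidth P w →
    ModelChecking Φ (⟨ encodeFormula diagram , encodePoset P ⟩ , w + ∣ diagram ∣ᶠ) ⇔ Q Embeds P
  ModelChecking⇔Embeds P Φ Φd {w} hw = mk⇔ to
    (λ emb → diagram , P , w , Φd , refl , hw , refl , Equivalence.from (⊨-diagram P) emb)
    where
    to : ModelChecking Φ (⟨ encodeFormula diagram , encodePoset P ⟩ , w + ∣ diagram ∣ᶠ) → Q Embeds P
    to (φ , P′ , _ , _ , e , _ , _ , sat)
      with e₁ , e₂ ← ⟨⟩-injective (encodeFormula diagram) (encodeFormula φ) e
      with refl , _ ← formula-injective diagram φ {[]} {[]} (cong (_++ []) e₁) =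
      embeds-resp (≈ᴾ-refl Q) (encodePoset-injective P P′ e₂) (Equivalence.to (⊨-diagram P′) sat)

  length-variables : ∀ (i j : Fin q) → length (unary (toℕ i) ++ unary (toℕ j)) ≤ q + q
  length-variables i j = subst (_≤ q + q)
    (sym (trans (List.length-++ (unary (toℕ i))) (cong₂ _+_ (length-unary (toℕ i)) (length-unary (toℕ j)))))
    (ℕ.+-mono-≤ (Fin.toℕ<n i) (Fin.toℕ<n j))

  length-literal : ∀ p → length (encodeFormula (literal p)) ≤ 6 + (q + q)
  length-literal (i , j) with leqQ i j
  ... | true  = ℕ.+-monoʳ-≤ 3 (ℕ.≤-trans (length-variables i j) (ℕ.m≤n+m (q + q) 3))
  ... | false = ℕ.+-monoʳ-≤ 6 (length-variables i j)

  length-literals : ∀ ps → length (encodeFormula (literals ps)) ≤ suc (length ps) * (9 + (q + q))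
  length-literals []       = ℕ.+-mono-≤ {3} {9} (s≤s (s≤s (s≤s z≤n)))
    (ℕ.≤-trans (length-variables z z) (ℕ.m≤m+n (q + q) 0))
  length-literals (p ∷ ps) = begin
    3 + length (encodeFormula (literal p) ++ encodeFormula (literals ps))
      ≡⟨ cong (3 +_) (List.length-++ (encodeFormula (literal p))) ⟩
    3 + (length (encodeFormula (literal p)) + length (encodeFormula (literals ps)))
      ≤⟨ ℕ.+-monoʳ-≤ 3 (ℕ.+-mono-≤ (length-literal p) (length-literals ps)) ⟩
    suc (suc (length ps)) * (9 + (q + q)) ∎
    where open ℕ.≤-Reasoning

  length-close : ∀ q (φ : Formula q) → length (encodeFormula {0} (close q φ)) ≡ q * 3 + length (encodeFormula φ)
  length-close zero    φ = refl
  length-close (suc q) φ = trans (length-close q (exF φ)) (lemma (q * 3) (length (encodeFormula φ)))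
    where
    lemma : ∀ a b → a + (3 + b) ≡ 3 + a + b
    lemma = solve-∀

  length-diagram : ∣ diagram ∣ᶠ ≤ q * 3 + suc (q * q) * (9 + (q + q))
  length-diagram = begin
    length (encodeFormula {0} diagram)
      ≡⟨ length-close q (literals pairs) ⟩
    q * 3 + length (encodeFormula (literals pairs))
      ≤⟨ ℕ.+-monoʳ-≤ (q * 3) (length-literals pairs) ⟩
    q * 3 + suc (length pairs) * (9 + (q + q))
      ≡⟨ cong (λ l → q * 3 + suc l * (9 + (q + q))) (trans (length-cartesianProductWith _,_ (allFin q) (allFin q))
           (cong₂ _*_ (List.length-tabulate {n = q} id) (List.length-tabulate {n = q} id))) ⟩
    q * 3 + suc (q * q) * (9 + (q + q)) ∎
    where open ℕ.≤-Reasoning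

-- Disjunctions of instances of an NP language as single instances

fill : ∀ {I : Set} → (I → Bool) → List (Lit I) → Word
fill ρ = map (evalL ρ)

fill-constL : ∀ {I : Set} (ρ : I → Bool) w → fill ρ (map constL w) ≡ w
fill-constL ρ w = trans (sym (List.map-∘ w)) (List.map-id w)

⟨⟩-++ : ∀ u v → ⟨ u , [] ⟩ ++ v ≡ ⟨ u , v ⟩
⟨⟩-++ []      v = refl
⟨⟩-++ (b ∷ u) v = cong (λ w → true ∷ b ∷ w) (⟨⟩-++ u v)

length-concatMap : ∀ {A B : Set} (f : A → List B) {r} xs → (∀ x → length (f x) ≡ r) →
  length (concatMap f xs) ≡ length xs * r
length-concatMap f []       h = refl
length-concatMap f (x ∷ xs) h = trans (List.length-++ (f x)) (cong₂ _+_ (h x) (length-concatMap f xs h))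

module _ {I : Set} (S : Shape I) where
  open Shape S

  posetLits : List (Lit I)
  posetLits = map constL (unary size) ++ concatMap (λ i → map (entry i) (allFin size)) (allFin size)

  fill-rows : ∀ ρ xs ys → fill ρ (concatMap (λ i → map (entry i) ys) xs) ≡
    concatMap (λ i → map (λ j → evalL ρ (entry i j)) ys) xs
  fill-rows ρ []       ys = refl
  fill-rows ρ (x ∷ xs) ys = trans (List.map-++ (evalL ρ) (map (entry x) ys) _)
    (cong₂ _++_ (sym (List.map-∘ ys)) (fill-rows ρ xs ys))

  fill-posetLits : ∀ ρ → fill ρ posetLits ≡
    unary size ++ concatMap (λ i → map (λ j → evalL ρ (entry i j)) (allFin size)) (allFin size)
  fill-posetLits ρ = trans (List.map-++ (evalL ρ) (map constL (unary size)) _)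
    (cong₂ _++_ (fill-constL ρ (unary size)) (fill-rows ρ (allFin size) (allFin size)))

  length-posetLits : length posetLits ≡ suc size + size * size
  length-posetLits = trans (List.length-++ (map constL (unary size)))
    (cong₂ _+_ (trans (List.length-map constL (unary size)) (length-unary size))
      (trans (length-concatMap (λ i → map (entry i) (allFin size)) (allFin size)
                (λ i → trans (List.length-map (entry i) (allFin size)) (List.length-tabulate {n = size} id)))
             (cong (_* size) (List.length-tabulate {n = size} id))))

-- An OR-composition in a special form: the inputs are merely substituted into a list of literals,
-- so that advice can carry the list. The parameter does not see the number `t` of inputs, and the
-- template must be short only for polynomially many of them.
record Composition (Π : ParameterizedProblem) (L : Language) : Set where
  field
    template  : ∀ n t → List (Lit (Fin t × Fin n))
    parameter : ℕ → ℕ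
    correct   : ∀ n t (X : Fin t × Fin n → Bool) →
      Π (fill X (template n t) , parameter n) ⇔ (∃[ c ] L (Vec.toList (Vec.tabulate (λ j → X (c , j)))))
    parameter-polyBounded : PolyBounded parameter
    template-polyBounded  : ∀ {t} → PolyBounded t → PolyBounded (λ n → length (template n (t n)))

evalL-cong : ∀ {I : Set} {ρ ρ′ : I → Bool} → (∀ i → ρ i ≡ ρ′ i) → ∀ l → evalL ρ l ≡ evalL ρ′ l
evalL-cong h (constL b) = refl
evalL-cong h (varL b i) = cong (b xor_) (h i)

⇔-trans : ∀ {A B C : Set} → A ⇔ B → B ⇔ C → A ⇔ C
⇔-trans f g = mk⇔ (λ a → Equivalence.to g (Equivalence.to f a)) (λ c → Equivalence.from f (Equivalence.from g c))

module Compositions {L : Language} (np : InNP L) where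
  open CookLevin np using (csp; csp-correct; #vars>0; #vars-polyBounded; #vals-polyBounded)

  module S (n t : ℕ) = Sums (csp n) (#vars>0 n) t

  -- The pattern is the same for every number of inputs; 0 is an arbitrary choice.
  patternOf : ℕ → Poset
  patternOf n = S.patternPoset n 0

  blockSize : ℕ → ℕ
  blockSize n = Block.size (csp n)

  satisfiable⇔ : ∀ n (ρ : Fin n → Bool) → CSP.Satisfiable (csp n) ρ ⇔ L (Vec.toList (Vec.tabulate ρ))
  satisfiable⇔ n ρ = mk⇔
    (λ (f , p , q) → Equivalence.from (csp-correct n x) (f , p , λ u → trans (evalL-cong lookup≡ (admissible u (f u))) (q u)))
    (λ h → let f , p , q = Equivalence.to (csp-correct n x) h in f , p , λ u → trans (sym (evalL-cong lookup≡ (admissible u (f u)))) (q u))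
    where
    open CSP (csp n) using (admissible)
    x = Vec.tabulate ρ
    lookup≡ : ∀ i → Vec.lookup x i ≡ ρ i
    lookup≡ = Vec.lookup∘tabulate ρ

  module _ (n t : ℕ) (X : Fin t × Fin n → Bool) where
    open S n t using (module Instance)

    posetOf : Poset
    posetOf = Instance.sumPoset X

    posetOf-width : Poset.HasWidth posetOf (blockSize n)
    posetOf-width = Instance.sum-width X

    embeds⇔L : patternOf n Embeds posetOf ⇔ (∃[ c ] L (Vec.toList (Vec.tabulate (λ j → X (c , j)))))
    embeds⇔L = ⇔-trans (Instance.embeds⇔ X)
      (mk⇔ (λ (c , s) → c , Equivalence.to (satisfiable⇔ n _) s) (λ (c , h) → c , Equivalence.from (satisfiable⇔ n _) h))

  height-polyBounded : PolyBounded (λ n → Block.height (csp n))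
  height-polyBounded = pb-suc (pb-suc (pb-+ #vars-polyBounded #vars-polyBounded))

  blockSize-polyBounded : PolyBounded blockSize
  blockSize-polyBounded = pb-+ height-polyBounded (pb-+ pb-VD pb-VD)
    where pb-VD = pb-* #vars-polyBounded #vals-polyBounded

  patternSize-polyBounded : PolyBounded (λ n → Poset.size (patternOf n))
  patternSize-polyBounded = pb-+ height-polyBounded (pb-+ pb-V pb-V)
    where pb-V = pb-* #vars-polyBounded (pb-const 1)

  module _ (Π : ParameterizedProblem) (header : ℕ → Word) (kernelParameter : ℕ → ℕ)
    (header-pb : PolyBounded (length ∘ header)) (parameter-pb : PolyBounded kernelParameter)
    (reduction : ∀ n P → Poset.HasWidth P (blockSize n) →
      Π (⟨ header n , encodePoset P ⟩ , kernelParameter n) ⇔ patternOf n Embeds P) where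

    -- All three problems use the same sum of blocks. They differ in the header, which presents the
    -- pattern either as a poset or as its diagram.
    composition : Composition Π L
    composition = record
      { template  = λ n t → map constL ⟨ header n , [] ⟩ ++ posetLits (S.sumShape n t)
      ; parameter = kernelParameter
      ; correct   = λ n t X → subst (λ w → Π (w , kernelParameter n) ⇔ _) (sym (instance-word n t X))
          (⇔-trans (reduction n (posetOf n t X) (posetOf-width n t X)) (embeds⇔L n t X))
      ; parameter-polyBounded = parameter-pb
      ; template-polyBounded  = λ {t} t-pb → pb-≤ (λ n → ℕ.≤-reflexive (template-length n (t n)))
          (pb-+ (pb-suc (pb-+ (pb-+ header-pb header-pb) (pb-const 0)))
                (pb-+ (pb-suc (sumSize t-pb)) (pb-* (sumSize t-pb) (sumSize t-pb))))
      }
      where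
      instance-word : ∀ n t X → fill X (map constL ⟨ header n , [] ⟩ ++ posetLits (S.sumShape n t)) ≡
        ⟨ header n , encodePoset (posetOf n t X) ⟩
      instance-word n t X = trans (List.map-++ (evalL X) (map constL ⟨ header n , [] ⟩) _)
        (trans (cong₂ _++_ (fill-constL X ⟨ header n , [] ⟩) (fill-posetLits (S.sumShape n t) X))
               (⟨⟩-++ (header n) _))
      sumSize : ∀ {t} → PolyBounded t → PolyBounded (λ n → suc (t n) * blockSize n)
      sumSize t-pb = pb-* (pb-suc t-pb) blockSize-polyBounded
      template-length : ∀ n t → length (map constL ⟨ header n , [] ⟩ ++ posetLits (S.sumShape n t)) ≡
        suc (length (header n) + length (header n) + 0) +
        (suc (suc t * blockSize n) + suc t * blockSize n * (suc t * blockSize n))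
      template-length n t = trans (List.length-++ (map constL ⟨ header n , [] ⟩))
        (cong₂ _+_ (trans (List.length-map constL ⟨ header n , [] ⟩) (length-⟨⟩ (header n) []))
                   (length-posetLits (S.sumShape n t)))

  embedding-composition : Composition Embedding L
  embedding-composition = composition Embedding (λ n → encodePoset (patternOf n))
    (λ n → blockSize n + Poset.size (patternOf n))
    (pb-≤ (λ n → ℕ.≤-reflexive (encode-length n))
      (pb-+ (pb-suc patternSize-polyBounded) (pb-* patternSize-polyBounded patternSize-polyBounded)))
    (pb-+ blockSize-polyBounded patternSize-polyBounded)
    (λ n P hw → Embedding⇔Embeds (patternOf n) P hw)
    where
    encode-length : ∀ n → length (encodePoset (patternOf n)) ≡
      suc (Poset.size (patternOf n)) + Poset.size (patternOf n) * Poset.size (patternOf n)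
    encode-length n = trans (cong length (sym (fill-posetLits (S.patternShape n 0) noBits)))
      (trans (List.length-map (evalL noBits) (posetLits (S.patternShape n 0))) (length-posetLits (S.patternShape n 0)))

  modelChecking-composition : ∀ Φ → (∀ {φ} → Existential φ → Φ φ) → Composition (ModelChecking Φ) L
  modelChecking-composition Φ ∃⊆Φ = composition (ModelChecking Φ) (λ n → encodeFormula (D.diagram n))
    (λ n → blockSize n + ∣ D.diagram n ∣ᶠ) diagram-pb (pb-+ blockSize-polyBounded diagram-pb)
    (λ n P hw → D.ModelChecking⇔Embeds n P Φ (∃⊆Φ (D.diagram-existential n)) hw)
    where
    module D (n : ℕ) = Diagram (patternOf n) zero
    diagram-pb : PolyBounded (λ n → ∣ D.diagram n ∣ᶠ)
    diagram-pb = pb-≤ D.length-diagram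
      (pb-+ (pb-* q (pb-const 3)) (pb-* (pb-suc (pb-* q q)) (pb-+ (pb-const 9) (pb-+ q q))))
      where q = patternSize-polyBounded

-- The machine that executes an advice script and then runs a kernelization

data Source : Set where
  lit fromX fromY : Bool → Source

-- `mark` opens a segment and `sep` closes each of its parts. `fwd` and `bwd` move the heads on the
-- copy of `x` and on the certificate simultaneously. `put` prepends a bit to the word under
-- construction or, in the final comparison, holds a bit of the expected kernel.
data Op : Set where
  mark sep fwd bwd : Op
  put              : Source → Op

-- Every block of four bits decodes to some operation, so the machine fetches in four steps and
-- checks no syntax.
decodeOp : Bool → Bool → Bool → Bool → Op
decodeOp false false false _     = mark
decodeOp false false true  _     = sep
decodeOp false true  false _     = fwd
decodeOp false true  true  _     = bwd
decodeOp true  false b     true  = put (fromX b)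
decodeOp true  false b     false = put (lit b)
decodeOp true  true  b     _     = put (fromY b)

encodeOp : Op → Word
encodeOp mark          = false ∷ false ∷ false ∷ false ∷ []
encodeOp sep           = false ∷ false ∷ true ∷ false ∷ []
encodeOp fwd           = false ∷ true ∷ false ∷ false ∷ []
encodeOp bwd           = false ∷ true ∷ true ∷ false ∷ []
encodeOp (put (fromX b)) = true ∷ false ∷ b ∷ true ∷ []
encodeOp (put (lit b))   = true ∷ false ∷ b ∷ false ∷ []
encodeOp (put (fromY b)) = true ∷ true ∷ b ∷ false ∷ []

encodeOps : List Op → Word
encodeOps []         = []
encodeOps (op ∷ ops) = encodeOp op ++ encodeOps ops

decodeOps : Word → List Op
decodeOps (b₁ ∷ b₂ ∷ b₃ ∷ b₄ ∷ bs) = decodeOp b₁ b₂ b₃ b₄ ∷ decodeOps bs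
decodeOps _                        = []

decode-encodeOps : ∀ ops → decodeOps (encodeOps ops) ≡ ops
decode-encodeOps []                     = refl
decode-encodeOps (mark ∷ ops)           = cong (mark ∷_) (decode-encodeOps ops)
decode-encodeOps (sep ∷ ops)            = cong (sep ∷_) (decode-encodeOps ops)
decode-encodeOps (fwd ∷ ops)            = cong (fwd ∷_) (decode-encodeOps ops)
decode-encodeOps (bwd ∷ ops)            = cong (bwd ∷_) (decode-encodeOps ops)
decode-encodeOps (put (lit b) ∷ ops)    = cong (put (lit b) ∷_) (decode-encodeOps ops)
decode-encodeOps (put (fromX b) ∷ ops)  = cong (put (fromX b) ∷_) (decode-encodeOps ops)
decode-encodeOps (put (fromY b) ∷ ops)  = cong (put (fromY b) ∷_) (decode-encodeOps ops)

length-encodeOps : ∀ ops → length (encodeOps ops) ≡ 4 * length ops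
length-encodeOps []         = refl
length-encodeOps (op ∷ ops) = trans (List.length-++ (encodeOp op))
  (trans (cong₂ _+_ (lemma op) (length-encodeOps ops)) (sym (ℕ.*-suc 4 (length ops))))
  where
  lemma : ∀ op → length (encodeOp op) ≡ 4
  lemma mark            = refl
  lemma sep             = refl
  lemma fwd             = refl
  lemma bwd             = refl
  lemma (put (lit _))   = refl
  lemma (put (fromX _)) = refl
  lemma (put (fromY _)) = refl

unpair : Word → Maybe (Word × Word)
unpair []              = nothing
unpair (false ∷ v)     = just ([] , v)
unpair (true ∷ [])     = nothing
unpair (true ∷ b ∷ w)  = Maybe.map (λ (u , v) → b ∷ u , v) (unpair w)

unpair-⟨⟩ : ∀ u v → unpair ⟨ u , v ⟩ ≡ just (u , v)
unpair-⟨⟩ []      v = refl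
unpair-⟨⟩ (b ∷ u) v rewrite unpair-⟨⟩ u v = refl

module _ {g : ℕ} where

  -- The same as act, but computing without knowledge of the cells before the head.
  move : Move → Symbol g → Tape g → Tape g
  move stay  s (tape ls _ rs)       = tape ls s rs
  move left  s (tape [] _ rs)       = tape [] blank (s ∷ rs)
  move left  s (tape (l ∷ ls) _ rs) = tape ls l (s ∷ rs)
  move right s (tape ls _ [])       = tape (s ∷ ls) blank []
  move right s (tape ls _ (r ∷ rs)) = tape (s ∷ ls) r rs

  act≡move : ∀ t s d → act t (s , d) ≡ move d s t
  act≡move (tape []      _ _)       s left  = refl
  act≡move (tape (_ ∷ _) _ _)       s left  = refl
  act≡move (tape []      _ _)       s stay  = refl
  act≡move (tape (_ ∷ _) _ _)       s stay  = refl
  act≡move (tape []      _ [])      s right = refl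
  act≡move (tape []      _ (_ ∷ _)) s right = refl
  act≡move (tape (_ ∷ _) _ [])      s right = refl
  act≡move (tape (_ ∷ _) _ (_ ∷ _)) s right = refl

  wordTape : List (Symbol g) → Word → Tape g
  wordTape ls []      = tape ls blank []
  wordTape ls (b ∷ w) = tape ls (bit b) (map bit w)

  move-wordTape : ∀ ls b w → move right (bit b) (wordTape ls (b ∷ w)) ≡ wordTape (bit b ∷ ls) w
  move-wordTape ls b []      = refl
  move-wordTape ls b (_ ∷ w) = refl

  inputTape≡wordTape : ∀ w → inputTape w ≡ wordTape [] w
  inputTape≡wordTape []      = refl
  inputTape≡wordTape (b ∷ w) = refl

  -- A tape that is read from right to left.
  backTape : Word → List (Symbol g) → Tape g
  backTape []      rs = tape [] blank rs
  backTape (b ∷ w) rs = tape (map bit w) (bit b) rs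

  move-backTape : ∀ b w rs → move left (bit b) (backTape (b ∷ w) rs) ≡ backTape w (bit b ∷ rs)
  move-backTape b []      rs = refl
  move-backTape b (_ ∷ w) rs = refl

  move-onto-backTape : ∀ w → move left blank (tape (map bit w) blank []) ≡ backTape w (blank ∷ [])
  move-onto-backTape []      = refl
  move-onto-backTape (b ∷ w) = refl

  forward backward : Tape g → Tape g
  forward t  = move right (Tape.head t) t
  backward t = move left (Tape.head t) t

  sourceValue : Source → Tape g → Tape g → Bool
  sourceValue (lit b)   tx ty = b
  sourceValue (fromX b) tx ty = b xor bitOf (Tape.head tx)
  sourceValue (fromY b) tx ty = b xor bitOf (Tape.head ty)

data ParseMode : Set where
  xFlag xBit advice : ParseMode

data Phase : Set where
  seek ticks emit compare : Phase

data Local : Set where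
  flag read : ParseMode → Local
  fetch₀    : Phase → Local
  fetch₁    : Phase → Bool → Local
  fetch₂    : Phase → Bool → Bool → Local
  fetch₃    : Phase → Bool → Bool → Bool → Local
  exec      : Phase → Op → Local
  put₁      : Bool → Local
  put₂      : Local
  answer    : Bool → Local
  clear     : Local
  done      : Local

parseModes : List ParseMode
parseModes = xFlag ∷ xBit ∷ advice ∷ []

∈-parseModes : ∀ m → m ∈ parseModes
∈-parseModes xFlag  = here refl
∈-parseModes xBit   = there (here refl)
∈-parseModes advice = there (there (here refl))

phases : List Phase
phases = seek ∷ ticks ∷ emit ∷ compare ∷ []

∈-phases : ∀ p → p ∈ phases
∈-phases seek    = here refl
∈-phases ticks   = there (here refl)
∈-phases emit    = there (there (here refl))
∈-phases compare = there (there (there (here refl)))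

operations : List Op
operations = mark ∷ sep ∷ fwd ∷ bwd ∷ map (put ∘ lit) bits ++ map (put ∘ fromX) bits ++ map (put ∘ fromY) bits

∈-operations : ∀ op → op ∈ operations
∈-operations mark                = here refl
∈-operations sep                 = there (here refl)
∈-operations fwd                 = there (there (here refl))
∈-operations bwd                 = there (there (there (here refl)))
∈-operations (put (lit b))       = there (there (there (there (∈-++⁺ˡ (∈-map⁺ (put ∘ lit) (∈-bits b))))))
∈-operations (put (fromX b))     = there (there (there (there (∈-++⁺ʳ (map (put ∘ lit) bits) (∈-++⁺ˡ (∈-map⁺ (put ∘ fromX) (∈-bits b)))))))
∈-operations (put (fromY b))     = there (there (there (there (∈-++⁺ʳ (map (put ∘ lit) bits) (∈-++⁺ʳ (map (put ∘ fromX) bits) (∈-map⁺ (put ∘ fromY) (∈-bits b)))))))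

localBlocks : List (List Local)
localBlocks =
    map flag parseModes
  ∷ map read parseModes
  ∷ map fetch₀ phases
  ∷ cartesianProductWith fetch₁ phases bits
  ∷ cartesianProductWith (λ p (b , c) → fetch₂ p b c) phases (cartesianProduct bits bits)
  ∷ cartesianProductWith (λ p (b , c , d) → fetch₃ p b c d) phases (cartesianProduct bits (cartesianProduct bits bits))
  ∷ cartesianProductWith exec phases operations
  ∷ map put₁ bits
  ∷ map answer bits
  ∷ (put₂ ∷ clear ∷ done ∷ [])
  ∷ []

localBlock : ∀ (q : Local) → ∃[ xs ] q ∈ xs × xs ∈ localBlocks
localBlock (flag m)         = _ , ∈-map⁺ flag (∈-parseModes m) , here refl
localBlock (read m)         = _ , ∈-map⁺ read (∈-parseModes m) , there (here refl)
localBlock (fetch₀ p)       = _ , ∈-map⁺ fetch₀ (∈-phases p) , there (there (here refl))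
localBlock (fetch₁ p b)     = _ , ∈-cartesianProductWith⁺ fetch₁ (∈-phases p) (∈-bits b) , there (there (there (here refl)))
localBlock (fetch₂ p b c)   = _ , ∈-cartesianProductWith⁺ (λ p (b , c) → fetch₂ p b c) (∈-phases p)
  (∈-cartesianProduct⁺ (∈-bits b) (∈-bits c)) , there (there (there (there (here refl))))
localBlock (fetch₃ p b c d) = _ , ∈-cartesianProductWith⁺ (λ p (b , c , d) → fetch₃ p b c d) (∈-phases p)
  (∈-cartesianProduct⁺ (∈-bits b) (∈-cartesianProduct⁺ (∈-bits c) (∈-bits d))) , there (there (there (there (there (here refl)))))
localBlock (exec p op)      = _ , ∈-cartesianProductWith⁺ exec (∈-phases p) (∈-operations op) ,
  there (there (there (there (there (there (here refl))))))
localBlock (put₁ b)         = _ , ∈-map⁺ put₁ (∈-bits b) , there (there (there (there (there (there (there (here refl)))))))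
localBlock (answer b)       = _ , ∈-map⁺ answer (∈-bits b) , there (there (there (there (there (there (there (there (here refl))))))))
localBlock put₂             = _ , here refl , there (there (there (there (there (there (there (there (there (here refl)))))))))
localBlock clear            = _ , there (here refl) , there (there (there (there (there (there (there (there (there (here refl)))))))))
localBlock done             = _ , there (there (here refl)) , there (there (there (there (there (there (there (there (there (here refl)))))))))

abstract
  locals : List Local
  locals = concat localBlocks

  ∈-locals : ∀ q → q ∈ locals
  ∈-locals q = let xs , q∈ , xs∈ = localBlock q in ∈-concat⁺′ q∈ xs∈

module ScriptMachine (K : TM) where
  open TM K using () renaming (extraSymbols to g; extraTapes to e; extraStates to s; δ to δᴷ)

  S : Set
  S = Symbol g

  Control : Set
  Control = Local ⊎ Fin (suc s)

  pattern loc q = inj₁ q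
  pattern run q = inj₂ q

  -- An action of nothing leaves a tape alone.
  record Tapes : Set where
    constructor tapes
    field
      inT xT aT kT : Tape g
      restT        : Vec (Tape g) e

  record Actions : Set where
    constructor actions
    field
      inA xA aA kA : Maybe (S × Move)
      restA        : Maybe (Vec (S × Move) e)

  idle : Actions
  idle = actions nothing nothing nothing nothing nothing

  -- Parsing reads a doubly encoded input: `flag` takes the outer flags, and `read` the bits between
  -- them, among which the flags of the inner pair. The instance is built on the tape of `K` from
  -- right to left, already encoded: ticks of the parameter, then `false`, then for each bit of the
  -- word the bit itself (`put₁`) and the `true` that precedes it (`put₂`). The head thus always
  -- rests on the first cell, and `K` can be started at once.
  δ : Control → S → S → S → S → Vec S e → Maybe (Control × Actions)
  δ (loc (flag m)) (bit true) _ _ _ _ = just (loc (read m) , record idle { inA = just (bit true , right) })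
  δ (loc (flag advice)) (bit false) _ _ _ _ =
    just (loc (fetch₀ seek) , record idle { inA = just (bit false , right) ; aA = just (blank , left) })
  δ (loc (flag _)) _ _ _ _ _ = just (loc (answer false) , idle)
  δ (loc (read xFlag)) (bit true) _ _ _ _ = just (loc (flag xBit) , record idle { inA = just (bit true , right) })
  δ (loc (read xFlag)) (bit false) _ _ _ _ = just (loc (flag advice) , record idle { inA = just (bit false , right) })
  δ (loc (read xBit)) (bit b) _ _ _ _ =
    just (loc (flag xFlag) , record idle { inA = just (bit b , right) ; xA = just (bit b , left) })
  δ (loc (read advice)) (bit b) _ _ _ _ =
    just (loc (flag advice) , record idle { inA = just (bit b , right) ; aA = just (bit b , right) })
  δ (loc (read _)) _ _ _ _ _ = just (loc (answer false) , idle)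
  δ (loc (fetch₀ p)) _ _ (bit b) _ _ = just (loc (fetch₁ p b) , record idle { aA = just (bit b , left) })
  δ (loc (fetch₀ p)) _ _ _ _ _ = just (loc (answer false) , idle)
  δ (loc (fetch₁ p b₁)) _ _ (bit b) _ _ = just (loc (fetch₂ p b₁ b) , record idle { aA = just (bit b , left) })
  δ (loc (fetch₁ p _)) _ _ _ _ _ = just (loc (answer false) , idle)
  δ (loc (fetch₂ p b₁ b₂)) _ _ (bit b) _ _ = just (loc (fetch₃ p b₁ b₂ b) , record idle { aA = just (bit b , left) })
  δ (loc (fetch₂ p _ _)) _ _ _ _ _ = just (loc (answer false) , idle)
  δ (loc (fetch₃ p b₁ b₂ b₃)) _ _ (bit b) _ _ =
    just (loc (exec p (decodeOp b₁ b₂ b₃ b)) , record idle { aA = just (bit b , left) })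
  δ (loc (fetch₃ p _ _ _)) _ _ _ _ _ = just (loc (answer false) , idle)
  δ (loc (exec seek mark)) i _ _ _ _ =
    just (loc (fetch₀ (if bitOf i then ticks else seek)) , record idle { inA = just (i , right) })
  δ (loc (exec seek _)) _ _ _ _ _ = just (loc (fetch₀ seek) , idle)
  δ (loc (exec ticks sep)) _ _ _ _ _ = just (loc (fetch₀ emit) , record idle { kA = just (bit false , stay) })
  δ (loc (exec ticks _)) _ _ _ _ _ = just (loc (fetch₀ ticks) , record idle { kA = just (bit true , left) })
  δ (loc (exec emit mark)) _ _ _ _ _ = just (loc (fetch₀ emit) , idle)
  δ (loc (exec emit sep)) _ _ _ _ _ = just (run zero , idle)
  δ (loc (exec emit fwd)) i x _ _ _ =
    just (loc (fetch₀ emit) , record idle { inA = just (i , right) ; xA = just (x , right) })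
  δ (loc (exec emit bwd)) i x _ _ _ =
    just (loc (fetch₀ emit) , record idle { inA = just (i , left) ; xA = just (x , left) })
  δ (loc (exec emit (put (lit b)))) _ _ _ k _ = just (loc (put₁ b) , record idle { kA = just (k , left) })
  δ (loc (exec emit (put (fromX b)))) _ x _ k _ = just (loc (put₁ (b xor bitOf x)) , record idle { kA = just (k , left) })
  δ (loc (exec emit (put (fromY b)))) i _ _ k _ = just (loc (put₁ (b xor bitOf i)) , record idle { kA = just (k , left) })
  δ (loc (exec compare (put (lit b)))) _ _ _ (bit c) _ = just
    ((if ⌊ b 𝔹.≟ c ⌋ then loc (fetch₀ compare) else loc (answer false)) , record idle { kA = just (bit c , right) })
  δ (loc (exec compare sep)) _ _ _ (bit _) _ = just (loc (answer false) , idle)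
  δ (loc (exec compare sep)) _ _ _ _ _ = just (loc (answer true) , idle)
  δ (loc (exec compare _)) _ _ _ _ _ = just (loc (answer false) , idle)
  δ (loc (put₁ b)) _ _ _ _ _ = just (loc put₂ , record idle { kA = just (bit b , left) })
  δ (loc put₂) _ _ _ _ _ = just (loc (fetch₀ emit) , record idle { kA = just (bit true , stay) })
  δ (loc (answer b)) _ _ _ _ _ = just (loc clear , record idle { inA = just (bit b , right) })
  δ (loc clear) _ _ _ _ _ = just (loc done , record idle { inA = just (blank , left) })
  δ (loc done) _ _ _ _ _ = nothing
  δ (run q) _ _ _ k ks with δᴷ q (k ∷ ks)
  ... | nothing            = just (loc (fetch₀ compare) , idle)
  ... | just (q′ , a ∷ as) = just (run q′ , record idle { kA = just a ; restA = just as })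

  perform₁ : Maybe (S × Move) → Tape g → Tape g
  perform₁ nothing        t = t
  perform₁ (just (s , d)) t = move d s t

  performs : Maybe (Vec (S × Move) e) → Vec (Tape g) e → Vec (Tape g) e
  performs nothing   ts = ts
  performs (just as) ts = Vec.zipWith act ts as

  perform : Actions → Tapes → Tapes
  perform (actions i x a k r) (tapes ti tx ta tk tr) =
    tapes (perform₁ i ti) (perform₁ x tx) (perform₁ a ta) (perform₁ k tk) (performs r tr)

  Configuration : Set
  Configuration = Control × Tapes

  δ-heads : Control → Tapes → Maybe (Control × Actions)
  δ-heads q (tapes ti tx ta tk tr) =
    δ q (Tape.head ti) (Tape.head tx) (Tape.head ta) (Tape.head tk) (Vec.map Tape.head tr)

  _⟶_ : Configuration → Configuration → Set
  (q , ts) ⟶ (q′ , ts′) = ∃[ as ] δ-heads q ts ≡ just (q′ , as) × perform as ts ≡ ts′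

  data Steps : ℕ → Configuration → Configuration → Set where
    none : ∀ {c} → Steps 0 c c
    _▹_  : ∀ {n c c′ d} → c ⟶ c′ → Steps n c′ d → Steps (suc n) c d

  Reach : ℕ → Configuration → Configuration → Set
  Reach n c d = ∃[ t ] t ≤ n × Steps t c d

  reach-refl : ∀ {c} → Reach 0 c c
  reach-refl = 0 , z≤n , none

  infixr 5 _▸_
  _▸_ : ∀ {n c c′ d} → c ⟶ c′ → Reach n c′ d → Reach (suc n) c d
  st ▸ (t , t≤n , steps) = suc t , s≤s t≤n , st ▹ steps

  Steps-++ : ∀ {m n c d f} → Steps m c d → Steps n d f → Steps (m + n) c f
  Steps-++ none      ts = ts
  Steps-++ (s ▹ ss) ts = s ▹ Steps-++ ss ts

  reach-trans : ∀ {m n c d f} → Reach m c d → Reach n d f → Reach (m + n) c f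
  reach-trans (t , t≤m , ss) (u , u≤n , ts) = t + u , ℕ.+-mono-≤ t≤m u≤n , Steps-++ ss ts

  reach-≤ : ∀ {m n c d} → m ≤ n → Reach m c d → Reach n c d
  reach-≤ m≤n (t , t≤m , ss) = t , ℕ.≤-trans t≤m m≤n , ss

  -- Realization as a Turing machine

  startControl : Control
  startControl = loc (flag xFlag)

  otherControls : List Control
  otherControls = map inj₁ locals ++ map inj₂ (allFin (suc s))

  -- `startControl` stands in front because runs begin in state `zero`. It occurs again further on,
  -- where `code` finds it; steps depend only on the entry that is looked up, not on its index.
  controls : List Control
  controls = startControl ∷ otherControls

  ∈-controls : ∀ q → q ∈ controls
  ∈-controls (loc q) = there (∈-++⁺ˡ (∈-map⁺ inj₁ (∈-locals q)))
  ∈-controls (run q) = there (∈-++⁺ʳ (map inj₁ locals) (∈-map⁺ inj₂ (∈-allFin q)))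

  code : Control → Fin (length controls)
  code q = Any.index (∈-controls q)

  lookup-code : ∀ q → List.lookup controls (code q) ≡ q
  lookup-code q = sym (Any.lookup-index (∈-controls q))

  allActions : Actions → S → S → S → S → Vec S e → Vec (S × Move) (4 + e)
  allActions (actions ai ax aa ak (just ar)) i x a k r =
    Maybe.fromMaybe (i , stay) ai ∷ Maybe.fromMaybe (x , stay) ax ∷ Maybe.fromMaybe (a , stay) aa ∷ Maybe.fromMaybe (k , stay) ak ∷ ar
  allActions (actions ai ax aa ak nothing) i x a k r =
    Maybe.fromMaybe (i , stay) ai ∷ Maybe.fromMaybe (x , stay) ax ∷ Maybe.fromMaybe (a , stay) aa ∷ Maybe.fromMaybe (k , stay) ak ∷ Vec.map (_, stay) r

  machine : TM
  machine = record
    { extraStates = length otherControls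
    ; extraTapes = 3 + e
    ; extraSymbols = g
    ; δ = λ { q (i ∷ x ∷ a ∷ k ∷ r) →
        Maybe.map (λ (q′ , as) → code q′ , allActions as i x a k r) (δ (List.lookup controls q) i x a k r) }
    }

  toVec : Tapes → Vec (Tape g) (4 + e)
  toVec (tapes ti tx ta tk tr) = ti ∷ tx ∷ ta ∷ tk ∷ tr

  act-perform₁ : ∀ a t → act t (Maybe.fromMaybe (Tape.head t , stay) a) ≡ perform₁ a t
  act-perform₁ nothing        t = act-stay t
  act-perform₁ (just (s , d)) t = act≡move t s d

  act-perform : ∀ as ts → let open Tapes ts in
    Vec.zipWith act (toVec ts) (allActions as (Tape.head inT) (Tape.head xT) (Tape.head aT) (Tape.head kT) (Vec.map Tape.head restT))
      ≡ toVec (perform as ts)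
  act-perform (actions ai ax aa ak (just ar)) (tapes ti tx ta tk tr)
    rewrite act-perform₁ ai ti | act-perform₁ ax tx | act-perform₁ aa ta | act-perform₁ ak tk = refl
  act-perform (actions ai ax aa ak nothing) (tapes ti tx ta tk tr)
    rewrite act-perform₁ ai ti | act-perform₁ ax tx | act-perform₁ aa ta | act-perform₁ ak tk =
    cong (λ ts → perform₁ ai ti ∷ perform₁ ax tx ∷ perform₁ aa ta ∷ perform₁ ak tk ∷ ts) (Run.act-stays K tr)

  machine-step : ∀ {q ts q′ ts′} i → List.lookup controls i ≡ q → (q , ts) ⟶ (q′ , ts′) →
    step machine (i , toVec ts) ≡ just (code q′ , toVec ts′)
  machine-step {ts = ts} i refl (as , e≡ , refl) rewrite e≡ = cong (λ v → just (_ , v)) (act-perform as ts)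

  machine-halts : ∀ {t q ts ts′} → Steps t (q , ts) (loc done , ts′) → ∀ i → List.lookup controls i ≡ q →
    ∃[ d ] HaltsIn machine t (i , toVec ts) d × proj₂ d ≡ toVec ts′
  machine-halts {ts = ts} none i i≡ = _ , halt halted , refl
    where
    halted : step machine (i , toVec ts) ≡ nothing
    halted rewrite i≡ = refl
  machine-halts (st ▹ ss) i i≡ =
    let d , h , e≡ = machine-halts ss _ (lookup-code _) in d , next (machine-step i i≡ st) h , e≡

-- Unfolds to two successors for each bit consumed, so the time bounds compute along the advice.
double : ℕ → ℕ
double zero    = zero
double (suc n) = suc (suc (double n))

double≡+ : ∀ n → double n ≡ n + n
double≡+ zero    = refl
double≡+ (suc n) = cong suc (trans (cong suc (double≡+ n)) (sym (ℕ.+-suc n n)))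

unpair-length : ∀ w {u v} → unpair w ≡ just (u , v) → length v ≤ length w
unpair-length (false ∷ w) refl = ℕ.n≤1+n _
unpair-length (true ∷ b ∷ w) e with unpair w in e′
unpair-length (true ∷ b ∷ w) refl | just _ = ℕ.m≤n⇒m≤1+n (ℕ.m≤n⇒m≤1+n (unpair-length w e′))

-- Scripts as functions on tapes

compareV : List Op → Word → Bool
compareV (put (lit b) ∷ ops) (c ∷ w) = if ⌊ b 𝔹.≟ c ⌋ then compareV ops w else false
compareV (sep ∷ _)           []      = true
compareV _                   _       = false

module Script {g : ℕ} (kernel : Word × ℕ → Word × ℕ) where

  emitV : List Op → Tape g → Tape g → ℕ → Word → Bool
  emitV []           tx ty k w = false
  emitV (mark ∷ ops) tx ty k w = emitV ops tx ty k w
  emitV (sep ∷ ops)  tx ty k w = compareV ops (encodeInstance (kernel (w , k)))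
  emitV (fwd ∷ ops)  tx ty k w = emitV ops (forward tx) (forward ty) k w
  emitV (bwd ∷ ops)  tx ty k w = emitV ops (backward tx) (backward ty) k w
  emitV (put s ∷ ops) tx ty k w = emitV ops tx ty k (sourceValue s tx ty ∷ w)

  ticksV : List Op → Tape g → Tape g → ℕ → Bool
  ticksV []          tx ty k = false
  ticksV (sep ∷ ops) tx ty k = emitV ops tx ty k []
  ticksV (_ ∷ ops)   tx ty k = ticksV ops tx ty (suc k)

  seekV : List Op → Tape g → Tape g → Bool
  seekV []           tx ty = false
  seekV (mark ∷ ops) tx ty = if bitOf (Tape.head ty) then ticksV ops tx (forward ty) 0 else seekV ops tx (forward ty)
  seekV (_ ∷ ops)    tx ty = seekV ops tx ty

  verifyV : Word × Word → Bool
  verifyV (u , v) with unpair u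
  ... | nothing          = false
  -- Parsing copies `x` leftwards and the advice is read back from its end, so both appear reversed.
  -- To the left of the certificate lies the input that has been read.
  ... | just (x , a) = seekV (decodeOps (reverse a)) (tape [] blank (map bit (reverse x)))
                             (wordTape (map bit (reverse ⟨ u , [] ⟩)) v)

  verifyV-⟨⟩ : ∀ x a v → verifyV (⟨ x , a ⟩ , v) ≡
    seekV (decodeOps (reverse a)) (tape [] blank (map bit (reverse x)))
          (wordTape (map bit (reverse ⟨ ⟨ x , a ⟩ , [] ⟩)) v)
  verifyV-⟨⟩ x a v rewrite unpair-⟨⟩ x a = refl

-- Correctness and running time of the script machine

module Behaviour (K : TM) (kernel : Word × ℕ → Word × ℕ) (p : Polynomial)
  (kernel-runs : ∀ a → OutputsWithin K (⟦ p ⟧ (length (encodeInstance a))) (encodeInstance a) (encodeInstance (kernel a))) where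
  open ScriptMachine K
  open TM K using () renaming (extraSymbols to g; extraTapes to e; δ to δᴷ)
  open Script {g} kernel

  Answers : ℕ → Configuration → Bool → Set
  Answers n c b = ∃[ ts ] Reach n c (loc (answer b) , ts)

  answers-≤ : ∀ {m n c b} → m ≤ n → Answers m c b → Answers n c b
  answers-≤ m≤n (ts , r) = ts , reach-≤ m≤n r

  infixr 5 _▸ᴬ_
  _▸ᴬ_ : ∀ {n c c′ b} → c ⟶ c′ → Answers n c′ b → Answers (suc n) c b
  st ▸ᴬ (ts , r) = ts , st ▸ r

  reach-answers : ∀ {m n c d b} → Reach m c d → Answers n d b → Answers (m + n) c b
  reach-answers r (ts , r′) = ts , reach-trans r r′

  answered : ∀ {b ts} → Answers 0 (loc (answer b) , ts) b
  answered = _ , reach-refl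

  module _ {ti tx : Tape g} {tk : Tape g} {tr : Vec (Tape g) e} where

    with-advice : Word → List (Symbol g) → Tapes
    with-advice bs rs = tapes ti tx (backTape bs rs) tk tr

    fetch : ∀ ph b₁ b₂ b₃ b₄ bs rs →
      Reach 4 (loc (fetch₀ ph) , with-advice (b₁ ∷ b₂ ∷ b₃ ∷ b₄ ∷ bs) rs)
              (loc (exec ph (decodeOp b₁ b₂ b₃ b₄)) , with-advice bs (bit b₄ ∷ bit b₃ ∷ bit b₂ ∷ bit b₁ ∷ rs))
    fetch ph b₁ b₂ b₃ b₄ bs rs =
      (_ , refl , refl) ▸ (_ , refl , refl) ▸ (_ , refl , refl) ▸
      (_ , refl , cong (λ t → tapes ti tx t tk tr) (move-backTape b₄ bs _)) ▸ reach-refl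

    fetch-fails : ∀ ph bs rs → length bs < 4 → Answers 4 (loc (fetch₀ ph) , with-advice bs rs) false
    fetch-fails ph [] rs _ = answers-≤ (s≤s z≤n) ((_ , refl , refl) ▸ᴬ answered)
    fetch-fails ph (b₁ ∷ []) rs _ = answers-≤ (s≤s (s≤s z≤n)) ((_ , refl , refl) ▸ᴬ (_ , refl , refl) ▸ᴬ answered)
    fetch-fails ph (b₁ ∷ b₂ ∷ []) rs _ = answers-≤ (s≤s (s≤s (s≤s z≤n)))
      ((_ , refl , refl) ▸ᴬ (_ , refl , refl) ▸ᴬ (_ , refl , refl) ▸ᴬ answered)
    fetch-fails ph (b₁ ∷ b₂ ∷ b₃ ∷ []) rs _ =
      (_ , refl , refl) ▸ᴬ (_ , refl , refl) ▸ᴬ (_ , refl , refl) ▸ᴬ (_ , refl , refl) ▸ᴬ answered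
    fetch-fails ph (_ ∷ _ ∷ _ ∷ _ ∷ _) rs (s≤s (s≤s (s≤s (s≤s ()))))

  outputWord-right : ∀ ls s rs → outputWord {g} (move right s (tape ls s rs)) ≡ leadingBits rs
  outputWord-right ls s []      = refl
  outputWord-right ls s (_ ∷ _) = refl

  compare-correct : ∀ bs {ti tx rs tk tr} →
    Answers (double (length bs) + 5) (loc (fetch₀ compare) , tapes ti tx (backTape bs rs) tk tr)
            (compareV (decodeOps bs) (outputWord tk))

  compare-exec : ∀ op bs {ti tx rs tk tr} →
    Answers (suc (double (length bs) + 5)) (loc (exec compare op) , tapes ti tx (backTape bs rs) tk tr)
            (compareV (op ∷ decodeOps bs) (outputWord tk))
  compare-exec mark bs            = answers-≤ (s≤s z≤n) ((_ , refl , refl) ▸ᴬ answered)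
  compare-exec fwd bs             = answers-≤ (s≤s z≤n) ((_ , refl , refl) ▸ᴬ answered)
  compare-exec bwd bs             = answers-≤ (s≤s z≤n) ((_ , refl , refl) ▸ᴬ answered)
  compare-exec (put (fromX _)) bs = answers-≤ (s≤s z≤n) ((_ , refl , refl) ▸ᴬ answered)
  compare-exec (put (fromY _)) bs = answers-≤ (s≤s z≤n) ((_ , refl , refl) ▸ᴬ answered)
  compare-exec sep bs {tk = tape _ blank _}     = answers-≤ (s≤s z≤n) ((_ , refl , refl) ▸ᴬ answered)
  compare-exec sep bs {tk = tape _ (bit _) _}   = answers-≤ (s≤s z≤n) ((_ , refl , refl) ▸ᴬ answered)
  compare-exec sep bs {tk = tape _ (extra _) _} = answers-≤ (s≤s z≤n) ((_ , refl , refl) ▸ᴬ answered)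
  compare-exec (put (lit b)) bs {tk = tape _ blank _}     = answers-≤ (s≤s z≤n) ((_ , refl , refl) ▸ᴬ answered)
  compare-exec (put (lit b)) bs {tk = tape _ (extra _) _} = answers-≤ (s≤s z≤n) ((_ , refl , refl) ▸ᴬ answered)
  compare-exec (put (lit b)) bs {ti} {tx} {rs} {tape ls (bit c) ks} {tr} with b 𝔹.≟ c in e≡
  ... | yes _ = (_ , cong (λ d → just ((if ⌊ d ⌋ then loc (fetch₀ compare) else loc (answer false)) , _)) e≡ , refl) ▸ᴬ
    subst (λ w → Answers (double (length bs) + 5)
                   (loc (fetch₀ compare) , tapes ti tx (backTape bs rs) (move right (bit c) (tape ls (bit c) ks)) tr)
                   (compareV (decodeOps bs) w))
          (outputWord-right ls (bit c) ks) (compare-correct bs)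
  ... | no _  = answers-≤ (s≤s z≤n)
    ((_ , cong (λ d → just ((if ⌊ d ⌋ then loc (fetch₀ compare) else loc (answer false)) , _)) e≡ , refl) ▸ᴬ answered)

  stuck : ∀ ph bs {m ti tx rs tk tr} → length bs < 4 →
    Answers (double (length bs) + (5 + m)) (loc (fetch₀ ph) , tapes ti tx (backTape bs rs) tk tr) false
  stuck ph bs l = answers-≤ (ℕ.≤-trans (s≤s (s≤s (s≤s (s≤s z≤n)))) (ℕ.m≤n+m _ (double (length bs)))) (fetch-fails ph bs _ l)

  compare-correct []                = stuck compare [] (s≤s z≤n)
  compare-correct bs@(_ ∷ [])         = stuck compare bs (s≤s (s≤s z≤n))
  compare-correct bs@(_ ∷ _ ∷ [])     = stuck compare bs (s≤s (s≤s (s≤s z≤n)))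
  compare-correct bs@(_ ∷ _ ∷ _ ∷ []) = stuck compare bs (s≤s (s≤s (s≤s (s≤s z≤n))))
  compare-correct (b₁ ∷ b₂ ∷ b₃ ∷ b₄ ∷ bs) =
    answers-≤ (ℕ.m≤n+m _ 3) (reach-answers (fetch compare b₁ b₂ b₃ b₄ bs _) (compare-exec (decodeOp b₁ b₂ b₃ b₄) bs))

  kernel-step : ∀ {q tk tr q′ tk′ tr′ ti tx ta} → step K (q , tk ∷ tr) ≡ just (q′ , tk′ ∷ tr′) →
    (run q , tapes ti tx ta tk tr) ⟶ (run q′ , tapes ti tx ta tk′ tr′)
  kernel-step {q} {tk} {tr} e≡ with δᴷ q (Tape.head tk ∷ Vec.map Tape.head tr)
  kernel-step {q} {tk} {tr} refl | just (q′ , (s , d) ∷ as) =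
    _ , refl , cong (λ t → tapes _ _ _ t _) (sym (act≡move tk s d))

  kernel-halt : ∀ {q tk tr ti tx ta} → step K (q , tk ∷ tr) ≡ nothing →
    (run q , tapes ti tx ta tk tr) ⟶ (loc (fetch₀ compare) , tapes ti tx ta tk tr)
  kernel-halt {q} {tk} {tr} e≡ with δᴷ q (Tape.head tk ∷ Vec.map Tape.head tr)
  ... | nothing = _ , refl , refl

  kernel-runs-on : ∀ {t q tk tr d ti tx ta} → HaltsIn K t (q , tk ∷ tr) d →
    Reach (suc t) (run q , tapes ti tx ta tk tr)
      (loc (fetch₀ compare) , tapes ti tx ta (Vec.head (proj₂ d)) (Vec.tail (proj₂ d)))
  kernel-runs-on (halt e≡) = kernel-halt e≡ ▸ reach-refl
  kernel-runs-on (next {c′ = q′ , tk′ ∷ tr′} e≡ h) = kernel-step e≡ ▸ kernel-runs-on h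

  length-encodeInstance : ∀ w k → length (encodeInstance (w , k)) ≡ suc (length w + length w + k)
  length-encodeInstance w k = trans (length-⟨⟩ w (replicate k true)) (cong (λ l → suc (length w + length w + l)) (List.length-replicate k))

  rewind : ∀ w v → move left (Tape.head (inputTape {g} ⟨ w , v ⟩)) (inputTape ⟨ w , v ⟩) ≡ tape [] blank (map bit ⟨ w , v ⟩)
  rewind []      v = refl
  rewind (_ ∷ w) v = refl

  blanks : Vec (Tape g) e
  blanks = Vec.replicate e emptyTape

  module Bounded (Z : ℕ) where

    E : ℕ
    E = ⟦ p ⟧ Z

    -- Two units per advice bit make eight per operation; they pay for four fetching steps and at
    -- most three steps of execution (a `put`). The run of `K` is paid by `E`, a truncated last
    -- operation by the constant 5.
    time : Word → ℕ
    time bs = double (length bs) + (5 + E)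

    kernel-correct : ∀ w k bs {ti tx rs} → suc (length w + length w + k) ≤ Z →
      Answers (suc E + (double (length bs) + 5))
        (run zero , tapes ti tx (backTape bs rs) (inputTape (encodeInstance (w , k))) blanks)
        (compareV (decodeOps bs) (encodeInstance (kernel (w , k))))
    kernel-correct w k bs {ti} {tx} {rs} size with kernel-runs (w , k)
    ... | t , (q , tk ∷ tr) , t≤ , halts , out = reach-answers
      (reach-≤ (s≤s (ℕ.≤-trans t≤ (Polynomial-mono p (subst (_≤ Z) (sym (length-encodeInstance w k)) size))))
        (kernel-runs-on halts))
      (subst (λ o → Answers (double (length bs) + 5) (loc (fetch₀ compare) , tapes ti tx (backTape bs rs) tk tr)
                      (compareV (decodeOps bs) o)) out (compare-correct bs))

    drop-two : ∀ (w : Word) k (bs : Word) → suc (length w + length w + k) + (2 + length bs) ≤ Z → suc (length w + length w + k) + length bs ≤ Z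
    drop-two w k bs = ℕ.≤-trans (ℕ.+-monoʳ-≤ (suc (length w + length w + k)) (ℕ.m≤n+m (length bs) 2))

    -- The length of the encoded instance plus the remaining advice never exceeds `Z`, because an
    -- operation consumes four advice bits and lengthens the instance by at most two cells. Hence
    -- `K` runs on an input of length at most `Z`.
    emit-correct : ∀ bs w k {ti tx rs} → suc (length w + length w + k) + length bs ≤ Z →
      Answers (time bs)
        (loc (fetch₀ emit) , tapes ti tx (backTape bs rs) (inputTape (encodeInstance (w , k))) blanks)
        (emitV (decodeOps bs) tx ti k w)

    emit-exec : ∀ op bs w k {ti tx rs} → suc (length w + length w + k) + (2 + length bs) ≤ Z →
      Answers (3 + time bs)
        (loc (exec emit op) , tapes ti tx (backTape bs rs) (inputTape (encodeInstance (w , k))) blanks)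
        (emitV (op ∷ decodeOps bs) tx ti k w)
    emit-exec mark bs w k size = answers-≤ (ℕ.m≤n+m _ 2) ((_ , refl , refl) ▸ᴬ emit-correct bs w k (drop-two w k bs size))
    emit-exec fwd bs w k size = answers-≤ (ℕ.m≤n+m _ 2) ((_ , refl , refl) ▸ᴬ emit-correct bs w k (drop-two w k bs size))
    emit-exec bwd bs w k size = answers-≤ (ℕ.m≤n+m _ 2) ((_ , refl , refl) ▸ᴬ emit-correct bs w k (drop-two w k bs size))
    emit-exec sep bs w k size = answers-≤ (arithmetic (double (length bs)) E)
      ((_ , refl , refl) ▸ᴬ kernel-correct w k bs (ℕ.m+n≤o⇒m≤o _ size))
      where
      arithmetic : ∀ n E → suc (suc E + (n + 5)) ≤ 3 + (n + (5 + E))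
      arithmetic n E = ℕ.≤-trans (ℕ.≤-reflexive (lemma n E)) (ℕ.n≤1+n _)
        where
        lemma : ∀ n E → suc (suc E + (n + 5)) ≡ 2 + (n + (5 + E))
        lemma = solve-∀
    emit-exec (put s) bs w k {ti} {tx} {rs} size =
      (_ , put-δ s , cong (λ t → tapes ti tx (backTape bs rs) t blanks) (rewind w (replicate k true))) ▸ᴬ
      (_ , refl , refl) ▸ᴬ (_ , refl , refl) ▸ᴬ emit-correct bs (sourceValue s tx ti ∷ w) k
        (subst (_≤ Z) (arithmetic (length w) k (length bs)) size)
      where
      put-δ : ∀ s → δ-heads (loc (exec emit (put s))) (tapes ti tx (backTape bs rs) (inputTape (encodeInstance (w , k))) blanks) ≡
        just (loc (put₁ (sourceValue s tx ti)) , record idle { kA = just (Tape.head (inputTape {g} (encodeInstance (w , k))) , left) })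
      put-δ (lit b)   = refl
      put-δ (fromX b) = refl
      put-δ (fromY b) = refl
      arithmetic : ∀ a k n → suc (a + a + k) + (2 + n) ≡ suc (suc a + suc a + k) + n
      arithmetic = solve-∀

    emit-correct []                 w k _ = stuck emit [] (s≤s z≤n)
    emit-correct bs@(_ ∷ [])         w k _ = stuck emit bs (s≤s (s≤s z≤n))
    emit-correct bs@(_ ∷ _ ∷ [])     w k _ = stuck emit bs (s≤s (s≤s (s≤s z≤n)))
    emit-correct bs@(_ ∷ _ ∷ _ ∷ []) w k _ = stuck emit bs (s≤s (s≤s (s≤s (s≤s z≤n))))
    emit-correct (b₁ ∷ b₂ ∷ b₃ ∷ b₄ ∷ bs) w k size =
      answers-≤ (ℕ.m≤n+m _ 1) (reach-answers (fetch emit b₁ b₂ b₃ b₄ bs _)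
        (emit-exec (decodeOp b₁ b₂ b₃ b₄) bs w k
          (ℕ.≤-trans (ℕ.+-monoʳ-≤ (suc (length w + length w + k)) (ℕ.m≤n+m (2 + length bs) 2)) size)))

    ticks-correct : ∀ bs k {ti tx rs} → suc k + length bs ≤ Z →
      Answers (time bs)
        (loc (fetch₀ ticks) , tapes ti tx (backTape bs rs) (tape [] blank (map bit (replicate k true))) blanks)
        (ticksV (decodeOps bs) tx ti k)

    ticks-exec : ∀ op bs k {ti tx rs} → suc k + (2 + length bs) ≤ Z →
      Answers (suc (time bs))
        (loc (exec ticks op) , tapes ti tx (backTape bs rs) (tape [] blank (map bit (replicate k true))) blanks)
        (ticksV (op ∷ decodeOps bs) tx ti k)
    ticks-exec op bs k size = by-op op
      where
      smaller : suc (suc k) + length bs ≤ Z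
      smaller = ℕ.≤-trans (ℕ.≤-trans (ℕ.≤-reflexive (sym (ℕ.+-suc (suc k) (length bs)))) (ℕ.+-monoʳ-≤ (suc k) (ℕ.n≤1+n _))) size
      by-op : ∀ op {ti tx rs} → Answers (suc (time bs))
        (loc (exec ticks op) , tapes ti tx (backTape bs rs) (tape [] blank (map bit (replicate k true))) blanks)
        (ticksV (op ∷ decodeOps bs) tx ti k)
      by-op sep     = (_ , refl , refl) ▸ᴬ emit-correct bs [] k (ℕ.≤-trans (ℕ.n≤1+n _) smaller)
      by-op mark    = (_ , refl , refl) ▸ᴬ ticks-correct bs (suc k) smaller
      by-op fwd     = (_ , refl , refl) ▸ᴬ ticks-correct bs (suc k) smaller
      by-op bwd     = (_ , refl , refl) ▸ᴬ ticks-correct bs (suc k) smaller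
      by-op (put _) = (_ , refl , refl) ▸ᴬ ticks-correct bs (suc k) smaller

    ticks-correct []                 k _ = stuck ticks [] (s≤s z≤n)
    ticks-correct bs@(_ ∷ [])         k _ = stuck ticks bs (s≤s (s≤s z≤n))
    ticks-correct bs@(_ ∷ _ ∷ [])     k _ = stuck ticks bs (s≤s (s≤s (s≤s z≤n)))
    ticks-correct bs@(_ ∷ _ ∷ _ ∷ []) k _ = stuck ticks bs (s≤s (s≤s (s≤s (s≤s z≤n))))
    ticks-correct (b₁ ∷ b₂ ∷ b₃ ∷ b₄ ∷ bs) k size =
      answers-≤ (ℕ.m≤n+m _ 3) (reach-answers (fetch ticks b₁ b₂ b₃ b₄ bs _)
        (ticks-exec (decodeOp b₁ b₂ b₃ b₄) bs k
          (ℕ.≤-trans (ℕ.+-monoʳ-≤ (suc k) (ℕ.m≤n+m (2 + length bs) 2)) size)))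

    seek-correct : ∀ bs {ti tx rs} → suc (length bs) ≤ Z →
      Answers (time bs) (loc (fetch₀ seek) , tapes ti tx (backTape bs rs) emptyTape blanks) (seekV (decodeOps bs) tx ti)

    seek-exec : ∀ op bs {ti tx rs} → suc (length bs) ≤ Z →
      Answers (suc (time bs)) (loc (exec seek op) , tapes ti tx (backTape bs rs) emptyTape blanks)
              (seekV (op ∷ decodeOps bs) tx ti)
    seek-exec sep bs size     = (_ , refl , refl) ▸ᴬ seek-correct bs size
    seek-exec fwd bs size     = (_ , refl , refl) ▸ᴬ seek-correct bs size
    seek-exec bwd bs size     = (_ , refl , refl) ▸ᴬ seek-correct bs size
    seek-exec (put _) bs size = (_ , refl , refl) ▸ᴬ seek-correct bs size
    seek-exec mark bs {ti} {tx} {rs} size = (_ , refl , refl) ▸ᴬ branch (bitOf (Tape.head ti))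
      where
      branch : ∀ b → Answers (time bs)
        (loc (fetch₀ (if b then ticks else seek)) , tapes (forward ti) tx (backTape bs rs) emptyTape blanks)
        (if b then ticksV (decodeOps bs) tx (forward ti) 0 else seekV (decodeOps bs) tx (forward ti))
      branch true  = ticks-correct bs 0 size
      branch false = seek-correct bs size

    seek-correct []                 _ = stuck seek [] (s≤s z≤n)
    seek-correct bs@(_ ∷ [])         _ = stuck seek bs (s≤s (s≤s z≤n))
    seek-correct bs@(_ ∷ _ ∷ [])     _ = stuck seek bs (s≤s (s≤s (s≤s z≤n)))
    seek-correct bs@(_ ∷ _ ∷ _ ∷ []) _ = stuck seek bs (s≤s (s≤s (s≤s (s≤s z≤n))))
    seek-correct (b₁ ∷ b₂ ∷ b₃ ∷ b₄ ∷ bs) size =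
      answers-≤ (ℕ.m≤n+m _ 3) (reach-answers (fetch seek b₁ b₂ b₃ b₄ bs _)
        (seek-exec (decodeOp b₁ b₂ b₃ b₄) bs (ℕ.≤-trans (ℕ.m≤n+m (suc (length bs)) 4) size)))

  parse-advice : ∀ a ls as v {tx tk tr} →
    Reach (suc (double (length a)))
      (loc (flag advice) , tapes (wordTape (map bit ls) ⟨ a , v ⟩) tx (tape (map bit as) blank []) tk tr)
      (loc (fetch₀ seek) , tapes (wordTape (map bit (⟨ a , [] ⟩ ʳ++ ls)) v) tx (backTape (a ʳ++ as) (blank ∷ [])) tk tr)
  parse-advice [] ls as v =
    (_ , refl , cong₂ (λ t u → tapes t _ u _ _) (move-wordTape (map bit ls) false v) (move-onto-backTape as)) ▸ reach-refl
  parse-advice (b ∷ a) ls as v =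
    (_ , refl , refl) ▸
    (_ , refl , cong (λ t → tapes t _ _ _ _) (move-wordTape (map bit (true ∷ ls)) b ⟨ a , v ⟩)) ▸
    parse-advice a (b ∷ true ∷ ls) (b ∷ as) v

  parse : ∀ u ls xs v {tk tr} →
    (∀ {x a} → unpair u ≡ just (x , a) → Reach (suc (double (length u)))
      (loc (flag xFlag) , tapes (wordTape (map bit ls) ⟨ u , v ⟩) (tape [] blank (map bit xs)) emptyTape tk tr)
      (loc (fetch₀ seek) , tapes (wordTape (map bit (⟨ u , [] ⟩ ʳ++ ls)) v) (tape [] blank (map bit (x ʳ++ xs)))
                                 (backTape (reverse a) (blank ∷ [])) tk tr)) ×
    (unpair u ≡ nothing → Answers (suc (double (length u)))
      (loc (flag xFlag) , tapes (wordTape (map bit ls) ⟨ u , v ⟩) (tape [] blank (map bit xs)) emptyTape tk tr) false)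
  parse [] ls xs v = (λ ()) , λ _ → (_ , refl , refl) ▸ᴬ answered
  parse (false ∷ a) ls xs v = (λ { refl →
    (_ , refl , refl) ▸
    (_ , refl , cong (λ t → tapes t _ _ _ _) (move-wordTape (map bit (true ∷ ls)) false ⟨ a , v ⟩)) ▸
    parse-advice a (false ∷ true ∷ ls) [] v }) , λ ()
  parse (true ∷ []) ls xs v = (λ ()) , λ _ → (_ , refl , refl) ▸ᴬ (_ , refl , refl) ▸ᴬ (_ , refl , refl) ▸ᴬ answered
  parse (true ∷ b ∷ u) ls xs v with unpair u | parse u (b ∷ true ∷ true ∷ true ∷ ls) (b ∷ xs) v
  ... | just _  | found , _ = (λ { refl → read-bit (found refl) }) , λ ()
    where
    read-bit : ∀ {d n tk tr} → Reach n
      (loc (flag xFlag) , tapes (wordTape (map bit (b ∷ true ∷ true ∷ true ∷ ls)) ⟨ u , v ⟩) (tape [] blank (map bit (b ∷ xs))) emptyTape tk tr) d →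
      Reach (4 + n) (loc (flag xFlag) , tapes (wordTape (map bit ls) ⟨ true ∷ b ∷ u , v ⟩) (tape [] blank (map bit xs)) emptyTape tk tr) d
    read-bit r = (_ , refl , refl) ▸ (_ , refl , refl) ▸ (_ , refl , refl) ▸
      (_ , refl , cong (λ t → tapes t _ _ _ _) (move-wordTape (map bit (true ∷ true ∷ true ∷ ls)) b ⟨ u , v ⟩)) ▸ r
  ... | nothing | _ , failed = (λ ()) , λ _ →
      (_ , refl , refl) ▸ᴬ (_ , refl , refl) ▸ᴬ (_ , refl , refl) ▸ᴬ
      (_ , refl , cong (λ t → tapes t _ _ _ _) (move-wordTape (map bit (true ∷ true ∷ true ∷ ls)) b ⟨ u , v ⟩)) ▸ᴬ failed refl

  runningTime : ℕ → ℕ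
  runningTime n = suc (double n) + (double n + (5 + ⟦ p ⟧ (suc n)))

  double-mono : ∀ {m n} → m ≤ n → double m ≤ double n
  double-mono {m} {n} m≤n = subst₂ _≤_ (sym (double≡+ m)) (sym (double≡+ n)) (ℕ.+-mono-≤ m≤n m≤n)

  start-tapes : Word → Tapes
  start-tapes w = tapes (wordTape [] w) emptyTape emptyTape emptyTape blanks

  verifyV-correct : ∀ u v → Answers (runningTime (length u)) (startControl , start-tapes ⟨ u , v ⟩) (verifyV (u , v))
  verifyV-correct u v with unpair u in e≡ | parse u [] [] v {emptyTape} {blanks}
  ... | nothing      | _ , failed = answers-≤ (ℕ.m≤m+n _ _) (failed refl)
  ... | just (x , a) | found , _  = reach-answers (found refl)
    (answers-≤ (ℕ.+-mono-≤ (double-mono a≤u) ℕ.≤-refl)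
      (Bounded.seek-correct (suc (length u)) (reverse a) (s≤s a≤u)))
    where
    a≤u : length (reverse a) ≤ length u
    a≤u = subst (_≤ length u) (sym (List.length-reverse a)) (unpair-length u e≡)

  -- Bits may remain to the right of the head; the blank written behind the answer cuts the output
  -- down to one bit.
  output-answer : ∀ b t → outputWord {g} (move left blank (move right (bit b) t)) ≡ b ∷ []
  output-answer b (tape ls s [])       = refl
  output-answer b (tape ls s (r ∷ rs)) = refl

  finish : ∀ {n c b} → Answers n c b → ∃[ ts ] Reach (n + 2) c (loc done , ts) × outputWord (Tapes.inT ts) ≡ b ∷ []
  finish {b = b} (tapes ti tx ta tk tr , r) = _ ,
    reach-trans r ((_ , refl , refl) ▸ (_ , refl , refl) ▸ reach-refl) , output-answer b ti

  initial-machine : ∀ w → initial machine w ≡ (zero , toVec (start-tapes w))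
  initial-machine w = cong (λ t → zero , t ∷ emptyTape ∷ emptyTape ∷ emptyTape ∷ blanks) (inputTape≡wordTape w)

  double-polyBounded : PolyBounded double
  double-polyBounded = pb-≤ (λ n → ℕ.≤-reflexive (double≡+ n)) (pb-+ pb-id pb-id)

  runningTime-polyBounded : PolyBounded (λ n → runningTime n + 2)
  runningTime-polyBounded = pb-+ (pb-+ (pb-suc double-polyBounded)
    (pb-+ double-polyBounded (pb-+ (pb-const 5) (pb-∘ p (pb-suc pb-id))))) (pb-const 2)

  verifyV-polyTime : PolyTime encodePair encodeBit verifyV
  verifyV-polyTime = machine , PolyBounded.poly runningTime-polyBounded , λ { (u , v) →
    let ts , (t , t≤ , steps) , out = finish (verifyV-correct u v)
        d , h , d≡ = machine-halts steps zero refl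
    in t , d ,
       ℕ.≤-trans t≤ (ℕ.≤-trans (PolyBounded.bounds runningTime-polyBounded (length u))
         (Polynomial-mono (PolyBounded.poly runningTime-polyBounded) (u≤ u v))) ,
       subst (λ c → HaltsIn machine t c d) (sym (initial-machine ⟨ u , v ⟩)) h ,
       trans (cong (outputWord ∘ Vec.head) d≡) out }
    where
    u≤ : ∀ u v → length u ≤ length ⟨ u , v ⟩
    u≤ u v = subst (length u ≤_) (sym (length-⟨⟩ u v))
      (ℕ.≤-trans (ℕ.m≤m+n (length u) (length u)) (ℕ.≤-trans (ℕ.m≤m+n _ (length v)) (ℕ.n≤1+n _)))

-- Scripts that evaluate a template on data read from the tapes

-- The copy of `x` is reversed and the head rests on the blank before it, so bit `j` is found
-- `suc (fromEnd j)` cells to the right.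
fromEnd : ∀ {n} → Fin n → ℕ
fromEnd {suc n} zero    = n
fromEnd {suc n} (suc j) = fromEnd j

fromEnd< : ∀ {n} (j : Fin n) → fromEnd j < n
fromEnd< {suc n} zero    = ℕ.≤-refl
fromEnd< {suc n} (suc j) = ℕ.m≤n⇒m≤1+n (fromEnd< j)

module _ {g : ℕ} where

  rightOf : Tape g → ℕ → Symbol g
  rightOf t i = look t (cell i)

  -- Equality up to blank cells at the right end.
  record _≈ᵀ_ (t u : Tape g) : Set where
    constructor sameᵀ
    field
      before≡ : Tape.before t ≡ Tape.before u
      right≡  : ∀ i → rightOf t i ≡ rightOf u i

  ≈ᵀ-refl : ∀ {t} → t ≈ᵀ t
  ≈ᵀ-refl = sameᵀ refl (λ _ → refl)

  ≈ᵀ-trans : ∀ {t u v} → t ≈ᵀ u → u ≈ᵀ v → t ≈ᵀ v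
  ≈ᵀ-trans (sameᵀ p q) (sameᵀ p′ q′) = sameᵀ (trans p p′) (λ i → trans (q i) (q′ i))

  rightOf-forward : ∀ t i → rightOf (forward t) i ≡ rightOf t (suc i)
  rightOf-forward (tape _ _ [])      zero    = refl
  rightOf-forward (tape _ _ [])      (suc i) = refl
  rightOf-forward (tape _ _ (_ ∷ _)) zero    = refl
  rightOf-forward (tape _ _ (_ ∷ _)) (suc i) = refl

  before-forward : ∀ t → Tape.before (forward t) ≡ rightOf t 0 ∷ Tape.before t
  before-forward (tape _ _ [])      = refl
  before-forward (tape _ _ (_ ∷ _)) = refl

  forward-cong : ∀ {t u} → t ≈ᵀ u → forward t ≈ᵀ forward u
  forward-cong {t} {u} (sameᵀ p q) = sameᵀ
    (trans (before-forward t) (trans (cong₂ _∷_ (q 0) p) (sym (before-forward u))))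
    (λ i → trans (rightOf-forward t i) (trans (q (suc i)) (sym (rightOf-forward u i))))

  backward-cong : ∀ {t u} → t ≈ᵀ u → backward t ≈ᵀ backward u
  backward-cong {tape []       _ _} {tape .[]       _ _} (sameᵀ refl q) =
    sameᵀ refl (λ { zero → refl ; (suc zero) → q 0 ; (suc (suc i)) → q (suc i) })
  backward-cong {tape (l ∷ ls) _ _} {tape .(l ∷ ls) _ _} (sameᵀ refl q) =
    sameᵀ refl (λ { zero → refl ; (suc zero) → q 0 ; (suc (suc i)) → q (suc i) })

  -- Equality may fail: a step beyond the end of the stored cells leaves an explicit blank in the
  -- list.
  backward-forward : ∀ t → backward (forward t) ≈ᵀ t
  backward-forward (tape ls s [])       =
    sameᵀ refl (λ { zero → refl ; (suc zero) → refl ; (suc (suc i)) → refl })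
  backward-forward (tape ls s (r ∷ rs)) =
    sameᵀ refl (λ { zero → refl ; (suc zero) → refl ; (suc (suc i)) → refl })

  iterate : (Tape g → Tape g) → ℕ → Tape g → Tape g
  iterate f zero    t = t
  iterate f (suc d) t = iterate f d (f t)

  iterate-commute : ∀ f d t → iterate f d (f t) ≡ f (iterate f d t)
  iterate-commute f zero    t = refl
  iterate-commute f (suc d) t = iterate-commute f d (f t)

  backward-forward-iterate : ∀ d t → iterate backward d (iterate forward d t) ≈ᵀ t
  backward-forward-iterate zero    t = ≈ᵀ-refl
  backward-forward-iterate (suc d) t =
    subst (_≈ᵀ t) (sym (iterate-commute backward d _))
      (≈ᵀ-trans (backward-cong (backward-forward-iterate d (forward t))) (backward-forward t))

  rightOf-iterate : ∀ d t → Tape.head (iterate forward d t) ≡ rightOf t d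
  rightOf-iterate zero    t = refl
  rightOf-iterate (suc d) t = trans (rightOf-iterate d (forward t)) (rightOf-forward t d)

  rightOf-wordTape : ∀ ls w i → rightOf (wordTape ls w) i ≡ nth (map bit w) i
  rightOf-wordTape ls []      zero    = refl
  rightOf-wordTape ls []      (suc i) = refl
  rightOf-wordTape ls (_ ∷ w) zero    = refl
  rightOf-wordTape ls (_ ∷ w) (suc i) = refl

  nth-tabulate : ∀ {n} (f : Fin n → Bool) i → nth {g} (map bit (List.tabulate f)) (toℕ i) ≡ bit (f i)
  nth-tabulate f zero    = refl
  nth-tabulate f (suc i) = nth-tabulate (f ∘ suc) i

  nth-ʳ++-skip : ∀ {n} (x : Vec Bool n) ys i → nth {g} (map bit (Vec.toList x ʳ++ ys)) (n + i) ≡ nth (map bit ys) i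
  nth-ʳ++-skip []      ys i = refl
  nth-ʳ++-skip {suc n} (b ∷ x) ys i =
    trans (cong (nth (map bit (Vec.toList x ʳ++ (b ∷ ys)))) (sym (ℕ.+-suc n i))) (nth-ʳ++-skip x (b ∷ ys) (suc i))

  nth-ʳ++ : ∀ {n} (x : Vec Bool n) ys j → nth {g} (map bit (Vec.toList x ʳ++ ys)) (fromEnd j) ≡ bit (Vec.lookup x j)
  nth-ʳ++ {suc n} (b ∷ x) ys zero =
    trans (cong (nth (map bit (Vec.toList x ʳ++ (b ∷ ys)))) (sym (ℕ.+-identityʳ n))) (nth-ʳ++-skip x (b ∷ ys) 0)
  nth-ʳ++ (b ∷ x) ys (suc j) = nth-ʳ++ x (b ∷ ys) j

-- The way back brings both heads home, so the code for one literal is independent of its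
-- neighbours.
travel : ℕ → Source → List Op
travel d s = replicate d fwd ++ put s ∷ replicate d bwd

length-travel : ∀ d s → length (travel d s) ≡ suc (d + d)
length-travel d s = trans (List.length-++ (replicate d fwd))
  (trans (cong₂ _+_ (List.length-replicate d) (cong suc (List.length-replicate d))) (ℕ.+-suc d d))

module Compile {t n : ℕ} (c : Fin t) where

  -- The position `c` of the input in the tuple is hard-wired. Its bits come from the copy of `x`,
  -- all others from the certificate, which lists the whole tuple with `n` bits per component, as
  -- addressed by `Fin.combine`.
  compile : Lit (Fin t × Fin n) → List Op
  compile (constL b)        = put (lit b) ∷ []
  compile (varL b (c′ , j)) =
    if ⌊ c Fin.≟ c′ ⌋ then travel (suc (fromEnd j)) (fromX b) else travel (toℕ (Fin.combine c′ j)) (fromY b)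

  -- The word under construction grows at its left end, so the last literal comes first.
  emitOps : List (Lit (Fin t × Fin n)) → List Op
  emitOps []       = []
  emitOps (l ∷ ls) = emitOps ls ++ compile l

  -- The parts are the parameter in unary, the word, and the expected kernel `z`. Any operation but
  -- `sep` counts as a tick in the first part; choosing `fwd` keeps the body free of `mark`, so a
  -- search for the next segment passes over it.
  body : List (Lit (Fin t × Fin n)) → ℕ → Word → List Op
  body ls k z = replicate k fwd ++ sep ∷ emitOps ls ++ sep ∷ map (put ∘ lit) z ++ sep ∷ []

  length-travel-≤ : ∀ {d} s → d ≤ t * n + n → length (travel d s) ≤ suc (2 * (t * n + n))
  length-travel-≤ {d} s d≤ = subst₂ _≤_ (sym (length-travel d s)) (cong suc (lemma (t * n + n))) (s≤s (ℕ.+-mono-≤ d≤ d≤))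
    where
    lemma : ∀ d → d + d ≡ 2 * d
    lemma = solve-∀

  length-compile : ∀ l → length (compile l) ≤ suc (2 * (t * n + n))
  length-compile (constL b) = s≤s z≤n
  length-compile (varL b (c′ , j)) with c Fin.≟ c′
  ... | yes _ = length-travel-≤ (fromX b) (ℕ.≤-trans (fromEnd< j) (ℕ.m≤n+m n (t * n)))
  ... | no _  = length-travel-≤ (fromY b)
    (ℕ.≤-trans (ℕ.<⇒≤ (Fin.toℕ<n (Fin.combine c′ j))) (ℕ.m≤m+n (t * n) n))

  length-emitOps : ∀ ls → length (emitOps ls) ≤ length ls * suc (2 * (t * n + n))
  length-emitOps []       = z≤n
  length-emitOps (l ∷ ls) = subst₂ _≤_ (sym (List.length-++ (emitOps ls)))
    (ℕ.+-comm (length ls * suc (2 * (t * n + n))) (suc (2 * (t * n + n))))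
    (ℕ.+-mono-≤ (length-emitOps ls) (length-compile l))

  length-body : ∀ ls k z → length (body ls k z) ≡ 3 + k + length (emitOps ls) + length z
  length-body ls k z = begin
    length (body ls k z)
      ≡⟨ List.length-++ (replicate k fwd) ⟩
    length (replicate k fwd) + suc (length (emitOps ls ++ sep ∷ map (put ∘ lit) z ++ sep ∷ []))
      ≡⟨ cong₂ (λ a b → a + suc b) (List.length-replicate k) (List.length-++ (emitOps ls)) ⟩
    k + suc (length (emitOps ls) + suc (length (map (put ∘ lit) z ++ sep ∷ [])))
      ≡⟨ cong (λ a → k + suc (length (emitOps ls) + suc a))
           (trans (List.length-++ (map (put ∘ lit) z)) (cong (_+ 1) (List.length-map (put ∘ lit) z))) ⟩
    k + suc (length (emitOps ls) + suc (length z + 1))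
      ≡⟨ lemma k (length (emitOps ls)) (length z) ⟩
    3 + k + length (emitOps ls) + length z ∎
    where
    open ≡-Reasoning
    lemma : ∀ a b c → a + suc (b + suc (c + 1)) ≡ 3 + a + b + c
    lemma = solve-∀

  Unmarked : Op → Set
  Unmarked op = op ≢ mark

  unmarked-travel : ∀ d s → All Unmarked (travel d s)
  unmarked-travel d s = All.++⁺ (All.replicate⁺ d λ ()) ((λ ()) ∷ All.replicate⁺ d λ ())

  unmarked-compile : ∀ l → All Unmarked (compile l)
  unmarked-compile (constL b) = (λ ()) ∷ []
  unmarked-compile (varL b (c′ , j)) with c Fin.≟ c′
  ... | yes _ = unmarked-travel (suc (fromEnd j)) (fromX b)
  ... | no _  = unmarked-travel (toℕ (Fin.combine c′ j)) (fromY b)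

  unmarked-emitOps : ∀ ls → All Unmarked (emitOps ls)
  unmarked-emitOps []       = []
  unmarked-emitOps (l ∷ ls) = All.++⁺ (unmarked-emitOps ls) (unmarked-compile l)

  unmarked-body : ∀ ls k z → All Unmarked (body ls k z)
  unmarked-body ls k z = All.++⁺ (All.replicate⁺ k λ ()) ((λ ()) ∷ All.++⁺ (unmarked-emitOps ls)
    ((λ ()) ∷ All.++⁺ (All.map⁺ (All.universal (λ _ ()) z)) ((λ ()) ∷ [])))

  module _ {g : ℕ} (kernel : Word × ℕ → Word × ℕ) where
    open Script {g} kernel

    skip : ∀ {ops} → All Unmarked ops → ∀ rest tx ty → seekV (ops ++ rest) tx ty ≡ seekV rest tx ty
    skip {[]}        []       rest tx ty = refl
    skip {mark ∷ _}  (u ∷ us) rest tx ty = contradiction refl u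
    skip {sep ∷ _}   (_ ∷ us) rest tx ty = skip us rest tx ty
    skip {fwd ∷ _}   (_ ∷ us) rest tx ty = skip us rest tx ty
    skip {bwd ∷ _}   (_ ∷ us) rest tx ty = skip us rest tx ty
    skip {put _ ∷ _} (_ ∷ us) rest tx ty = skip us rest tx ty

    sourceValue-cong : ∀ s {tx tx′ ty ty′ : Tape g} → tx ≈ᵀ tx′ → ty ≈ᵀ ty′ → sourceValue s tx ty ≡ sourceValue s tx′ ty′
    sourceValue-cong (lit b)   p q = refl
    sourceValue-cong (fromX b) p q = cong (λ s → b xor bitOf s) (_≈ᵀ_.right≡ p 0)
    sourceValue-cong (fromY b) p q = cong (λ s → b xor bitOf s) (_≈ᵀ_.right≡ q 0)

    emitV-cong : ∀ ops {tx tx′ ty ty′ k w} → tx ≈ᵀ tx′ → ty ≈ᵀ ty′ → emitV ops tx ty k w ≡ emitV ops tx′ ty′ k w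
    emitV-cong []            p q = refl
    emitV-cong (mark ∷ ops)  p q = emitV-cong ops p q
    emitV-cong (sep ∷ ops)   p q = refl
    emitV-cong (fwd ∷ ops)   p q = emitV-cong ops (forward-cong p) (forward-cong q)
    emitV-cong (bwd ∷ ops)   p q = emitV-cong ops (backward-cong p) (backward-cong q)
    emitV-cong (put s ∷ ops) {ty = ty} {k = k} {w} p q =
      trans (emitV-cong ops p q) (cong (λ b → emitV ops _ _ k (b ∷ w)) (sourceValue-cong s p q))

    emitV-fwd : ∀ d ops tx ty k w →
      emitV (replicate d fwd ++ ops) tx ty k w ≡ emitV ops (iterate forward d tx) (iterate forward d ty) k w
    emitV-fwd zero    ops tx ty k w = refl
    emitV-fwd (suc d) ops tx ty k w = emitV-fwd d ops (forward tx) (forward ty) k w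

    emitV-bwd : ∀ d ops tx ty k w →
      emitV (replicate d bwd ++ ops) tx ty k w ≡ emitV ops (iterate backward d tx) (iterate backward d ty) k w
    emitV-bwd zero    ops tx ty k w = refl
    emitV-bwd (suc d) ops tx ty k w = emitV-bwd d ops (backward tx) (backward ty) k w

    emitV-travel : ∀ d s ops tx ty k w → emitV (travel d s ++ ops) tx ty k w ≡
      emitV ops tx ty k (sourceValue s (iterate forward d tx) (iterate forward d ty) ∷ w)
    emitV-travel d s ops tx ty k w = trans
      (cong (λ ops → emitV ops tx ty k w) (List.++-assoc (replicate d fwd) (put s ∷ replicate d bwd) ops))
      (trans (emitV-fwd d _ tx ty k w)
      (trans (emitV-bwd d ops _ _ k _)
             (emitV-cong ops (backward-forward-iterate d tx) (backward-forward-iterate d ty))))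

    module _ (x : Vec Bool n) where

      xTape : Tape g
      xTape = tape [] blank (map bit (reverse (Vec.toList x)))

      -- The data that a script for position c works with: component c is
      -- the input and the other components are read from the certificate.
      tapeData : Tape g → Fin t × Fin n → Bool
      tapeData ty (c′ , j) =
        if ⌊ c Fin.≟ c′ ⌋ then Vec.lookup x j else bitOf (rightOf ty (toℕ (Fin.combine c′ j)))

      emitV-compile : ∀ l ops ty k w →
        emitV (compile l ++ ops) xTape ty k w ≡ emitV ops xTape ty k (evalL (tapeData ty) l ∷ w)
      emitV-compile (constL b) ops ty k w = refl
      emitV-compile (varL b (c′ , j)) ops ty k w with c Fin.≟ c′
      ... | yes _ = trans (emitV-travel (suc (fromEnd j)) (fromX b) ops xTape ty k w)
            (cong (λ s → emitV ops xTape ty k ((b xor bitOf s) ∷ w))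
              (trans (rightOf-iterate (suc (fromEnd j)) xTape) (nth-ʳ++ x [] j)))
      ... | no _  = trans (emitV-travel (toℕ (Fin.combine c′ j)) (fromY b) ops xTape ty k w)
            (cong (λ s → emitV ops xTape ty k ((b xor bitOf s) ∷ w)) (rightOf-iterate (toℕ (Fin.combine c′ j)) ty))

      emitV-emitOps : ∀ ls ops ty k w →
        emitV (emitOps ls ++ ops) xTape ty k w ≡ emitV ops xTape ty k (fill (tapeData ty) ls ++ w)
      emitV-emitOps []       ops ty k w = refl
      emitV-emitOps (l ∷ ls) ops ty k w = trans
        (cong (λ ops → emitV ops xTape ty k w) (List.++-assoc (emitOps ls) (compile l) ops))
        (trans (emitV-emitOps ls (compile l ++ ops) ty k w) (emitV-compile l ops ty k _))

      ticksV-fwd : ∀ m ops ty k → ticksV (replicate m fwd ++ sep ∷ ops) xTape ty k ≡ emitV ops xTape ty (m + k) []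
      ticksV-fwd zero    ops ty k = refl
      ticksV-fwd (suc m) ops ty k =
        trans (ticksV-fwd m ops ty (suc k)) (cong (λ k → emitV ops xTape ty k []) (ℕ.+-suc m k))

      image : Tape g → List (Lit (Fin t × Fin n)) → ℕ → Word
      image ty ls k = encodeInstance (kernel (fill (tapeData ty) ls , k))

      ticksV-body : ∀ ls k z rest ty → ticksV (body ls k z ++ rest) xTape ty 0 ≡
        compareV (map (put ∘ lit) z ++ sep ∷ rest) (image ty ls k)
      ticksV-body ls k z rest ty = begin
        ticksV (body ls k z ++ rest) xTape ty 0
          ≡⟨ cong (λ ops → ticksV ops xTape ty 0) (trans (List.++-assoc (replicate k fwd) _ rest)
               (cong (λ ops → replicate k fwd ++ sep ∷ ops) (trans (List.++-assoc (emitOps ls) _ rest)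
               (cong (λ ops → emitOps ls ++ sep ∷ ops) (List.++-assoc (map (put ∘ lit) z) _ rest))))) ⟩
        ticksV (replicate k fwd ++ sep ∷ emitOps ls ++ sep ∷ map (put ∘ lit) z ++ sep ∷ rest) xTape ty 0
          ≡⟨ ticksV-fwd k _ ty 0 ⟩
        emitV (emitOps ls ++ sep ∷ map (put ∘ lit) z ++ sep ∷ rest) xTape ty (k + 0) []
          ≡⟨ emitV-emitOps ls _ ty (k + 0) [] ⟩
        compareV (map (put ∘ lit) z ++ sep ∷ rest) (encodeInstance (kernel (fill (tapeData ty) ls ++ [] , k + 0)))
          ≡⟨ cong₂ (λ w k → compareV (map (put ∘ lit) z ++ sep ∷ rest) (encodeInstance (kernel (w , k))))
               (List.++-identityʳ _) (ℕ.+-identityʳ k) ⟩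
        compareV (map (put ∘ lit) z ++ sep ∷ rest) (image ty ls k) ∎
        where open ≡-Reasoning

compareV-sound : ∀ z rest w → compareV (map (put ∘ lit) z ++ sep ∷ rest) w ≡ true → z ≡ w
compareV-sound []      rest []      _ = refl
compareV-sound (b ∷ z) rest (c ∷ w) h with b 𝔹.≟ c
... | yes refl = cong (b ∷_) (compareV-sound z rest w h)

compareV-refl : ∀ z rest → compareV (map (put ∘ lit) z ++ sep ∷ rest) z ≡ true
compareV-refl []      rest = refl
compareV-refl (b ∷ z) rest with b 𝔹.≟ b
... | yes _ = compareV-refl z rest
... | no ne = contradiction refl ne

-- Programs made of selectable segments

module Program {g t n : ℕ} (kernel : Word × ℕ → Word × ℕ) (ls : List (Lit (Fin t × Fin n))) (k : ℕ) where
  open Script {g} kernel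
  open Compile using (body; xTape; tapeData; image; skip; unmarked-body; ticksV-body)

  -- At each `mark` the machine reads one certificate bit: `true` runs the segment, `false` skips
  -- it. A certificate is thus a segment number in unary, followed by a tuple.
  program : List (Fin t × Word) → List Op
  program []             = []
  program ((c , z) ∷ ps) = mark ∷ body c ls k z ++ program ps

  length-program : ∀ ps Z → (∀ {p} → p ∈ ps → length (proj₂ p) ≤ Z) →
    length (program ps) ≤ length ps * (4 + k + length ls * suc (2 * (t * n + n)) + Z)
  length-program []             Z h = z≤n
  length-program ((c , z) ∷ ps) Z h = begin
    suc (length (body c ls k z ++ program ps))
      ≡⟨ cong suc (trans (List.length-++ (body c ls k z)) (cong (_+ length (program ps)) (Compile.length-body c ls k z))) ⟩
    4 + k + length (Compile.emitOps c ls) + length z + length (program ps)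
      ≤⟨ ℕ.+-mono-≤ (ℕ.+-mono-≤ (ℕ.+-monoʳ-≤ (4 + k) (Compile.length-emitOps c ls)) (h (here refl)))
                    (length-program ps Z (h ∘ there)) ⟩
    suc (length ps) * (4 + k + length ls * suc (2 * (t * n + n)) + Z) ∎
    where open ℕ.≤-Reasoning

  module _ (x : Vec Bool n) where

    private
      tx : Tape g
      tx = tape [] blank (map bit (reverse (Vec.toList x)))

    seek-body : ∀ c z ps ty → seekV (body c ls k z ++ program ps) tx ty ≡ seekV (program ps) tx ty
    seek-body c z ps ty = skip {n = n} c kernel (unmarked-body c ls k z) (program ps) tx ty

    seekV-sound : ∀ ps ty → seekV (program ps) tx ty ≡ true →
      ∃[ c ] ∃[ z ] ∃[ ty′ ] (c , z) ∈ ps × z ≡ image c {g} kernel x ty′ ls k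
    seekV-sound ((c , z) ∷ ps) ty h with bitOf (Tape.head ty)
    ... | true  = c , z , forward ty , here refl ,
          compareV-sound z (program ps) _ (trans (sym (ticksV-body c kernel x ls k z (program ps) (forward ty))) h)
    ... | false = let c′ , z′ , ty′ , p∈ , e≡ = seekV-sound ps (forward ty) (trans (sym (seek-body c z ps (forward ty))) h) in
          c′ , z′ , ty′ , there p∈ , e≡

    -- The cells to the left of the certificate head accumulate the selection bits while segments
    -- are skipped, hence the quantification over `bs`.
    seekV-complete : ∀ (w : Word) {c z} ps → (c , z) ∈ ps →
      (∀ bs → image c {g} kernel x (wordTape bs w) ls k ≡ z) →
      ∃[ y ] length y ≤ length ps + length w × (∀ bs → seekV (program ps) tx (wordTape bs y) ≡ true)
    seekV-complete w {c} {z} (_ ∷ ps) (here refl) h = true ∷ w , s≤s (ℕ.m≤n+m (length w) (length ps)) , λ bs →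
      trans (cong (λ ty → ticksV (body c ls k z ++ program ps) tx ty 0) (move-wordTape bs true w))
      (trans (ticksV-body c kernel x ls k z (program ps) (wordTape (bit true ∷ bs) w))
      (trans (cong (compareV (map (put ∘ lit) z ++ sep ∷ program ps)) (h _)) (compareV-refl z (program ps))))
    seekV-complete w ((c′ , z′) ∷ ps) (there p∈) h =
      let y , y≤ , ok = seekV-complete w ps p∈ h in false ∷ y , s≤s y≤ , λ bs →
      trans (seek-body c′ z′ ps _) (trans (cong (seekV (program ps) tx) (move-wordTape bs false y)) (ok (bit false ∷ bs)))

-- Fortnow and Santhanam's argument

-- Exhaustive search over certificates. It serves to define the advice, of which only the length is
-- bounded, not the time to compute it.
L-decidable : ∀ {L} → InNP L → ∀ x → Dec (L x)
L-decidable np x with search (λ y → verify (x , y) 𝔹.≟ true) (words≤ (⟦ bound ⟧ (length x)))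
  where open InNP np
... | inj₁ (y , y∈ , v) = yes (Equivalence.from (InNP.correct np x) (y , words≤-length y∈ , v))
... | inj₂ none         = no λ Lx →
      let y , y≤ , v = Equivalence.to (InNP.correct np x) Lx in none (∈-words≤ y y≤) v

encodeInstance-injective : ∀ a b → encodeInstance a ≡ encodeInstance b → a ≡ b
encodeInstance-injective (x , k) (y , l) e =
  let p , q = ⟨⟩-injective x y e in
  cong₂ _,_ p (trans (sym (List.length-replicate k)) (trans (cong length q) (List.length-replicate l)))

module Distillation {Π : ParameterizedProblem} {L′ L : Language} (np : InNP L′)
  (composition : Composition Π L′) (L≐∁L′ : L ≐ ∁ L′) (K : PolynomialKernel Π) where
  open Composition composition using (template; parameter) renaming (correct to composition-correct)
  open PolynomialKernel K using (kernel; equivalent; small) renaming (bound to kernelBound)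

  M : TM
  M = proj₁ (PolynomialKernel.kernelPoly K)

  open TM M using () renaming (extraSymbols to g)

  module Verifier = Behaviour M kernel (proj₁ (proj₂ (PolynomialKernel.kernelPoly K))) (proj₂ (proj₂ (PolynomialKernel.kernelPoly K)))

  open Script {g} kernel using (seekV; verifyV; verifyV-⟨⟩)

  -- `imageBound` bounds an encoded kernel, in which the word counts twice and the parameter once.
  -- There are fewer than `2 ^ suc m` words of length at most `m`, which gives the tuple length.
  imageBound tuples : ℕ → ℕ
  imageBound n = suc (⟦ kernelBound ⟧ (parameter n) + ⟦ kernelBound ⟧ (parameter n) + ⟦ kernelBound ⟧ (parameter n))
  tuples n = suc (imageBound n)

  module Advice (n : ℕ) where

    t : ℕ
    t = tuples n

    literals : List (Lit (Fin t × Fin n))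
    literals = template n t

    assignment : Vec (Vec Bool n) t → Fin t × Fin n → Bool
    assignment v (c , j) = Vec.lookup (Vec.lookup v c) j

    imageOf : (Fin t × Fin n → Bool) → Word
    imageOf X = encodeInstance (kernel (fill X literals , parameter n))

    imageOf-length : ∀ X → length (imageOf X) ≤ imageBound n
    imageOf-length X = subst (_≤ imageBound n) (sym (Verifier.length-encodeInstance (proj₁ reduced) (proj₂ reduced)))
      (let x≤ , k≤ = small (fill X literals) (parameter n) in s≤s (ℕ.+-mono-≤ (ℕ.+-mono-≤ x≤ x≤) k≤))
      where reduced = kernel (fill X literals , parameter n)

    noInstance : Vec Bool n → Bool
    noInstance v = not ⌊ L-decidable np (Vec.toList v) ⌋

    noInstance-sound : ∀ v → noInstance v ≡ true → ¬ L′ (Vec.toList v)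
    noInstance-sound v h with no ¬L′v ← L-decidable np (Vec.toList v) = ¬L′v

    noInstance-complete : ∀ v → ¬ L′ (Vec.toList v) → noInstance v ≡ true
    noInstance-complete v ¬L′v with L-decidable np (Vec.toList v)
    ... | yes L′v = contradiction L′v ¬L′v
    ... | no _    = refl

    noInstances : List (Vec Bool n)
    noInstances = select noInstance (allVecs bits n)

    noTuples : List (Vec (Vec Bool n) t)
    noTuples = allVecs noInstances t

    IsImage : Word → Set
    IsImage z = Any (λ v → imageOf (assignment v) ≡ z) noTuples

    isImage? : ∀ z → Dec (IsImage z)
    isImage? z = Any.any? (λ v → List.≡-dec 𝔹._≟_ (imageOf (assignment v)) z) noTuples

    images : List Word
    images = select (λ z → ⌊ isImage? z ⌋) (words≤ (imageBound n))

    Hit : Vec Bool n → Word → Set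
    Hit x z = Any (λ v → (∃[ i ] Vec.lookup v i ≡ x) × imageOf (assignment v) ≡ z) noTuples

    hit? : ∀ x z → Dec (Hit x z)
    hit? x z = Any.any? (λ v → Fin.any? (λ i → Vec.≡-dec 𝔹._≟_ (Vec.lookup v i) x) ×-dec
                               List.≡-dec 𝔹._≟_ (imageOf (assignment v)) z) noTuples

    length-select-≤ : ∀ {A : Set} (p : A → Bool) xs → length (select p xs) ≤ length xs
    length-select-≤ p xs = subst₂ _≤_ (sym (length-select p xs)) (count-not p xs) (ℕ.m≤m+n _ _)

    -- The covering argument wants a strict inequality, which costs one in the exponent: this is why
    -- `suc n` targets are allowed.
    few-noInstances : length noInstances < 2 ^ suc n
    few-noInstances = ℕ.≤-<-trans (length-select-≤ noInstance (allVecs bits n))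
      (subst (_< 2 ^ suc n) (sym (length-allVecs bits n)) (ℕ.^-monoʳ-< 2 (s≤s (s≤s z≤n)) {n} {suc n} ℕ.≤-refl))

    few-images : length images < 2 ^ t
    few-images = ℕ.≤-<-trans (length-select-≤ (λ z → ⌊ isImage? z ⌋) (words≤ (imageBound n))) (length-words≤ (imageBound n))

    abstract
      cover : ∃[ cs ] length cs ≤ suc n × (∀ {z} → z ∈ cs → z ∈ images) ×
        (∀ {x} → x ∈ noInstances → ∃[ z ] z ∈ cs × ⌊ hit? x z ⌋ ≡ true)
      cover with cover-or-escape (λ x z → ⌊ hit? x z ⌋) (suc n) t noInstances images few-noInstances few-images
      ... | inj₂ c = c
      -- The image of the escaping tuple `v` is itself one of the `images`, and each component of
      -- `v` hits it through `v`, so nothing can miss it.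
      ... | inj₁ (v , v∈ , escape) =
        let i , miss = escape image∈ in
        contradiction (trans (sym (dec-complete (hit? _ _) (lose v∈ ((i , refl) , refl)))) miss) λ ()
        where
        image∈ : imageOf (assignment v) ∈ images
        image∈ = ∈-select⁺ _ (∈-words≤ _ (imageOf-length (assignment v))) (dec-complete (isImage? _) (lose v∈ refl))

    targets : List Word
    targets = proj₁ cover

    -- A segment has both the position of the input and the target built in, so there is one for
    -- every combination.
    segments : List (Fin t × Word)
    segments = cartesianProduct (allFin t) targets

    length-segments : length segments ≤ t * suc n
    length-segments = subst (_≤ t * suc n) (sym (length-cartesianProductWith _,_ (allFin t) targets))
      (subst (λ l → l * length targets ≤ t * suc n) (sym (List.length-tabulate {n = t} id))
        (ℕ.*-monoʳ-≤ t (proj₁ (proj₂ cover))))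

    open Program {g} kernel literals (parameter n) public

    abstract
      adviceWord : Word
      adviceWord = reverse (encodeOps (program segments))

      decode-adviceWord : decodeOps (reverse adviceWord) ≡ program segments
      decode-adviceWord = trans (cong decodeOps (List.reverse-involutive (encodeOps (program segments))))
                                (decode-encodeOps (program segments))

      length-adviceWord : length adviceWord ≡ 4 * length (program segments)
      length-adviceWord = trans (List.length-reverse (encodeOps (program segments))) (length-encodeOps (program segments))

    target-image : ∀ {z} → z ∈ targets → IsImage z
    target-image z∈ = dec-sound (isImage? _) (proj₂ (∈-select⁻ (λ z → ⌊ isImage? z ⌋) (words≤ (imageBound n)) (proj₁ (proj₂ (proj₂ cover)) z∈)))

    target-length : ∀ {z} → z ∈ targets → length z ≤ imageBound n
    target-length z∈ = words≤-length (proj₁ (∈-select⁻ (λ z → ⌊ isImage? z ⌋) (words≤ (imageBound n)) (proj₁ (proj₂ (proj₂ cover)) z∈)))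

    -- A target is the kernel of a tuple of no-instances, so every instance with this kernel is a no-instance.
    image-no : ∀ {z} X → z ∈ targets → z ≡ imageOf X → ∀ c → ¬ L′ (Vec.toList (Vec.tabulate (λ j → X (c , j))))
    image-no X z∈ z≡ c L′c with find (target-image z∈)
    ... | v , v∈ , e≡ = noInstance-sound _ (proj₂ (∈-select⁻ noInstance (allVecs bits n) (∈-allVecs⁻ {xs = noInstances} v∈ (proj₁ yes-tuple))))
            (subst (L′ ∘ Vec.toList) (Vec.tabulate∘lookup (Vec.lookup v (proj₁ yes-tuple))) (proj₂ yes-tuple))
      where
      same-kernel : kernel (fill (assignment v) literals , parameter n) ≡ kernel (fill X literals , parameter n)
      same-kernel = encodeInstance-injective _ _ (trans e≡ z≡)
      yes-tuple : ∃[ i ] L′ (Vec.toList (Vec.tabulate (λ j → assignment v (i , j))))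
      yes-tuple = Equivalence.to (composition-correct n t (assignment v))
        (Equivalence.from (equivalent _ _) (subst Π (sym same-kernel)
          (Equivalence.to (equivalent _ _) (Equivalence.from (composition-correct n t X) (c , L′c)))))

    module _ (x : Vec Bool n) where

      verifyV-advice : ∀ y → verifyV (⟨ Vec.toList x , adviceWord ⟩ , y) ≡
        seekV (program segments) (tape [] blank (map bit (reverse (Vec.toList x))))
              (wordTape (map bit (reverse ⟨ ⟨ Vec.toList x , adviceWord ⟩ , [] ⟩)) y)
      verifyV-advice y = trans (verifyV-⟨⟩ (Vec.toList x) adviceWord y)
        (cong (λ ops → seekV ops (tape [] blank (map bit (reverse (Vec.toList x))))
          (wordTape (map bit (reverse ⟨ ⟨ Vec.toList x , adviceWord ⟩ , [] ⟩)) y)) decode-adviceWord)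

      -- The components read from the certificate may be anything, even yes-instances: a kernel
      -- shared with a tuple of no-instances excludes a yes-instance at every position, in
      -- particular at the position `c` of `x`.
      rejected : ∀ y → verifyV (⟨ Vec.toList x , adviceWord ⟩ , y) ≡ true → ¬ L′ (Vec.toList x)
      rejected y h L′x with seekV-sound x segments _ (trans (sym (verifyV-advice y)) h)
      ... | c , z , ty , p∈ , z≡ = image-no (Compile.tapeData c kernel x ty)
              (proj₂ (∈-cartesianProduct⁻ (allFin t) targets p∈)) z≡ c
              (subst (L′ ∘ Vec.toList) (vec-ext λ j → sym (trans (Vec.lookup∘tabulate _ j) (own j))) L′x)
        where
        own : ∀ j → Compile.tapeData c {g} kernel x ty (c , j) ≡ Vec.lookup x j
        own j with c Fin.≟ c
        ... | yes _ = refl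
        ... | no ne = contradiction refl ne

      -- The certificate selects one of at most `t * suc n` segments in unary and then spells out
      -- the `t * n` bits of a tuple of no-instances through which `x` hits a target.
      accepted : ¬ L′ (Vec.toList x) → ∃[ y ] length y ≤ t * suc n + t * n × verifyV (⟨ Vec.toList x , adviceWord ⟩ , y) ≡ true
      accepted ¬L′x with proj₂ (proj₂ (proj₂ cover)) (∈-select⁺ noInstance (∈-allVecs⁺ x (λ i → ∈-bits _)) (noInstance-complete x ¬L′x))
      ... | z , z∈ , hit with find (dec-sound (hit? x z) hit)
      ... | v , _ , (c , v≡) , e≡ = y ,
            ℕ.≤-trans y≤ (ℕ.+-mono-≤ length-segments (ℕ.≤-reflexive (List.length-tabulate flat))) ,
            trans (verifyV-advice y) (ok _)
        where
        flat : Fin (t * n) → Bool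
        flat i = assignment v (Fin.remQuot n i)
        data≡ : ∀ bs i → Compile.tapeData c {g} kernel x (wordTape bs (List.tabulate flat)) i ≡ assignment v i
        data≡ bs (c′ , j) with c Fin.≟ c′
        ... | yes refl = cong (λ u → Vec.lookup u j) (sym v≡)
        ... | no _     = trans (cong bitOf (trans (rightOf-wordTape bs (List.tabulate flat) _) (nth-tabulate flat (Fin.combine c′ j))))
                               (cong (assignment v) (Fin.remQuot-combine c′ j))
        image≡ : ∀ bs → Compile.image c {g} kernel x (wordTape bs (List.tabulate flat)) literals (parameter n) ≡ z
        image≡ bs = trans (cong (λ w → encodeInstance (kernel (w , parameter n)))
          (List.map-cong (evalL-cong (data≡ bs)) literals)) e≡
        completed = seekV-complete x (List.tabulate flat) segments (∈-cartesianProduct⁺ (∈-allFin c) z∈) image≡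
        y = proj₁ completed
        y≤ = proj₁ (proj₂ completed)
        ok = proj₂ (proj₂ completed)

  tuples-polyBounded : PolyBounded tuples
  tuples-polyBounded = pb-suc (pb-suc (pb-+ (pb-+ m m) m))
    where m = pb-∘ kernelBound (Composition.parameter-polyBounded composition)

  certificate-polyBounded : PolyBounded (λ n → tuples n * suc n + tuples n * n)
  certificate-polyBounded = pb-+ (pb-* tuples-polyBounded (pb-suc pb-id)) (pb-* tuples-polyBounded pb-id)

  advice-polyBounded : PolyBounded (λ n → length (Advice.adviceWord n))
  advice-polyBounded = pb-≤ advice-length (pb-* (pb-const 4) (pb-* (pb-* tuples-polyBounded (pb-suc pb-id))
    (pb-+ (pb-+ (pb-+ (pb-const 4) (Composition.parameter-polyBounded composition))
      (pb-* (Composition.template-polyBounded composition tuples-polyBounded)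
            (pb-suc (pb-* (pb-const 2) (pb-+ (pb-* tuples-polyBounded pb-id) pb-id)))))
      tuples-polyBounded)))
    where
    advice-length : ∀ n → length (Advice.adviceWord n) ≤ 4 * (tuples n * suc n *
      (4 + parameter n + length (template n (tuples n)) * suc (2 * (tuples n * n + n)) + tuples n))
    advice-length n = begin
      length adviceWord             ≡⟨ length-adviceWord ⟩
      4 * length (program segments)
        ≤⟨ ℕ.*-monoʳ-≤ 4 (ℕ.≤-trans
             (length-program segments (tuples n) λ {p} p∈ →
               ℕ.m≤n⇒m≤1+n (target-length (proj₂ (∈-cartesianProduct⁻ (allFin t) targets p∈))))
             (ℕ.*-monoˡ-≤ _ length-segments)) ⟩
      4 * (tuples n * suc n * (4 + parameter n + length (template n (tuples n)) * suc (2 * (tuples n * n + n)) + tuples n)) ∎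
      where
      open ℕ.≤-Reasoning
      open Advice n

  certificateBound : Polynomial
  certificateBound = PolyBounded.poly certificate-polyBounded

  Verified : Language
  Verified w = ∃[ y ] length y ≤ ⟦ certificateBound ⟧ (length w) × verifyV (w , y) ≡ true

  verified-NP : InNP Verified
  verified-NP = record
    { verify = verifyV ; verifyPoly = Verifier.verifyV-polyTime ; bound = certificateBound ; correct = λ x → mk⇔ id id }

  distill : InNP/poly L
  distill = record
    { L′          = Verified
    ; L′∈NP       = verified-NP
    ; advice      = λ n → Advice.adviceWord n
    ; bound       = PolyBounded.poly advice-polyBounded
    ; adviceBound = PolyBounded.bounds advice-polyBounded
    ; correct     = λ x → subst (λ w → L w ⇔ Verified ⟨ w , Advice.adviceWord (length x) ⟩) (Vec.toList∘fromList x)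
        (mk⇔ (to (Vec.fromList x)) (from (Vec.fromList x)))
    }
    where
    to : ∀ {n} (x : Vec Bool n) → L (Vec.toList x) → Verified ⟨ Vec.toList x , Advice.adviceWord n ⟩
    to {n} x Lx =
      let y , y≤ , v = Advice.accepted n x (proj₁ L≐∁L′ Lx) in
      y , ℕ.≤-trans y≤ (ℕ.≤-trans (PolyBounded.bounds certificate-polyBounded n)
            (Polynomial-mono certificateBound n≤)) , v
      where
      n≤ : n ≤ length ⟨ Vec.toList x , Advice.adviceWord n ⟩
      n≤ = subst₂ _≤_ (Vec.length-toList x) (sym (length-⟨⟩ (Vec.toList x) _))
        (ℕ.≤-trans (ℕ.m≤m+n _ _) (ℕ.≤-trans (ℕ.m≤m+n _ _) (ℕ.n≤1+n _)))
    from : ∀ {n} (x : Vec Bool n) → Verified ⟨ Vec.toList x , Advice.adviceWord n ⟩ → L (Vec.toList x)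
    from {n} x (y , _ , v) = proj₂ L≐∁L′ (Advice.rejected n x y v)

theorem5p3 : (PolynomialKernel Embedding → coNP ⊆ NP/poly) ×
    (PolynomialKernel Poset-∃FO-ModelChecking → coNP ⊆ NP/poly) ×
    (PolynomialKernel Poset-FO-ModelChecking → coNP ⊆ NP/poly)
theorem5p3 =
  (λ K (_ , np , L≐∁L′) → distill np (embedding-composition np) L≐∁L′ K) ,
  (λ K (_ , np , L≐∁L′) → distill np (modelChecking-composition np Existential id) L≐∁L′ K) ,
  (λ K (_ , np , L≐∁L′) → distill np (modelChecking-composition np U _) L≐∁L′ K)
  where
  open Compositions using (embedding-composition; modelChecking-composition)
  open Distillation using (distill)
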